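{- Let $i$ and $b$ be positive integers, and write $i(P)=|\operatorname{int}(P)\cap\mathbb{Z}^2|$, $b(P)=|\partial P\cap\mathbb{Z}^2|$. (1) If $2 \le b \le 3i+5$, there exists a convex polygon $P\subset\mathbb{R}^2$ of denominator $3$ that is pseudointegral with $i(P)=i$ and $b(P)=b$. (2) If $2 \le b \le 4i+4$, there exists a convex polygon $P\subset\mathbb{R}^2$ of denominator $4$ that is pseudointegral with $i(P)=i$ and $b(P)=b$. (3) If $2 \le b \le 5i+4$, there exists a convex polygon $P\subset\mathbb{R}^2$ of denominator $10$ that is pseudointegral with $i(P)=i$ and $b(P)=b$.
   Context: The denominator of a rational polygon $P$ is the least positive integer $k$ such that $kP$ has all vertices in $\mathbb{Z}^2$. A polygon $P$ is pseudointegral if $t \mapsto |tP \cap \mathbb{Z}^2|$ ($t\in\mathbb{Z}_{>0}$) is a polynomial function of $t$. $\operatorname{int}$ and $\partial$ denote topological interior and boundary. -}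

module Defs where

open import Data.Nat as ℕ using (ℕ; suc; NonZero)
open import Data.Nat.DivMod using (_%_; m%n<n)
open import Data.Integer using (ℤ; +_)
open import Data.Rational using (ℚ; _/_; _+_; _-_; _*_; _<_; _≤_; 0ℚ; ↧ₙ_)
open import Data.Fin using (Fin; toℕ; fromℕ<)
open import Data.Product using (Σ; _×_; _,_; proj₁; proj₂)
open import Data.List using (List; length; foldr)
open import Data.List.Relation.Unary.Unique.Propositional using (Unique)
open import Data.List.Membership.Propositional using (_∈_)
open import Function.Bundles using (_⇔_)
open import Relation.Binary.PropositionalEquality using (_≡_; _≢_)
open import Relation.Nullary using (¬_)

Point : Set
Point = ℚ × ℚ

ℤtoℚ : ℤ → ℚ
ℤtoℚ z = z / 1

ℕtoℚ : ℕ → ℚ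
ℕtoℚ n = (+ n) / 1

latticePt : ℤ × ℤ → Point
latticePt (x , y) = (ℤtoℚ x , ℤtoℚ y)

-- cross (b - a) × (c - a); positive iff c lies strictly to the left of the directed line a→b
cross : Point → Point → Point → ℚ
cross (ax , ay) (bx , by) (cx , cy) = ((bx - ax) * (cy - ay)) - ((by - ay) * (cx - ax))

next : ∀ {n} → Fin (suc n) → Fin (suc n)
next {n} j = fromℕ< (m%n<n (suc (toℕ j)) (suc n))

-- A convex polygon in ℝ² with rational vertices, given by its vertices
-- v_0, …, v_{m-1} (m = 3 + extra ≥ 3) in counterclockwise order: every vertex
-- not on an edge lies strictly to the left of that edge.  This says exactly that
-- the v_j are the vertices of a (2-dimensional) convex polygon, listed cyclically.
record ConvexPolygon : Set where
  field
    extra : ℕ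
    vert  : Fin (suc (suc (suc extra))) → Point
    convex : ∀ j m → m ≢ j → m ≢ next j → 0ℚ < cross (vert j) (vert (next j)) (vert m)

open ConvexPolygon public

scalePt : ℚ → Point → Point
scalePt c (x , y) = (c * x , c * y)

InDil : ℕ → ConvexPolygon → Point → Set
InDil t P x = ∀ j → 0ℚ ≤ cross (scalePt (ℕtoℚ t) (vert P j)) (scalePt (ℕtoℚ t) (vert P (next j))) x

InP : ConvexPolygon → Point → Set
InP P x = ∀ j → 0ℚ ≤ cross (vert P j) (vert P (next j)) x

InInt : ConvexPolygon → Point → Set
InInt P x = ∀ j → 0ℚ < cross (vert P j) (vert P (next j)) x

InBd : ConvexPolygon → Point → Set
InBd P x = InP P x × ¬ InInt P x

HasCard : (ℤ × ℤ → Set) → ℕ → Set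
HasCard A n = Σ (List (ℤ × ℤ)) λ L → Unique L × (length L ≡ n) × (∀ z → (z ∈ L) ⇔ A z)

HasInteriorCount : ConvexPolygon → ℕ → Set
HasInteriorCount P n = HasCard (λ z → InInt P (latticePt z)) n

HasBoundaryCount : ConvexPolygon → ℕ → Set
HasBoundaryCount P n = HasCard (λ z → InBd P (latticePt z)) n

IsIntegral : ℚ → Set
IsIntegral q = ↧ₙ q ≡ 1

IntegralPt : Point → Set
IntegralPt (x , y) = IsIntegral x × IsIntegral y

VerticesIntegralAfter : ℕ → ConvexPolygon → Set
VerticesIntegralAfter k P = ∀ j → IntegralPt (scalePt (ℕtoℚ k) (vert P j))

HasDenominator : ConvexPolygon → ℕ → Set
HasDenominator P d = (1 ℕ.≤ d) × VerticesIntegralAfter d P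
                   × (∀ k → 1 ℕ.≤ k → k ℕ.< d → ¬ VerticesIntegralAfter k P)

evalPoly : List ℚ → ℚ → ℚ
evalPoly cs x = foldr (λ c acc → c + (x * acc)) 0ℚ cs

Pseudointegral : ConvexPolygon → Set
Pseudointegral P = Σ (List ℚ) λ cs → ∀ t → 1 ℕ.≤ t →
  Σ ℕ λ n → HasCard (λ z → InDil t P (latticePt z)) n × (evalPoly cs (ℕtoℚ t) ≡ ℕtoℚ n)

{-# OPTIONS --safe #-}

-- For k = 3, 4, 5 (denominators 3, 4, 10) and m = 2, 1, 1 consider the polygon with, counterclockwise, apex
-- (-m/k, 1 + 1/k), origin (0, 0), base (b - 2, 0), elbow (i + (b - 3)(1 - 1/k), 1/k) and shoulder (i, 1).  For k = 4 there
-- is one more vertex, the notch (-1/2, 1/2), between apex and origin; for k = 5 the origin is moved to (-1/2, 0).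
-- Its lattice points are (0, 0), …, (b - 2, 0) and (i, 1) on the boundary and (0, 1), …, (i - 1, 1) inside.
--
-- In the t-th dilate, row n ends on the right at
--   i ((k + 1) t - k n) + m (t - n) - γ (t ∸ n) - (i - 1) (t ∸ k n),   γ = k i + m + 3 - b ≥ 0,
-- so every side on the right meets every row in a lattice point although elbow and apex are not integral.  Summed over the
-- rows, (k + 1) t - k n and t ∸ k n cancel up to a polynomial in t; hence i and γ contribute polynomially, and only the
-- polygon with i = 1 and γ = 0 remains to be counted.  For it, passing from t to t + k while shifting the rows by
-- k + 1 leaves the row lengths unchanged, apart from k + 1 new rows at the bottom (and, for k = 4, the rows below the
-- notch, which are accounted for separately).

module Submission where

open import Defs
open import Data.Bool using (T)
open import Data.Bool.Properties using (T?)
open import Data.Fin as Fin using (Fin)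
open import Data.Fin.Patterns using (0F; 1F; 2F; 3F; 4F; 5F)
import Data.Fin.Properties as Fin
open import Data.Integer as ℤ using (ℤ; +_; -[1+_]; 0ℤ; 1ℤ)
import Data.Integer.GCD as ℤ
import Data.Integer.Properties as ℤ
open import Algebra.Properties.AbelianGroup ℤ.+-0-abelianGroup using () renaming (∙-cancelˡ to +-cancelˡ)
open import Data.Integer.Solver using (module +-*-Solver)
open import Data.Integer.Tactic.RingSolver using (solve-∀)
open import Data.List as List using (List; []; _∷_; _++_; map; upTo; length)
open import Data.List.Membership.Propositional using (_∈_)
open import Data.List.Membership.Propositional.Properties using (∈-++⁺ˡ; ∈-++⁺ʳ; ∈-++⁻; ∈-map⁺; ∈-map⁻; ∈-upTo⁺; ∈-upTo⁻)
open import Data.List.Properties using (length-++; length-map; length-upTo)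
open import Data.List.Relation.Unary.AllPairs using ([])
open import Data.List.Relation.Unary.Unique.Propositional using (Unique)
open import Data.List.Relation.Unary.Unique.Propositional.Properties using (++⁺; map⁺; upTo⁺)
open import Data.Maybe as Maybe using (Maybe; just; nothing; is-just; to-witness-T)
open import Data.Nat as ℕ using (ℕ; zero; suc; _/_; _∸_; _⊓_; s≤s; z≤n; NonZero)
import Data.Nat.Divisibility.Core as Divides
import Data.Nat.DivMod as ℕ
import Data.Nat.Properties as ℕ
open import Data.Product using (Σ; _×_; _,_; proj₁; proj₂)
open import Data.Rational as ℚ using (ℚ; 0ℚ; 1ℚ; ½; toℚᵘ; ↧ₙ_)
import Data.Rational.Properties as ℚ
import Data.Rational.Solver as ℚ-Solver
open import Data.Rational.Unnormalised as ℚᵘ using (mkℚᵘ; *≡*; *≤*; *<*)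
import Data.Rational.Unnormalised.Properties as ℚᵘ
open import Data.Sum using (_⊎_; inj₁; inj₂)
open import Data.Vec using (Vec; []; _∷_; lookup)
open import Function.Bundles using (_⇔_; mk⇔; Equivalence)
open import Function.Properties.Equivalence using () renaming (sym to ⇔-sym; trans to ⇔-trans)
open import Relation.Binary.PropositionalEquality
open import Relation.Nullary using (¬_; Dec; yes; no; contradiction)
open import Relation.Nullary.Decidable using (True; toWitness; _⊎-dec_)
open Equivalence using (to; from)

-- Reduction of convexity and of lattice point membership to integer inequalities

-- The forms of the right sides have x-coefficient -1, so solving them for x needs no division.
-- Rounding occurs only on the left, where row n begins at -⌊n / 2⌋ (k = 3), -min(n, ⌊(2 t - n) /
-- 3⌋) (k = 4) or -⌊(2 t - n) / 4⌋ (k = 5). These floors are the obstacle: they depend on residues,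
-- yet the count must be a polynomial. For i = 1 and γ = 0, elbow and shoulder lie on the segment
-- from base to apex. Since k times the apex is the lattice point (-m, k + 1), translation by it
-- carries tP onto the part of (t + k)P from height k + 1 upwards, provided that for k = 4 the side
-- beyond the notch is prolonged to the bottom. Hence the shift by k + 1 rows; m is how far the left
-- side advances meanwhile. It remains to add up the floors in the new rows, and Hermite's identity
-- makes this sum linear in t. The resulting polynomial is the one that Pick's formula predicts: its
-- doubled coefficients are b + 2 i - 2, b and 2. Elbow, shoulder and bottom edge can each
-- degenerate, so every family consists of several combinatorial shapes whose convexity must be
-- checked separately.

toℚᵘ-ℤtoℚ : ∀ z → toℚᵘ (ℤtoℚ z) ℚᵘ.≃ mkℚᵘ z 0
toℚᵘ-ℤtoℚ z = ℚ.toℚᵘ-fromℚᵘ (mkℚᵘ z 0)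

ℤtoℚ-+ : ∀ a b → ℤtoℚ (a ℤ.+ b) ≡ ℤtoℚ a ℚ.+ ℤtoℚ b
ℤtoℚ-+ a b = ℚ.toℚᵘ-injective (begin
  toℚᵘ (ℤtoℚ (a ℤ.+ b))                   ≈⟨ toℚᵘ-ℤtoℚ (a ℤ.+ b) ⟩
  mkℚᵘ (a ℤ.+ b) 0                        ≈⟨ *≡* (cong (ℤ._* 1ℤ) (sym (cong₂ ℤ._+_ (ℤ.*-identityʳ a) (ℤ.*-identityʳ b)))) ⟩
  mkℚᵘ a 0 ℚᵘ.+ mkℚᵘ b 0                  ≈⟨ ℚᵘ.+-cong (toℚᵘ-ℤtoℚ a) (toℚᵘ-ℤtoℚ b) ⟨
  toℚᵘ (ℤtoℚ a) ℚᵘ.+ toℚᵘ (ℤtoℚ b)        ≈⟨ ℚ.toℚᵘ-homo-+ (ℤtoℚ a) (ℤtoℚ b) ⟨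
  toℚᵘ (ℤtoℚ a ℚ.+ ℤtoℚ b)                ∎)
  where open ℚᵘ.≃-Reasoning

ℤtoℚ-* : ∀ a b → ℤtoℚ (a ℤ.* b) ≡ ℤtoℚ a ℚ.* ℤtoℚ b
ℤtoℚ-* a b = ℚ.toℚᵘ-injective (begin
  toℚᵘ (ℤtoℚ (a ℤ.* b))                   ≈⟨ toℚᵘ-ℤtoℚ (a ℤ.* b) ⟩
  mkℚᵘ a 0 ℚᵘ.* mkℚᵘ b 0                  ≈⟨ ℚᵘ.*-cong (toℚᵘ-ℤtoℚ a) (toℚᵘ-ℤtoℚ b) ⟨
  toℚᵘ (ℤtoℚ a) ℚᵘ.* toℚᵘ (ℤtoℚ b)        ≈⟨ ℚ.toℚᵘ-homo-* (ℤtoℚ a) (ℤtoℚ b) ⟨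
  toℚᵘ (ℤtoℚ a ℚ.* ℤtoℚ b)                ∎)
  where open ℚᵘ.≃-Reasoning

ℤtoℚ-neg : ∀ a → ℤtoℚ (ℤ.- a) ≡ ℚ.- ℤtoℚ a
ℤtoℚ-neg a = ℚ.toℚᵘ-injective (begin
  toℚᵘ (ℤtoℚ (ℤ.- a))     ≈⟨ toℚᵘ-ℤtoℚ (ℤ.- a) ⟩
  ℚᵘ.- mkℚᵘ a 0           ≈⟨ ℚᵘ.-‿cong (toℚᵘ-ℤtoℚ a) ⟨
  ℚᵘ.- toℚᵘ (ℤtoℚ a)      ≈⟨ ℚ.toℚᵘ-homo‿- (ℤtoℚ a) ⟨
  toℚᵘ (ℚ.- ℤtoℚ a)       ∎)
  where open ℚᵘ.≃-Reasoning

ℤtoℚ-- : ∀ a b → ℤtoℚ (a ℤ.- b) ≡ ℤtoℚ a ℚ.- ℤtoℚ b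
ℤtoℚ-- a b = trans (ℤtoℚ-+ a (ℤ.- b)) (cong (ℤtoℚ a ℚ.+_) (ℤtoℚ-neg b))

ℤtoℚ-0≤ : ∀ {z} → (0ℚ ℚ.≤ ℤtoℚ z) ⇔ (0ℤ ℤ.≤ z)
ℤtoℚ-0≤ {z} = mk⇔
  (λ 0≤q → ℚᵘ≤⇒ (ℚᵘ.≤-respʳ-≃ (toℚᵘ-ℤtoℚ z) (ℚ.toℚᵘ-mono-≤ 0≤q)))
  (λ 0≤z → ℚ.toℚᵘ-cancel-≤ (ℚᵘ.≤-respʳ-≃ (ℚᵘ.≃-sym (toℚᵘ-ℤtoℚ z))
    (*≤* (subst (0ℤ ℤ.≤_) (sym (ℤ.*-identityʳ z)) 0≤z))))
  where
  ℚᵘ≤⇒ : mkℚᵘ 0ℤ 0 ℚᵘ.≤ mkℚᵘ z 0 → 0ℤ ℤ.≤ z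
  ℚᵘ≤⇒ (*≤* p) = subst (0ℤ ℤ.≤_) (ℤ.*-identityʳ z) p

ℤtoℚ-0< : ∀ {z} → (0ℚ ℚ.< ℤtoℚ z) ⇔ (0ℤ ℤ.< z)
ℤtoℚ-0< {z} = mk⇔
  (λ 0<q → ℚᵘ<⇒ (ℚᵘ.<-respʳ-≃ (toℚᵘ-ℤtoℚ z) (ℚ.toℚᵘ-mono-< 0<q)))
  (λ 0<z → ℚ.toℚᵘ-cancel-< (ℚᵘ.<-respʳ-≃ (ℚᵘ.≃-sym (toℚᵘ-ℤtoℚ z))
    (*<* (subst (0ℤ ℤ.<_) (sym (ℤ.*-identityʳ z)) 0<z))))
  where
  ℚᵘ<⇒ : mkℚᵘ 0ℤ 0 ℚᵘ.< mkℚᵘ z 0 → 0ℤ ℤ.< z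
  ℚᵘ<⇒ (*<* p) = subst (0ℤ ℤ.<_) (ℤ.*-identityʳ z) p

0≤-scaleℚ : ∀ {c} → 0ℚ ℚ.< c → ∀ q → (0ℚ ℚ.≤ c ℚ.* q) ⇔ (0ℚ ℚ.≤ q)
0≤-scaleℚ {c} 0<c q = mk⇔
  (λ p → ℚ.*-cancelˡ-≤-pos c (subst (ℚ._≤ c ℚ.* q) (sym (ℚ.*-zeroʳ c)) p))
  (λ p → subst (ℚ._≤ c ℚ.* q) (ℚ.*-zeroʳ c) (ℚ.*-monoˡ-≤-nonNeg c p))
  where instance
    _ = ℚ.positive 0<c
    _ = ℚ.pos⇒nonNeg c

0<-scaleℚ : ∀ {c} → 0ℚ ℚ.< c → ∀ q → (0ℚ ℚ.< c ℚ.* q) ⇔ (0ℚ ℚ.< q)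
0<-scaleℚ {c} 0<c q = mk⇔
  (λ p → ℚ.*-cancelˡ-<-nonNeg c (subst (ℚ._< c ℚ.* q) (sym (ℚ.*-zeroʳ c)) p))
  (λ p → subst (ℚ._< c ℚ.* q) (ℚ.*-zeroʳ c) (ℚ.*-monoʳ-<-pos c p))
  where instance
    _ = ℚ.positive 0<c
    _ = ℚ.pos⇒nonNeg c

-- With e = 1/d, `e * a` is the vertex coordinate with numerator a and `e * (d * x)` is the lattice
-- coordinate x. Taking out e² τ leaves an expression that is integral for integral data, so its
-- sign can be decided in ℤ.
scaled-cross : ∀ e d τ a₁ a₂ b₁ b₂ x y →
  cross (scalePt τ (e ℚ.* a₁ , e ℚ.* a₂)) (scalePt τ (e ℚ.* b₁ , e ℚ.* b₂)) (e ℚ.* (d ℚ.* x) , e ℚ.* (d ℚ.* y))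
    ≡ (e ℚ.* e ℚ.* τ) ℚ.* ((b₁ ℚ.- a₁) ℚ.* (d ℚ.* y ℚ.- τ ℚ.* a₂) ℚ.- (b₂ ℚ.- a₂) ℚ.* (d ℚ.* x ℚ.- τ ℚ.* a₁))
scaled-cross = solve 9 (λ e d τ a₁ a₂ b₁ b₂ x y →
    ((τ :* (e :* b₁) :- τ :* (e :* a₁)) :* (e :* (d :* y) :- τ :* (e :* a₂)))
      :- ((τ :* (e :* b₂) :- τ :* (e :* a₂)) :* (e :* (d :* x) :- τ :* (e :* a₁)))
    := (e :* e :* τ) :* ((b₁ :- a₁) :* (d :* y :- τ :* a₂) :- (b₂ :- a₂) :* (d :* x :- τ :* a₁)))
    refl
  where open ℚ-Solver.+-*-Solver

-- The hypothesis trades the factor e² for e³ d. This gives the test of a third vertex the shape of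
-- `scaled-cross` with τ = d: a vertex of P is a lattice point of the d-th dilate.
homogeneous-cross : ∀ e d a₁ a₂ b₁ b₂ c₁ c₂ → d ℚ.* e ≡ 1ℚ →
  cross (e ℚ.* a₁ , e ℚ.* a₂) (e ℚ.* b₁ , e ℚ.* b₂) (e ℚ.* c₁ , e ℚ.* c₂)
    ≡ (e ℚ.* e ℚ.* e) ℚ.* ((b₁ ℚ.- a₁) ℚ.* (d ℚ.* c₂ ℚ.- d ℚ.* a₂) ℚ.- (b₂ ℚ.- a₂) ℚ.* (d ℚ.* c₁ ℚ.- d ℚ.* a₁))
homogeneous-cross e d a₁ a₂ b₁ b₂ c₁ c₂ d*e≡1 = begin
  cross (e ℚ.* a₁ , e ℚ.* a₂) (e ℚ.* b₁ , e ℚ.* b₂) (e ℚ.* c₁ , e ℚ.* c₂)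
    ≡⟨ solve 7 (λ e a₁ a₂ b₁ b₂ c₁ c₂ →
         (e :* b₁ :- e :* a₁) :* (e :* c₂ :- e :* a₂) :- (e :* b₂ :- e :* a₂) :* (e :* c₁ :- e :* a₁)
         := con 1ℚ :* (e :* e :* ((b₁ :- a₁) :* (c₂ :- a₂) :- (b₂ :- a₂) :* (c₁ :- a₁))))
       refl e a₁ a₂ b₁ b₂ c₁ c₂ ⟩
  1ℚ ℚ.* (e ℚ.* e ℚ.* ((b₁ ℚ.- a₁) ℚ.* (c₂ ℚ.- a₂) ℚ.- (b₂ ℚ.- a₂) ℚ.* (c₁ ℚ.- a₁)))
    ≡⟨ cong (ℚ._* (e ℚ.* e ℚ.* ((b₁ ℚ.- a₁) ℚ.* (c₂ ℚ.- a₂) ℚ.- (b₂ ℚ.- a₂) ℚ.* (c₁ ℚ.- a₁)))) d*e≡1 ⟨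
  (d ℚ.* e) ℚ.* (e ℚ.* e ℚ.* ((b₁ ℚ.- a₁) ℚ.* (c₂ ℚ.- a₂) ℚ.- (b₂ ℚ.- a₂) ℚ.* (c₁ ℚ.- a₁)))
    ≡⟨ solve 8 (λ e d a₁ a₂ b₁ b₂ c₁ c₂ →
         (d :* e) :* (e :* e :* ((b₁ :- a₁) :* (c₂ :- a₂) :- (b₂ :- a₂) :* (c₁ :- a₁)))
         := (e :* e :* e) :* ((b₁ :- a₁) :* (d :* c₂ :- d :* a₂) :- (b₂ :- a₂) :* (d :* c₁ :- d :* a₁)))
       refl e d a₁ a₂ b₁ b₂ c₁ c₂ ⟩
  (e ℚ.* e ℚ.* e) ℚ.* ((b₁ ℚ.- a₁) ℚ.* (d ℚ.* c₂ ℚ.- d ℚ.* a₂) ℚ.- (b₂ ℚ.- a₂) ℚ.* (d ℚ.* c₁ ℚ.- d ℚ.* a₁)) ∎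
  where
  open ≡-Reasoning
  open ℚ-Solver.+-*-Solver

module Scaled (D-1 : ℕ) where
  D : ℕ
  D = suc D-1

  ε : ℚ
  ε = 1ℤ ℚ./ D

  /-ε : ∀ z → z ℚ./ D ≡ ε ℚ.* ℤtoℚ z
  /-ε z = ℚ.toℚᵘ-injective (begin
    toℚᵘ (z ℚ./ D)                          ≈⟨ ℚ.toℚᵘ-fromℚᵘ (mkℚᵘ z D-1) ⟩
    mkℚᵘ z D-1                            ≈⟨ *≡* (cong₂ ℤ._*_ (sym (ℤ.*-identityˡ z)) (cong +_ (ℕ.*-identityʳ D))) ⟩
    mkℚᵘ 1ℤ D-1 ℚᵘ.* mkℚᵘ z 0             ≈⟨ ℚᵘ.*-cong (ℚ.toℚᵘ-fromℚᵘ (mkℚᵘ 1ℤ D-1)) (toℚᵘ-ℤtoℚ z) ⟨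
    toℚᵘ ε ℚᵘ.* toℚᵘ (ℤtoℚ z)             ≈⟨ ℚ.toℚᵘ-homo-* ε (ℤtoℚ z) ⟨
    toℚᵘ (ε ℚ.* ℤtoℚ z)                   ∎)
    where open ℚᵘ.≃-Reasoning

  0<ε : 0ℚ ℚ.< ε
  0<ε = ℚ.positive⁻¹ ε {{ℚ.normalize-pos 1 D}}

  D*ε : ℕtoℚ D ℚ.* ε ≡ 1ℚ
  D*ε = ℚ.toℚᵘ-injective (begin
    toℚᵘ (ℕtoℚ D ℚ.* ε)                   ≈⟨ ℚ.toℚᵘ-homo-* (ℕtoℚ D) ε ⟩
    toℚᵘ (ℕtoℚ D) ℚᵘ.* toℚᵘ ε             ≈⟨ ℚᵘ.*-cong (toℚᵘ-ℤtoℚ (+ D)) (ℚ.toℚᵘ-fromℚᵘ (mkℚᵘ 1ℤ D-1)) ⟩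
    mkℚᵘ (+ D) 0 ℚᵘ.* mkℚᵘ 1ℤ D-1         ≈⟨ *≡* (trans (ℤ.*-identityʳ _) (trans (ℤ.*-identityʳ (+ D)) (trans (cong +_ (sym (ℕ.+-identityʳ D))) (sym (ℤ.*-identityˡ (+ (D ℕ.+ 0))))))) ⟩
    toℚᵘ 1ℚ                               ∎)
    where open ℚᵘ.≃-Reasoning

  lattice-ε : ∀ z → ℤtoℚ z ≡ ε ℚ.* (ℕtoℚ D ℚ.* ℤtoℚ z)
  lattice-ε z = begin
    ℤtoℚ z                          ≡⟨ ℚ.*-identityˡ (ℤtoℚ z) ⟨
    1ℚ ℚ.* ℤtoℚ z                   ≡⟨ cong (ℚ._* ℤtoℚ z) (trans (sym D*ε) (ℚ.*-comm (ℕtoℚ D) ε)) ⟩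
    (ε ℚ.* ℕtoℚ D) ℚ.* ℤtoℚ z       ≡⟨ ℚ.*-assoc ε (ℕtoℚ D) (ℤtoℚ z) ⟩
    ε ℚ.* (ℕtoℚ D ℚ.* ℤtoℚ z)       ∎
    where open ≡-Reasoning

  point : ℤ × ℤ → Point
  point (a , b) = (a ℚ./ D , b ℚ./ D)

  -- The value of `cross` for an edge of the t-th dilate and a lattice point, multiplied by D² / t
  -- to clear denominators.
  side : ℤ × ℤ → ℤ × ℤ → ℤ → ℤ → ℤ → ℤ
  side (a₁ , a₂) (b₁ , b₂) t x y =
    (b₁ ℤ.- a₁) ℤ.* (+ D ℤ.* y ℤ.- t ℤ.* a₂) ℤ.- (b₂ ℤ.- a₂) ℤ.* (+ D ℤ.* x ℤ.- t ℤ.* a₁)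

  ℤtoℚ-side : ∀ a₁ a₂ b₁ b₂ t x y → ℤtoℚ (side (a₁ , a₂) (b₁ , b₂) t x y) ≡
    (ℤtoℚ b₁ ℚ.- ℤtoℚ a₁) ℚ.* (ℕtoℚ D ℚ.* ℤtoℚ y ℚ.- ℤtoℚ t ℚ.* ℤtoℚ a₂)
      ℚ.- (ℤtoℚ b₂ ℚ.- ℤtoℚ a₂) ℚ.* (ℕtoℚ D ℚ.* ℤtoℚ x ℚ.- ℤtoℚ t ℚ.* ℤtoℚ a₁)
  ℤtoℚ-side a₁ a₂ b₁ b₂ t x y =
    trans (ℤtoℚ-- ((b₁ ℤ.- a₁) ℤ.* (+ D ℤ.* y ℤ.- t ℤ.* a₂)) ((b₂ ℤ.- a₂) ℤ.* (+ D ℤ.* x ℤ.- t ℤ.* a₁)))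
      (cong₂ ℚ._-_ (product b₁ a₁ y a₂) (product b₂ a₂ x a₁))
    where
    difference : ∀ u v → ℤtoℚ (+ D ℤ.* u ℤ.- t ℤ.* v) ≡ ℕtoℚ D ℚ.* ℤtoℚ u ℚ.- ℤtoℚ t ℚ.* ℤtoℚ v
    difference u v = trans (ℤtoℚ-- (+ D ℤ.* u) (t ℤ.* v)) (cong₂ ℚ._-_ (ℤtoℚ-* (+ D) u) (ℤtoℚ-* t v))
    product : ∀ b a u v → ℤtoℚ ((b ℤ.- a) ℤ.* (+ D ℤ.* u ℤ.- t ℤ.* v)) ≡
      (ℤtoℚ b ℚ.- ℤtoℚ a) ℚ.* (ℕtoℚ D ℚ.* ℤtoℚ u ℚ.- ℤtoℚ t ℚ.* ℤtoℚ v)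
    product b a u v = trans (ℤtoℚ-* (b ℤ.- a) (+ D ℤ.* u ℤ.- t ℤ.* v)) (cong₂ ℚ._*_ (ℤtoℚ-- b a) (difference u v))

  pointᵋ : ℤ × ℤ → Point
  pointᵋ (a , b) = (ε ℚ.* ℤtoℚ a , ε ℚ.* ℤtoℚ b)

  point-ε : ∀ a → point a ≡ pointᵋ a
  point-ε (a , b) = cong₂ _,_ (/-ε a) (/-ε b)

  cross-dilated : ∀ t a b x y →
    cross (scalePt (ℕtoℚ t) (point a)) (scalePt (ℕtoℚ t) (point b)) (latticePt (x , y))
      ≡ (ε ℚ.* ε ℚ.* ℕtoℚ t) ℚ.* ℤtoℚ (side a b (+ t) x y)
  cross-dilated t a@(a₁ , a₂) b@(b₁ , b₂) x y = begin
    cross (scalePt τ (point a)) (scalePt τ (point b)) (latticePt (x , y))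
      ≡⟨ cong₂ (λ p q → cross (scalePt τ p) (scalePt τ q) (latticePt (x , y))) (point-ε a) (point-ε b) ⟩
    cross (scalePt τ (pointᵋ a)) (scalePt τ (pointᵋ b)) (latticePt (x , y))
      ≡⟨ cong₂ (λ p q → cross (scalePt τ (pointᵋ a)) (scalePt τ (pointᵋ b)) (p , q)) (lattice-ε x) (lattice-ε y) ⟩
    cross (scalePt τ (pointᵋ a)) (scalePt τ (pointᵋ b)) (ε ℚ.* (ℕtoℚ D ℚ.* ℤtoℚ x) , ε ℚ.* (ℕtoℚ D ℚ.* ℤtoℚ y))
      ≡⟨ scaled-cross ε (ℕtoℚ D) τ (ℤtoℚ a₁) (ℤtoℚ a₂) (ℤtoℚ b₁) (ℤtoℚ b₂) (ℤtoℚ x) (ℤtoℚ y) ⟩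
    _ ≡⟨ cong (ε ℚ.* ε ℚ.* τ ℚ.*_) (ℤtoℚ-side a₁ a₂ b₁ b₂ (+ t) x y) ⟨
    ε ℚ.* ε ℚ.* τ ℚ.* ℤtoℚ (side a b (+ t) x y) ∎
    where
    open ≡-Reasoning
    τ = ℕtoℚ t

  cross-vertices : ∀ a b c →
    cross (point a) (point b) (point c) ≡ (ε ℚ.* ε ℚ.* ε) ℚ.* ℤtoℚ (side a b (+ D) (proj₁ c) (proj₂ c))
  cross-vertices a@(a₁ , a₂) b@(b₁ , b₂) c@(c₁ , c₂) = begin
    cross (point a) (point b) (point c)
      ≡⟨ cong₂ (λ p q → cross p q (point c)) (point-ε a) (point-ε b) ⟩
    cross (pointᵋ a) (pointᵋ b) (point c)
      ≡⟨ cong (cross (pointᵋ a) (pointᵋ b)) (point-ε c) ⟩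
    cross (pointᵋ a) (pointᵋ b) (pointᵋ c)
      ≡⟨ homogeneous-cross ε (ℕtoℚ D) (ℤtoℚ a₁) (ℤtoℚ a₂) (ℤtoℚ b₁) (ℤtoℚ b₂) (ℤtoℚ c₁) (ℤtoℚ c₂) D*ε ⟩
    _ ≡⟨ cong (ε ℚ.* ε ℚ.* ε ℚ.*_) (ℤtoℚ-side a₁ a₂ b₁ b₂ (+ D) c₁ c₂) ⟨
    ε ℚ.* ε ℚ.* ε ℚ.* ℤtoℚ (side a b (+ D) c₁ c₂) ∎
    where open ≡-Reasoning

0≤-scaleℤ : ∀ {c} → 0ℤ ℤ.< c → ∀ z → (0ℤ ℤ.≤ c ℤ.* z) ⇔ (0ℤ ℤ.≤ z)
0≤-scaleℤ {c} 0<c z = mk⇔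
  (λ p → ℤ.*-cancelˡ-≤-pos 0ℤ z c (subst (ℤ._≤ c ℤ.* z) (sym (ℤ.*-zeroʳ c)) p))
  (λ p → subst (ℤ._≤ c ℤ.* z) (ℤ.*-zeroʳ c) (ℤ.*-monoˡ-≤-nonNeg c p))
  where instance
    _ = ℤ.positive 0<c
    _ = ℤ.nonNegative (ℤ.<⇒≤ 0<c)

0<-scaleℤ : ∀ {c} → 0ℤ ℤ.< c → ∀ z → (0ℤ ℤ.< c ℤ.* z) ⇔ (0ℤ ℤ.< z)
0<-scaleℤ {c} 0<c z = mk⇔
  (λ p → ℤ.*-cancelˡ-<-nonNeg c (subst (ℤ._< c ℤ.* z) (sym (ℤ.*-zeroʳ c)) p))
  (λ p → subst (ℤ._< c ℤ.* z) (ℤ.*-zeroʳ c) (ℤ.*-monoˡ-<-pos c p))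
  where instance
    _ = ℤ.positive 0<c
    _ = ℤ.nonNegative (ℤ.<⇒≤ 0<c)

0<*ℚ : ∀ {p q} → 0ℚ ℚ.< p → 0ℚ ℚ.< q → 0ℚ ℚ.< p ℚ.* q
0<*ℚ {p} {q} 0<p = from (0<-scaleℚ 0<p q)

-- The reduced denominator times gcd(z, 1) is the original denominator 1.
ℤtoℚ-integral : ∀ z → IsIntegral (ℤtoℚ z)
ℤtoℚ-integral z = ℕ.m*n≡1⇒m≡1 (↧ₙ ℤtoℚ z) ℤ.∣ ℤ.gcd z (+ 1) ∣
  (trans (sym (ℤ.abs-* (ℚ.↧ ℤtoℚ z) (ℤ.gcd z (+ 1)))) (cong ℤ.∣_∣ (ℚ.↧-/ z 1)))

-- Convex polygons described by integral linear forms

Line : Set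
Line = ℤ → ℤ → ℤ → ℤ

module ScaledPolygon (D-1 : ℕ) where
  open Scaled D-1 public

  0<εετ : ∀ t → 0ℚ ℚ.< ε ℚ.* ε ℚ.* ℕtoℚ (suc t)
  0<εετ t = 0<*ℚ {ε ℚ.* ε} {ℕtoℚ (suc t)} (0<*ℚ {ε} {ε} 0<ε 0<ε) (from (ℤtoℚ-0< {+ suc t}) (ℤ.+<+ ℕ.z<s))

  dilated-≤ : ∀ t a b x y →
    (0ℚ ℚ.≤ cross (scalePt (ℕtoℚ (suc t)) (point a)) (scalePt (ℕtoℚ (suc t)) (point b)) (latticePt (x , y)))
      ⇔ (0ℤ ℤ.≤ side a b (+ suc t) x y)
  dilated-≤ t a b x y = ⇔-trans
    (subst (λ q → (0ℚ ℚ.≤ q) ⇔ (0ℚ ℚ.≤ ℤtoℚ (side a b (+ suc t) x y))) (sym (cross-dilated (suc t) a b x y))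
      (0≤-scaleℚ (0<εετ t) (ℤtoℚ (side a b (+ suc t) x y))))
    (ℤtoℚ-0≤ {side a b (+ suc t) x y})

  dilated-< : ∀ t a b x y →
    (0ℚ ℚ.< cross (scalePt (ℕtoℚ (suc t)) (point a)) (scalePt (ℕtoℚ (suc t)) (point b)) (latticePt (x , y)))
      ⇔ (0ℤ ℤ.< side a b (+ suc t) x y)
  dilated-< t a b x y = ⇔-trans
    (subst (λ q → (0ℚ ℚ.< q) ⇔ (0ℚ ℚ.< ℤtoℚ (side a b (+ suc t) x y))) (sym (cross-dilated (suc t) a b x y))
      (0<-scaleℚ (0<εετ t) (ℤtoℚ (side a b (+ suc t) x y))))
    (ℤtoℚ-0< {side a b (+ suc t) x y})

  vertices-left : ∀ a b c → 0ℤ ℤ.< side a b (+ D) (proj₁ c) (proj₂ c) → 0ℚ ℚ.< cross (point a) (point b) (point c)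
  vertices-left a b c 0<side = subst (0ℚ ℚ.<_) (sym (cross-vertices a b c))
    (0<*ℚ {ε ℚ.* ε ℚ.* ε} {ℤtoℚ (side a b (+ D) (proj₁ c) (proj₂ c))}
      (0<*ℚ {ε ℚ.* ε} {ε} (0<*ℚ {ε} {ε} 0<ε 0<ε) 0<ε)
      (from (ℤtoℚ-0< {side a b (+ D) (proj₁ c) (proj₂ c)}) 0<side))

  -- One positive factor serves all dilates and all points, so the shorter form `ℓ` can replace the
  -- edge in every sign condition.
  Supports : Line → ℤ × ℤ → ℤ × ℤ → Set
  Supports ℓ a b = Σ ℤ λ c → 0ℤ ℤ.< c × ∀ t x y → side a b t x y ≡ c ℤ.* ℓ t x y

  LeftOf : Line → ℤ × ℤ → Set
  LeftOf ℓ (x , y) = 0ℤ ℤ.< ℓ (+ D) x y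

  module _ {n} (v : Fin (suc (suc (suc n))) → ℤ × ℤ) (ℓ : Fin (suc (suc (suc n))) → Line)
           (supports : ∀ j → Supports (ℓ j) (v j) (v (next j)))
           (leftOf : ∀ j m → m ≢ j → m ≢ next j → LeftOf (ℓ j) (v m)) where

    polygon : ConvexPolygon
    polygon = record
      { extra = n
      ; vert = λ j → point (v j)
      ; convex = λ j m m≢j m≢next →
          let c , 0<c , side≡ = supports j in
          vertices-left (v j) (v (next j)) (v m)
            (subst (0ℤ ℤ.<_) (sym (side≡ (+ D) (proj₁ (v m)) (proj₂ (v m))))
              (from (0<-scaleℤ 0<c (ℓ j (+ D) (proj₁ (v m)) (proj₂ (v m)))) (leftOf j m m≢j m≢next)))
      }

    private
      edge≤ : ∀ j t x y →
        (0ℚ ℚ.≤ cross (scalePt (ℕtoℚ (suc t)) (point (v j))) (scalePt (ℕtoℚ (suc t)) (point (v (next j)))) (latticePt (x , y)))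
          ⇔ (0ℤ ℤ.≤ ℓ j (+ suc t) x y)
      edge≤ j t x y =
        let c , 0<c , side≡ = supports j in
        ⇔-trans (dilated-≤ t (v j) (v (next j)) x y)
          (subst (λ z → (0ℤ ℤ.≤ z) ⇔ (0ℤ ℤ.≤ ℓ j (+ suc t) x y)) (sym (side≡ (+ suc t) x y)) (0≤-scaleℤ 0<c (ℓ j (+ suc t) x y)))

      edge< : ∀ j t x y →
        (0ℚ ℚ.< cross (scalePt (ℕtoℚ (suc t)) (point (v j))) (scalePt (ℕtoℚ (suc t)) (point (v (next j)))) (latticePt (x , y)))
          ⇔ (0ℤ ℤ.< ℓ j (+ suc t) x y)
      edge< j t x y =
        let c , 0<c , side≡ = supports j in
        ⇔-trans (dilated-< t (v j) (v (next j)) x y)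
          (subst (λ z → (0ℤ ℤ.< z) ⇔ (0ℤ ℤ.< ℓ j (+ suc t) x y)) (sym (side≡ (+ suc t) x y)) (0<-scaleℤ 0<c (ℓ j (+ suc t) x y)))

      undilated : ∀ j x y →
        cross (scalePt (ℕtoℚ 1) (point (v j))) (scalePt (ℕtoℚ 1) (point (v (next j)))) (latticePt (x , y))
          ≡ cross (point (v j)) (point (v (next j))) (latticePt (x , y))
      undilated j x y = cong₂ (λ p q → cross p q (latticePt (x , y))) (scale-1 (point (v j))) (scale-1 (point (v (next j))))
        where
        scale-1 : ∀ p → scalePt (ℕtoℚ 1) p ≡ p
        scale-1 (a , b) = cong₂ _,_ (ℚ.*-identityˡ a) (ℚ.*-identityˡ b)

    inDil⇔ : ∀ t x y → InDil (suc t) polygon (latticePt (x , y)) ⇔ (∀ j → 0ℤ ℤ.≤ ℓ j (+ suc t) x y)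
    inDil⇔ t x y = mk⇔ (λ h j → to (edge≤ j t x y) (h j)) (λ h j → from (edge≤ j t x y) (h j))

    inP⇔ : ∀ x y → InP polygon (latticePt (x , y)) ⇔ (∀ j → 0ℤ ℤ.≤ ℓ j 1ℤ x y)
    inP⇔ x y = mk⇔
      (λ h j → to (edge≤ j 0 x y) (subst (0ℚ ℚ.≤_) (sym (undilated j x y)) (h j)))
      (λ h j → subst (0ℚ ℚ.≤_) (undilated j x y) (from (edge≤ j 0 x y) (h j)))

    inInt⇔ : ∀ x y → InInt polygon (latticePt (x , y)) ⇔ (∀ j → 0ℤ ℤ.< ℓ j 1ℤ x y)
    inInt⇔ x y = mk⇔
      (λ h j → to (edge< j 0 x y) (subst (0ℚ ℚ.<_) (sym (undilated j x y)) (h j)))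
      (λ h j → subst (0ℚ ℚ.<_) (undilated j x y) (from (edge< j 0 x y) (h j)))

    integral-after-D : VerticesIntegralAfter D polygon
    integral-after-D j = integral (proj₁ (v j)) , integral (proj₂ (v j))
      where
      D*/D : ∀ z → ℕtoℚ D ℚ.* (z ℚ./ D) ≡ ℤtoℚ z
      D*/D z = begin
        ℕtoℚ D ℚ.* (z ℚ./ D)                ≡⟨ cong (ℕtoℚ D ℚ.*_) (/-ε z) ⟩
        ℕtoℚ D ℚ.* (ε ℚ.* ℤtoℚ z)         ≡⟨ ℚ.*-assoc (ℕtoℚ D) ε (ℤtoℚ z) ⟨
        ℕtoℚ D ℚ.* ε ℚ.* ℤtoℚ z           ≡⟨ cong (ℚ._* ℤtoℚ z) D*ε ⟩
        1ℚ ℚ.* ℤtoℚ z                     ≡⟨ ℚ.*-identityˡ (ℤtoℚ z) ⟩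
        ℤtoℚ z                            ∎
        where open ≡-Reasoning
      integral : ∀ z → IsIntegral (ℕtoℚ D ℚ.* (z ℚ./ D))
      integral z = trans (cong ↧ₙ_ (D*/D z)) (ℤtoℚ-integral z)

-- Counting lattice points row by row

HasCard-cong : ∀ {A B : ℤ × ℤ → Set} {n} → (∀ z → A z ⇔ B z) → HasCard A n → HasCard B n
HasCard-cong A⇔B (L , unique , length≡ , member) = L , unique , length≡ , λ z → ⇔-trans (member z) (A⇔B z)

Rows : ℕ → (ℕ → ℤ) → (ℕ → ℕ) → ℤ × ℤ → Set
Rows h a w (x , y) = Σ ℕ λ n → n ℕ.< h × y ≡ + n × Σ ℕ λ j → j ℕ.< w n × x ≡ a n ℤ.+ + j

total : (ℕ → ℕ) → ℕ → ℕ
total w zero    = zero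
total w (suc h) = total w h ℕ.+ w h

module _ (a : ℕ → ℤ) (w : ℕ → ℕ) where

  row : ℕ → ℕ → ℤ × ℤ
  row n j = (a n ℤ.+ + j , + n)

  rows : ℕ → List (ℤ × ℤ)
  rows zero    = []
  rows (suc h) = rows h ++ map (row h) (upTo (w h))

  rows-length : ∀ h → length (rows h) ≡ total w h
  rows-length zero    = refl
  rows-length (suc h) = trans (length-++ (rows h))
    (cong₂ ℕ._+_ (rows-length h) (trans (length-map (row h) (upTo (w h))) (length-upTo (w h))))

  ∈-rows⁻ : ∀ h {z} → z ∈ rows h → Rows h a w z
  ∈-rows⁻ (suc h) z∈ with ∈-++⁻ (rows h) z∈
  ... | inj₁ z∈rows = let n , n<h , rest = ∈-rows⁻ h z∈rows in n , ℕ.m<n⇒m<1+n n<h , rest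
  ... | inj₂ z∈row with j , j∈ , refl ← ∈-map⁻ (row h) z∈row = h , ℕ.n<1+n h , refl , j , ∈-upTo⁻ j∈ , refl

  ∈-rows⁺ : ∀ h {z} → Rows h a w z → z ∈ rows h
  ∈-rows⁺ (suc h) (n , n<1+h , refl , j , j<w , refl) with ℕ.m≤n⇒m<n∨m≡n (ℕ.s≤s⁻¹ n<1+h)
  ... | inj₁ n<h  = ∈-++⁺ˡ (∈-rows⁺ h (n , n<h , refl , j , j<w , refl))
  ... | inj₂ refl = ∈-++⁺ʳ (rows h) (∈-map⁺ (row h) (∈-upTo⁺ j<w))

  rows-unique : ∀ h → Unique (rows h)
  rows-unique zero    = []
  rows-unique (suc h) = ++⁺ (rows-unique h) (map⁺ row-injective (upTo⁺ (w h))) disjoint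
    where
    row-injective : ∀ {i j} → row h i ≡ row h j → i ≡ j
    row-injective {i} {j} eq = ℤ.+-injective (+-cancelˡ (a h) (+ i) (+ j) (cong proj₁ eq))
    disjoint : ∀ {z} → z ∈ rows h × z ∈ map (row h) (upTo (w h)) → _
    disjoint (z∈rows , z∈row) with n , n<h , refl , _ ← ∈-rows⁻ h z∈rows | _ , _ , eq ← ∈-map⁻ (row h) z∈row =
      ℕ.<-irrefl (ℤ.+-injective (cong proj₂ eq)) n<h

  rows-card : ∀ h → HasCard (Rows h a w) (total w h)
  rows-card h = rows h , rows-unique h , rows-length h , λ z → mk⇔ (∈-rows⁻ h) (∈-rows⁺ h)

module Construction where
  open import Data.Integer using (_+_; _*_; _-_; -_; _≤_; _<_)

  -- Sums over rows

  ∑ : (ℕ → ℤ) → ℕ → ℤ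
  ∑ f zero    = 0ℤ
  ∑ f (suc n) = ∑ f n + f n

  ∑-cong : ∀ {f g} n → (∀ j → j ℕ.< n → f j ≡ g j) → ∑ f n ≡ ∑ g n
  ∑-cong zero    f≡g = refl
  ∑-cong (suc n) f≡g = cong₂ _+_ (∑-cong n (λ j j<n → f≡g j (ℕ.m<n⇒m<1+n j<n))) (f≡g n (ℕ.n<1+n n))

  ∑-+ : ∀ f g n → ∑ (λ j → f j + g j) n ≡ ∑ f n + ∑ g n
  ∑-+ f g zero    = refl
  ∑-+ f g (suc n) = trans (cong (_+ (f n + g n)) (∑-+ f g n)) (interchange (∑ f n) (∑ g n) (f n) (g n))
    where
    interchange : ∀ a b c d → (a + b) + (c + d) ≡ (a + c) + (b + d)
    interchange = solve-∀

  ∑-* : ∀ c f n → ∑ (λ j → c * f j) n ≡ c * ∑ f n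
  ∑-* c f zero    = sym (ℤ.*-zeroʳ c)
  ∑-* c f (suc n) = trans (cong (_+ c * f n) (∑-* c f n)) (sym (ℤ.*-distribˡ-+ c (∑ f n) (f n)))

  ∑-split : ∀ f m n → ∑ f (m ℕ.+ n) ≡ ∑ f m + ∑ (λ j → f (m ℕ.+ j)) n
  ∑-split f m zero rewrite ℕ.+-identityʳ m = sym (ℤ.+-identityʳ (∑ f m))
  ∑-split f m (suc n) rewrite ℕ.+-suc m n =
    trans (cong (_+ f (m ℕ.+ n)) (∑-split f m n)) (ℤ.+-assoc (∑ f m) (∑ (λ j → f (m ℕ.+ j)) n) (f (m ℕ.+ n)))

  ∑-zero : ∀ f n → (∀ j → f j ≡ 0ℤ) → ∑ f n ≡ 0ℤ
  ∑-zero f zero    f≡0 = refl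
  ∑-zero f (suc n) f≡0 = cong₂ _+_ (∑-zero f n f≡0) (f≡0 n)

  ∑-total : ∀ w n → + total w n ≡ ∑ (λ j → + w j) n
  ∑-total w zero    = refl
  ∑-total w (suc n) = trans (ℤ.pos-+ (total w n) (w n)) (cong (_+ + w n) (∑-total w n))

  +-∸ : ∀ {m n} → n ℕ.≤ m → + (m ∸ n) ≡ + m - + n
  +-∸ {m} {n} n≤m = trans (sym (ℤ.⊖-≥ n≤m)) (sym (ℤ.m-n≡m⊖n m n))

  ∑-∸-extend : ∀ k t h n → t ℕ.≤ k ℕ.* h →
    ∑ (λ j → + (t ∸ k ℕ.* j)) (h ℕ.+ n) ≡ ∑ (λ j → + (t ∸ k ℕ.* j)) h
  ∑-∸-extend k t h n t≤kh = begin
    ∑ f (h ℕ.+ n)                          ≡⟨ ∑-split f h n ⟩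
    ∑ f h + ∑ (λ j → f (h ℕ.+ j)) n        ≡⟨ cong (λ s → ∑ f h + s) (∑-zero (λ j → f (h ℕ.+ j)) n vanishes) ⟩
    ∑ f h + 0ℤ                             ≡⟨ ℤ.+-identityʳ (∑ f h) ⟩
    ∑ f h                                  ∎
    where
    open ≡-Reasoning
    f = λ j → + (t ∸ k ℕ.* j)
    vanishes : ∀ j → f (h ℕ.+ j) ≡ 0ℤ
    vanishes j = cong +_ (ℕ.m≤n⇒m∸n≡0 (ℕ.≤-trans t≤kh (ℕ.*-monoʳ-≤ k (ℕ.m≤m+n h j))))

  two : ℤ
  two = + 2

  ∑-linear : ∀ a d n → two * ∑ (λ j → a - d * + j) n ≡ two * + n * a - d * (+ n * (+ n - 1ℤ))
  ∑-linear a d zero = lemma a d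
    where
    lemma : ∀ a d → + 2 * 0ℤ ≡ + 2 * 0ℤ * a - d * (0ℤ * (0ℤ - 1ℤ))
    lemma = solve-∀
  ∑-linear a d (suc n) = begin
    two * (∑ f n + (a - d * + n))                                  ≡⟨ ℤ.*-distribˡ-+ two (∑ f n) _ ⟩
    two * ∑ f n + two * (a - d * + n)                              ≡⟨ cong (_+ two * (a - d * + n)) (∑-linear a d n) ⟩
    two * + n * a - d * (+ n * (+ n - 1ℤ)) + two * (a - d * + n)   ≡⟨ lemma a d (+ n) ⟩
    two * (1ℤ + + n) * a - d * ((1ℤ + + n) * (1ℤ + + n - 1ℤ))      ≡⟨⟩
    two * + suc n * a - d * (+ suc n * (+ suc n - 1ℤ))             ∎
    where
    open ≡-Reasoning
    f = λ j → a - d * + j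
    lemma : ∀ a d n → + 2 * n * a - d * (n * (n - 1ℤ)) + + 2 * (a - d * n)
      ≡ + 2 * (1ℤ + n) * a - d * ((1ℤ + n) * (1ℤ + n - 1ℤ))
    lemma = solve-∀

  ∑-triangle : ∀ t n → two * ∑ (λ j → + (t ∸ j)) (t ℕ.+ n) ≡ + t * + t + + t
  ∑-triangle t n = begin
    two * ∑ (λ j → + (t ∸ j)) (t ℕ.+ n)
      ≡⟨ cong (two *_) (∑-cong (t ℕ.+ n) (λ j _ → cong (λ i → + (t ∸ i)) (sym (ℕ.*-identityˡ j)))) ⟩
    two * ∑ (λ j → + (t ∸ 1 ℕ.* j)) (t ℕ.+ n)
      ≡⟨ cong (two *_) (∑-∸-extend 1 t t n (ℕ.≤-reflexive (sym (ℕ.*-identityˡ t)))) ⟩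
    two * ∑ (λ j → + (t ∸ 1 ℕ.* j)) t
      ≡⟨ cong (two *_) (∑-cong t (λ j j<t → trans (cong (λ i → + (t ∸ i)) (ℕ.*-identityˡ j))
           (trans (+-∸ (ℕ.<⇒≤ j<t)) (cong (λ i → + t - i) (sym (ℤ.*-identityˡ (+ j))))))) ⟩
    two * ∑ (λ j → + t - 1ℤ * + j) t
      ≡⟨ ∑-linear (+ t) 1ℤ t ⟩
    two * + t * + t - 1ℤ * (+ t * (+ t - 1ℤ))
      ≡⟨ lemma (+ t) ⟩
    + t * + t + + t ∎
    where
    open ≡-Reasoning
    lemma : ∀ t → + 2 * t * t - 1ℤ * (t * (t - 1ℤ)) ≡ t * t + t
    lemma = solve-∀

  -- Beyond row t the two summands agree after shifting by t, so only the first t rows of the first sum survive.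
  ∑-telescope : ∀ k t q → k ℕ.* q ℕ.≤ t → t ℕ.≤ k ℕ.* suc q →
    two * (∑ (λ n → (+ k + 1ℤ) * + t - + k * + n) (t ℕ.+ suc q) - ∑ (λ n → + (t ∸ k ℕ.* n)) (t ℕ.+ suc q))
      ≡ (+ k + two) * (+ t * + t) + + k * + t
  ∑-telescope k t q kq≤t t≤k[1+q] = begin
    two * (∑ f (t ℕ.+ suc q) - ∑ g (t ℕ.+ suc q))
      ≡⟨ cong₂ (λ a b → two * (a - b)) (trans (∑-split f t (suc q)) (cong (λ z → ∑ f t + z) shifted)) truncated ⟩
    two * (∑ f t + ∑ g (suc q) - ∑ g (suc q))
      ≡⟨ cancel (∑ f t) (∑ g (suc q)) ⟩
    two * ∑ f t
      ≡⟨ ∑-linear ((+ k + 1ℤ) * + t) (+ k) t ⟩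
    two * + t * ((+ k + 1ℤ) * + t) - + k * (+ t * (+ t - 1ℤ))
      ≡⟨ expand (+ k) (+ t) ⟩
    (+ k + two) * (+ t * + t) + + k * + t ∎
    where
    open ≡-Reasoning
    f = λ n → (+ k + 1ℤ) * + t - + k * + n
    g = λ n → + (t ∸ k ℕ.* n)
    cancel : ∀ a b → + 2 * (a + b - b) ≡ + 2 * a
    cancel = solve-∀
    expand : ∀ k t → + 2 * t * ((k + 1ℤ) * t) - k * (t * (t - 1ℤ)) ≡ (k + + 2) * (t * t) + k * t
    expand = solve-∀
    shift : ∀ k t j → (k + 1ℤ) * t - k * (t + j) ≡ t - k * j
    shift = solve-∀
    shifted : ∑ (λ j → f (t ℕ.+ j)) (suc q) ≡ ∑ g (suc q)
    shifted = ∑-cong (suc q) λ j j<1+q → begin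
      (+ k + 1ℤ) * + t - + k * (+ t + + j)   ≡⟨ shift (+ k) (+ t) (+ j) ⟩
      + t - + k * + j                        ≡⟨ cong (λ i → + t - i) (ℤ.pos-* k j) ⟨
      + t - + (k ℕ.* j)                      ≡⟨ +-∸ (ℕ.≤-trans (ℕ.*-monoʳ-≤ k (ℕ.s≤s⁻¹ j<1+q)) kq≤t) ⟨
      + (t ∸ k ℕ.* j)                        ∎
    truncated : ∑ g (t ℕ.+ suc q) ≡ ∑ g (suc q)
    truncated = trans (cong (∑ g) (ℕ.+-comm t (suc q))) (∑-∸-extend k t (suc q) t t≤k[1+q])

  -- The sides are given over an arbitrary signature, so that the ring solver can be run on the same definitions.
  record Ops (A : Set) : Set where
    infixl 6 _⊕_ _⊝_
    infixl 7 _⊗_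
    field
      _⊕_ _⊝_ _⊗_ : A → A → A
      # : ℤ → A

  ℤ-ops : Ops ℤ
  ℤ-ops = record { _⊕_ = _+_ ; _⊝_ = _-_ ; _⊗_ = _*_ ; # = λ z → z }

  poly-ops : ∀ {n} → Ops (+-*-Solver.Polynomial n)
  poly-ops = record { _⊕_ = _:+_ ; _⊝_ = _:-_ ; _⊗_ = _:*_ ; # = con }
    where open +-*-Solver

  -- E = i - 1, B = b - 2, and G = γ is the slack in the bound on b.  A side of the t-th dilate is the set where its
  -- form vanishes; the forms are positive inside.  Row n ends at reach t n (t ∸ n) (t ∸ k n).
  module Lines {A : Set} (ops : Ops A) (K M E G : A) where
    open Ops ops

    I B : A
    I = # 1ℤ ⊕ E
    B = K ⊗ I ⊕ M ⊕ # 1ℤ ⊝ G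

    lower middle upper : A → A → A → A
    lower  t x y = B ⊗ t ⊝ (B ⊝ # 1ℤ ⊝ K ⊗ E) ⊗ y ⊝ x
    middle t x y = I ⊗ t ⊕ (B ⊝ # 1ℤ) ⊗ (t ⊝ y) ⊝ x
    upper  t x y = I ⊗ t ⊕ (K ⊗ I ⊕ M) ⊗ (t ⊝ y) ⊝ x

    reach : A → A → A → A → A
    reach t n a b = I ⊗ ((K ⊕ # 1ℤ) ⊗ t ⊝ K ⊗ n) ⊕ M ⊗ (t ⊝ n) ⊝ G ⊗ a ⊝ E ⊗ b

  -- Identities between the forms of the right sides and the reach

  open +-*-Solver using (solve; _:=_; con; _:+_; _:*_; _:-_; :-_)
  module Lℤ = Lines ℤ-ops

  -- Each of the three forms is the gap from x to the reach plus a remainder. At a = t ∸ n and b = t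
  -- ∸ k n all remainders are non-negative and in every row one of them vanishes, so the reach is
  -- the least of the three bounds on x.
  upper-reach : ∀ K M E G t x n a b →
    Lℤ.upper K M E G t x n ≡ (Lℤ.reach K M E G t n a b - x) + (G * a + E * b)
  upper-reach = solve 9 (λ K M E G t x n a b → let open Lines poly-ops K M E G in
    upper t x n := (reach t n a b :- x) :+ (G :* a :+ E :* b)) refl

  middle-reach : ∀ K M E G t x n a b →
    Lℤ.middle K M E G t x n ≡ (Lℤ.reach K M E G t n a b - x) + (G * (a - (t - n)) + E * b)
  middle-reach = solve 9 (λ K M E G t x n a b → let open Lines poly-ops K M E G in
    middle t x n := (reach t n a b :- x) :+ (G :* (a :- (t :- n)) :+ E :* b)) refl

  lower-reach : ∀ K M E G t x n a b →
    Lℤ.lower K M E G t x n ≡ (Lℤ.reach K M E G t n a b - x) + (G * (a - (t - n)) + E * (b - (t - K * n)))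
  lower-reach = solve 9 (λ K M E G t x n a b → let open Lines poly-ops K M E G in
    lower t x n := (reach t n a b :- x) :+ (G :* (a :- (t :- n)) :+ E :* (b :- (t :- K :* n)))) refl

  origin-lower : ∀ K M E G t n → Lℤ.lower K M E G t 0ℤ n ≡ Lℤ.B K M E G * (t - n) + (n + K * E * n)
  origin-lower = solve 6 (λ K M E G t n → let open Lines poly-ops K M E G in
    lower t (con 0ℤ) n := B :* (t :- n) :+ (n :+ K :* E :* n)) refl

  origin-middle : ∀ K M E G t n → Lℤ.middle K M E G t 0ℤ n ≡ Lℤ.B K M E G * (t - n) + (E * t + n)
  origin-middle = solve 6 (λ K M E G t n → let open Lines poly-ops K M E G in
    middle t (con 0ℤ) n := B :* (t :- n) :+ (E :* t :+ n)) refl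

  -- Concerns rows above t, where both truncated differences are 0. The line x = -m (n - t) runs
  -- from (0, t) to the apex of the dilate, and the right side lies i ((k + 1) t - k n) to its
  -- right, which vanishes at the height of the apex.
  reach-tip : ∀ K M E G t n → Lℤ.reach K M E G t n 0ℤ 0ℤ + M * (n - t) ≡ (1ℤ + E) * ((K + 1ℤ) * t - K * n)
  reach-tip = solve 6 (λ K M E G t n → let open Lines poly-ops K M E G in
    reach t n (con 0ℤ) (con 0ℤ) :+ M :* (n :- t) := (con 1ℤ :+ E) :* ((K :+ con 1ℤ) :* t :- K :* n)) refl

  lower-1 : ∀ K M E G x → Lℤ.lower K M E G 1ℤ x 1ℤ ≡ (1ℤ + E - x) + (K - 1ℤ) * E
  lower-1 = solve 5 (λ K M E G x → let open Lines poly-ops K M E G in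
    lower (con 1ℤ) x (con 1ℤ) := (con 1ℤ :+ E :- x) :+ (K :- con 1ℤ) :* E) refl
  middle-1 : ∀ K M E G x → Lℤ.middle K M E G 1ℤ x 1ℤ ≡ 1ℤ + E - x
  middle-1 = solve 5 (λ K M E G x → let open Lines poly-ops K M E G in
    middle (con 1ℤ) x (con 1ℤ) := con 1ℤ :+ E :- x) refl
  upper-1 : ∀ K M E G x → Lℤ.upper K M E G 1ℤ x 1ℤ ≡ 1ℤ + E - x
  upper-1 = solve 5 (λ K M E G x → let open Lines poly-ops K M E G in
    upper (con 1ℤ) x (con 1ℤ) := con 1ℤ :+ E :- x) refl

  ≤⇒0≤- : ∀ {a b} → a ≤ b → 0ℤ ≤ b - a
  ≤⇒0≤- = ℤ.i≤j⇒0≤j-i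

  <⇒0<- : ∀ {a b} → a < b → 0ℤ < b - a
  <⇒0<- {a} {b} a<b = subst (_< b - a) (ℤ.+-inverseʳ a) (ℤ.+-monoˡ-< (- a) a<b)

  0<-⇒< : ∀ {a b} → 0ℤ < b - a → a < b
  0<-⇒< {a} {b} 0<b-a = subst₂ _<_ (ℤ.+-identityˡ a) (cancel a b) (ℤ.+-monoˡ-< a 0<b-a)
    where
    cancel : ∀ a b → b - a + a ≡ b
    cancel = solve-∀

  0≤+ : ∀ {a b} → 0ℤ ≤ a → 0ℤ ≤ b → 0ℤ ≤ a + b
  0≤+ = ℤ.+-mono-≤

  0≤* : ∀ {a b} → 0ℤ ≤ a → 0ℤ ≤ b → 0ℤ ≤ a * b
  0≤* {+ a} {+ b} _ _ = subst (0ℤ ≤_) (ℤ.pos-* a b) (ℤ.+≤+ z≤n)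

  0≤+n : ∀ n → 0ℤ ≤ + n
  0≤+n n = ℤ.+≤+ z≤n

  m-n≤m∸n : ∀ m n → + m - + n ≤ + (m ∸ n)
  m-n≤m∸n m n with ℕ.≤-total n m
  ... | inj₁ n≤m = ℤ.≤-reflexive (sym (+-∸ n≤m))
  ... | inj₂ m≤n = ℤ.≤-trans (ℤ.i≤j⇒i-j≤0 (ℤ.+≤+ m≤n)) (0≤+n (m ∸ n))

  -- Rows of the dilates and their ends on the right

  module Strip (k m e γ B : ℕ) .{{_ : NonZero k}} (B≡ : + B ≡ Lℤ.B (+ k) (+ m) (+ e) (+ γ)) where
    K = + k
    M = + m
    E = + e
    G = + γ
    open Lℤ K M E G public using (lower; middle; upper)

    -- The sign condition `Q` is a parameter so that the closed polygon (`0ℤ ≤_`) and its interior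
    -- (`0ℤ <_`) share one description.
    Right : (ℤ → Set) → ℤ → ℤ → ℤ → Set
    Right Q t x y = Q (lower t x y) × Q (middle t x y) × Q (upper t x y)

    R : ℕ → ℕ → ℤ
    R t n = Lℤ.reach K M E G (+ t) (+ n) (+ (t ∸ n)) (+ (t ∸ k ℕ.* n))

    t-Kn≤ : ∀ t n → + t - K * + n ≤ + (t ∸ k ℕ.* n)
    t-Kn≤ t n = subst (λ z → + t - z ≤ + (t ∸ k ℕ.* n)) (ℤ.pos-* k n) (m-n≤m∸n t (k ℕ.* n))

    right⇔ : ∀ t x n → Right (0ℤ ≤_) (+ t) x (+ n) ⇔ (x ≤ R t n)
    right⇔ t x n = mk⇔ forwards backwards
      where
      a = t ∸ n
      b = t ∸ k ℕ.* n
      0≤R-x⇒ : 0ℤ ≤ R t n - x → x ≤ R t n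
      0≤R-x⇒ = ℤ.0≤i-j⇒j≤i
      drop : ∀ {z extra} → z ≡ (R t n - x) + extra → extra ≡ 0ℤ → 0ℤ ≤ z → x ≤ R t n
      drop z≡ refl 0≤z = 0≤R-x⇒ (subst (0ℤ ≤_) (trans z≡ (ℤ.+-identityʳ _)) 0≤z)
      a≡0 : t ℕ.≤ n → + a ≡ 0ℤ
      a≡0 t≤n = cong +_ (ℕ.m≤n⇒m∸n≡0 t≤n)
      b≡0 : t ℕ.≤ k ℕ.* n → + b ≡ 0ℤ
      b≡0 t≤kn = cong +_ (ℕ.m≤n⇒m∸n≡0 t≤kn)
      G-a : n ℕ.≤ t → G * (+ a - (+ t - + n)) ≡ 0ℤ
      G-a n≤t = trans (cong (G *_) (ℤ.i≡j⇒i-j≡0 (+-∸ n≤t))) (ℤ.*-zeroʳ G)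
      E-b : k ℕ.* n ℕ.≤ t → E * (+ b - (+ t - K * + n)) ≡ 0ℤ
      E-b kn≤t = trans (cong (E *_) (ℤ.i≡j⇒i-j≡0 (trans (+-∸ kn≤t) (cong (λ z → + t - z) (ℤ.pos-* k n))))) (ℤ.*-zeroʳ E)
      E-0 : t ℕ.≤ k ℕ.* n → E * + b ≡ 0ℤ
      E-0 t≤kn = trans (cong (E *_) (b≡0 t≤kn)) (ℤ.*-zeroʳ E)
      forwards : Right (0ℤ ≤_) (+ t) x (+ n) → x ≤ R t n
      -- The binding side is `lower` up to height t / k, `middle` from there to row t, and `upper`
      -- above; its remainder is the one that vanishes.
      forwards (0≤lower , 0≤middle , 0≤upper) with ℕ.≤-total n t | ℕ.≤-total (k ℕ.* n) t
      ... | inj₁ n≤t | inj₁ kn≤t = drop (lower-reach K M E G (+ t) x (+ n) (+ a) (+ b)) (cong₂ _+_ (G-a n≤t) (E-b kn≤t)) 0≤lower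
      ... | inj₁ n≤t | inj₂ t≤kn = drop (middle-reach K M E G (+ t) x (+ n) (+ a) (+ b)) (cong₂ _+_ (G-a n≤t) (E-0 t≤kn)) 0≤middle
      ... | inj₂ t≤n | _ = drop (upper-reach K M E G (+ t) x (+ n) (+ a) (+ b))
        (cong₂ _+_ (trans (cong (G *_) (a≡0 t≤n)) (ℤ.*-zeroʳ G)) (E-0 (ℕ.≤-trans t≤n (ℕ.m≤n*m n k)))) 0≤upper
      backwards : x ≤ R t n → Right (0ℤ ≤_) (+ t) x (+ n)
      backwards x≤R =
        subst (0ℤ ≤_) (sym (lower-reach K M E G (+ t) x (+ n) (+ a) (+ b)))
          (0≤+ 0≤R-x (0≤+ (0≤* (0≤+n γ) (≤⇒0≤- (m-n≤m∸n t n))) (0≤* (0≤+n e) (≤⇒0≤- (t-Kn≤ t n))))) ,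
        subst (0ℤ ≤_) (sym (middle-reach K M E G (+ t) x (+ n) (+ a) (+ b)))
          (0≤+ 0≤R-x (0≤+ (0≤* (0≤+n γ) (≤⇒0≤- (m-n≤m∸n t n))) (0≤* (0≤+n e) (0≤+n b)))) ,
        subst (0ℤ ≤_) (sym (upper-reach K M E G (+ t) x (+ n) (+ a) (+ b)))
          (0≤+ 0≤R-x (0≤+ (0≤* (0≤+n γ) (0≤+n a)) (0≤* (0≤+n e) (0≤+n b))))
        where 0≤R-x = ≤⇒0≤- x≤R

    0≤B : 0ℤ ≤ Lℤ.B K M E G
    0≤B = subst (0ℤ ≤_) B≡ (0≤+n B)

    0≤R : ∀ t n → n ℕ.≤ t → 0ℤ ≤ R t n
    0≤R t n n≤t = to (right⇔ t 0ℤ n)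
      ( subst (0ℤ ≤_) (sym (origin-lower K M E G (+ t) (+ n)))
          (0≤+ B[t-n] (0≤+ (0≤+n n) (0≤* (0≤* (0≤+n k) (0≤+n e)) (0≤+n n))))
      , subst (0ℤ ≤_) (sym (origin-middle K M E G (+ t) (+ n)))
          (0≤+ B[t-n] (0≤+ (0≤* (0≤+n e) (0≤+n t)) (0≤+n n)))
      , subst (0ℤ ≤_) (sym (ℤ.+-identityʳ _))
          (0≤+ (0≤* (0≤+n (suc e)) (0≤+n t)) (0≤* (0≤+ (0≤* (0≤+n k) (0≤+n (suc e))) (0≤+n m)) 0≤t-n)) )
      where
      0≤t-n = ≤⇒0≤- (ℤ.+≤+ n≤t)
      B[t-n] = 0≤* 0≤B 0≤t-n

    -- The apex of the t-th dilate has height t + t / k, here rounded down.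
    top-row : ℕ → ℕ
    top-row t = t ℕ.+ t / k

    ≤-top-row : ∀ t n → (n ℕ.≤ top-row t) ⇔ (k ℕ.* n ℕ.≤ (k ℕ.+ 1) ℕ.* t)
    ≤-top-row t n = mk⇔
      (λ n≤ → begin
        k ℕ.* n                   ≤⟨ ℕ.*-monoʳ-≤ k n≤ ⟩
        k ℕ.* (t ℕ.+ t / k)       ≡⟨ ℕ.*-distribˡ-+ k t (t / k) ⟩
        k ℕ.* t ℕ.+ k ℕ.* (t / k) ≡⟨ cong (k ℕ.* t ℕ.+_) (ℕ.*-comm k (t / k)) ⟩
        k ℕ.* t ℕ.+ t / k ℕ.* k   ≤⟨ ℕ.+-monoʳ-≤ (k ℕ.* t) (ℕ.m/n*n≤m t k) ⟩
        k ℕ.* t ℕ.+ t             ≡⟨ split ⟨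
        (k ℕ.+ 1) ℕ.* t           ∎)
      (λ kn≤ → begin
        n                         ≡⟨ ℕ.m*n/n≡m n k ⟨
        n ℕ.* k / k               ≤⟨ ℕ./-monoˡ-≤ k (ℕ.≤-trans (ℕ.≤-reflexive (ℕ.*-comm n k)) kn≤) ⟩
        (k ℕ.+ 1) ℕ.* t / k       ≡⟨ cong (_/ k) (trans split (cong (ℕ._+ t) (ℕ.*-comm k t))) ⟩
        (t ℕ.* k ℕ.+ t) / k       ≡⟨ ℕ.+-distrib-/-∣ˡ t (Divides.divides-refl t) ⟩
        t ℕ.* k / k ℕ.+ t / k     ≡⟨ cong (ℕ._+ t / k) (ℕ.m*n/n≡m t k) ⟩
        t ℕ.+ t / k               ∎)
      where
      open ℕ.≤-Reasoning
      split : (k ℕ.+ 1) ℕ.* t ≡ k ℕ.* t ℕ.+ t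
      split = trans (ℕ.*-distribʳ-+ t k 1) (cong (k ℕ.* t ℕ.+_) (ℕ.*-identityˡ t))

    -- The left boundary enters only through `extent`, the number of lattice points left of x = 0 in
    -- a row. `height` confines the region to rows below the apex, `tip` keeps the rows above t
    -- non-empty, and `base` is the count for i = 1 and γ = 0.
    module Count
      (extent : ℕ → ℕ → ℕ)
      (Left : (ℤ → Set) → ℤ → ℤ → ℤ → Set)
      (left⇔ : ∀ t x n → k ℕ.* n ℕ.≤ (k ℕ.+ 1) ℕ.* t → Left (0ℤ ≤_) (+ t) x (+ n) ⇔ (- (+ extent t n) ≤ x))
      (height : ∀ t x y → Left (0ℤ ≤_) t x y → 0ℤ ≤ upper t x y → K * y ≤ (K + 1ℤ) * t)
      (tip : ∀ t n → t ℕ.≤ n → k ℕ.* n ℕ.≤ (k ℕ.+ 1) ℕ.* t → m ℕ.* (n ∸ t) ℕ.≤ extent t n)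
      (base : ∀ t → two * ∑ (λ n → (K + 1ℤ) * + t - K * + n + M * (+ t - + n) + (+ extent t n + 1ℤ)) (suc (top-row t))
                      ≡ (K + M + + 3) * (+ t * + t + + t) + two)
      (1<k : 1 ℕ.< k)
      (extent-1-0 : extent 1 0 ≡ 0)
      (extent-1-1 : extent 1 1 ≡ 0)
      (left-map : ∀ {P Q t x y} → (∀ {z} → P z → Q z) → Left P t x y → Left Q t x y)
      (left-inside : ∀ j → Left (0ℤ <_) 1ℤ (+ j) 1ℤ)
      where

      Region : (ℤ → Set) → ℤ → ℤ × ℤ → Set
      Region Q t (x , y) = Q y × Right Q t x y × Left Q t x y

      -- The absolute value merely converts to ℕ: up to the top row its argument is non-negative by
      -- `-extent≤R`.
      width : ℕ → ℕ → ℕ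
      width t n = ℤ.∣ R t n + (+ extent t n + 1ℤ) ∣

      -- Every row up to the top one contains a lattice point: x = 0 if n ≤ t, and x = -m (n - t),
      -- on the segment from (0, t) to the apex, if n ≥ t.
      -extent≤R : ∀ t n → n ℕ.≤ top-row t → - (+ extent t n) ≤ R t n
      -extent≤R t n n≤top with ℕ.≤-total n t
      ... | inj₁ n≤t = ℤ.≤-trans (ℤ.neg-mono-≤ (0≤+n (extent t n))) (0≤R t n n≤t)
      ... | inj₂ t≤n = begin
        - (+ extent t n)                              ≤⟨ ℤ.neg-mono-≤ (ℤ.+≤+ (tip t n t≤n kn≤)) ⟩
        - (+ (m ℕ.* (n ∸ t)))                         ≡⟨ cong -_ (trans (ℤ.pos-* m (n ∸ t)) (cong (M *_) (+-∸ t≤n))) ⟩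
        - (M * (+ n - + t))                           ≡⟨ ℤ.+-identityˡ _ ⟨
        0ℤ - M * (+ n - + t)                          ≤⟨ ℤ.+-monoˡ-≤ (- (M * (+ n - + t))) 0≤R+tip ⟩
        R t n + M * (+ n - + t) - M * (+ n - + t)     ≡⟨ cancel (R t n) (M * (+ n - + t)) ⟩
        R t n                                         ∎
        where
        open ℤ.≤-Reasoning
        kn≤ = to (≤-top-row t n) n≤top
        cancel : ∀ a b → a + b - b ≡ a
        cancel = solve-∀
        t≤kn : t ℕ.≤ k ℕ.* n
        t≤kn = ℕ.≤-trans t≤n (ℕ.m≤n*m n k)
        R≡ : R t n ≡ Lℤ.reach K M E G (+ t) (+ n) 0ℤ 0ℤ
        R≡ = cong₂ (λ a b → Lℤ.reach K M E G (+ t) (+ n) (+ a) (+ b)) (ℕ.m≤n⇒m∸n≡0 t≤n) (ℕ.m≤n⇒m∸n≡0 t≤kn)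
        Kn≤ : K * + n ≤ (K + 1ℤ) * + t
        Kn≤ = subst₂ _≤_ (ℤ.pos-* k n) (ℤ.pos-* (k ℕ.+ 1) t) (ℤ.+≤+ kn≤)
        0≤R+tip : 0ℤ ≤ R t n + M * (+ n - + t)
        0≤R+tip = subst (0ℤ ≤_) (sym (trans (cong (_+ M * (+ n - + t)) R≡) (reach-tip K M E G (+ t) (+ n))))
          (0≤* (0≤+n (suc e)) (≤⇒0≤- Kn≤))

      width≡ : ∀ t n → n ℕ.≤ top-row t → + width t n ≡ R t n + (+ extent t n + 1ℤ)
      width≡ t n n≤top = ℤ.0≤i⇒+∣i∣≡i (subst (0ℤ ≤_) (rearrange (R t n) (+ extent t n))
        (0≤+ (≤⇒0≤- (-extent≤R t n n≤top)) (0≤+n 1)))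
        where
        rearrange : ∀ r l → r - (- l) + 1ℤ ≡ r + (l + 1ℤ)
        rearrange = solve-∀

      region⇔rows : ∀ t z → Region (0ℤ ≤_) (+ t) z ⇔ Rows (suc (top-row t)) (λ n → - (+ extent t n)) (width t) z
      region⇔rows t (x , y) = mk⇔ forwards backwards
        where
        forwards : Region (0ℤ ≤_) (+ t) (x , y) → Rows (suc (top-row t)) (λ n → - (+ extent t n)) (width t) (x , y)
        forwards (ℤ.+≤+ {n = n} _ , right@(_ , _ , 0≤upper) , left) =
          n , s≤s n≤top , refl , ℤ.∣ x + l ∣ , j<width , sym (trans (cong (λ z → - l + z) j≡) (cancel x l))
          where
          l = + extent t n
          cancel : ∀ x l → - l + (x + l) ≡ x
          cancel = solve-∀
          kn≤ : k ℕ.* n ℕ.≤ (k ℕ.+ 1) ℕ.* t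
          kn≤ = ℤ.drop‿+≤+ (subst₂ _≤_ (sym (ℤ.pos-* k n)) (sym (ℤ.pos-* (k ℕ.+ 1) t)) (height (+ t) x (+ n) left 0≤upper))
          n≤top : n ℕ.≤ top-row t
          n≤top = from (≤-top-row t n) kn≤
          -l≤x : - l ≤ x
          -l≤x = to (left⇔ t x n kn≤) left
          j≡ : + ℤ.∣ x + l ∣ ≡ x + l
          j≡ = ℤ.0≤i⇒+∣i∣≡i (subst (0ℤ ≤_) (cong (λ z → x + z) (ℤ.neg-involutive l)) (≤⇒0≤- -l≤x))
          j<width : ℤ.∣ x + l ∣ ℕ.< width t n
          j<width = ℤ.drop‿+<+ (begin-strict
            + ℤ.∣ x + l ∣         ≡⟨ j≡ ⟩
            x + l                 ≤⟨ ℤ.+-monoˡ-≤ l (to (right⇔ t x n) right) ⟩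
            R t n + l             <⟨ ℤ.+-monoʳ-< (R t n) (ℤ.+<+ (ℕ.m<m+n (extent t n) ℕ.z<s)) ⟩
            R t n + (l + 1ℤ)      ≡⟨ width≡ t n n≤top ⟨
            + width t n           ∎)
            where open ℤ.≤-Reasoning
        backwards : Rows (suc (top-row t)) (λ n → - (+ extent t n)) (width t) (x , y) → Region (0ℤ ≤_) (+ t) (x , y)
        backwards (n , s≤s n≤top , refl , j , j<width , refl) =
          0≤+n n , from (right⇔ t (- l + + j) n) x≤R , from (left⇔ t (- l + + j) n (to (≤-top-row t n) n≤top)) (ℤ.i≤i+j (- l) (+ j))
          where
          l = + extent t n
          cancel : ∀ r l → - l + (r + (l + 1ℤ) - 1ℤ) ≡ r
          cancel = solve-∀
          x≤R : - l + + j ≤ R t n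
          x≤R = begin
            - l + + j                             ≤⟨ ℤ.+-monoʳ-≤ (- l) (ℤ.i<j⇒i≤pred[j] (ℤ.+<+ j<width)) ⟩
            - l + ℤ.pred (+ width t n)            ≡⟨ cong (λ z → - l + z) (trans (ℤ.+-comm ℤ.-1ℤ (+ width t n)) (cong (ℤ._- 1ℤ) (width≡ t n n≤top))) ⟩
            - l + (R t n + (l + 1ℤ) - 1ℤ)         ≡⟨ cancel (R t n) l ⟩
            R t n                                 ∎
            where open ℤ.≤-Reasoning

      -- By `B≡`, `c₁` is b, and `c₂` is b + 2 i - 2, which is twice the area in Pick's formula.
      c₁ c₂ : ℤ
      c₁ = K + M + + 3 + K * E - G
      c₂ = K + M + + 3 + (K + two) * E - G

      region-card : ∀ t → Σ ℕ λ n → HasCard (Region (0ℤ ≤_) (+ t)) n × two * + n ≡ c₂ * (+ t * + t) + c₁ * + t + two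
      region-card t = total (width t) h , HasCard-cong (λ z → ⇔-sym (region⇔rows t z)) (rows-card (λ n → - (+ extent t n)) (width t) h) , twice
        where
        q = t / k
        h = suc (top-row t)
        f g a b : ℕ → ℤ
        f n = (K + 1ℤ) * + t - K * + n
        g n = f n + M * (+ t - + n) + (+ extent t n + 1ℤ)
        a n = + (t ∸ n)
        b n = + (t ∸ k ℕ.* n)
        h≡ : h ≡ t ℕ.+ suc q
        h≡ = sym (ℕ.+-suc t q)
        kq≤t : k ℕ.* q ℕ.≤ t
        kq≤t = subst (ℕ._≤ t) (ℕ.*-comm q k) (ℕ.m/n*n≤m t k)
        t≤k[1+q] : t ℕ.≤ k ℕ.* suc q
        t≤k[1+q] = begin
          t                           ≡⟨ ℕ.m≡m%n+[m/n]*n t k ⟩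
          t ℕ.% k ℕ.+ q ℕ.* k         ≤⟨ ℕ.+-monoˡ-≤ (q ℕ.* k) (ℕ.<⇒≤ (ℕ.m%n<n t k)) ⟩
          k ℕ.+ q ℕ.* k               ≡⟨ ℕ.*-comm (suc q) k ⟩
          k ℕ.* suc q                 ∎
          where open ℕ.≤-Reasoning
        summand : ∀ K M E G t n a b l →
          Lℤ.reach K M E G t n a b + (l + 1ℤ) ≡
            (K + 1ℤ) * t - K * n + M * (t - n) + (l + 1ℤ) + (E * ((K + 1ℤ) * t - K * n) + (- E * b + - G * a))
        summand = solve 9 (λ K M E G t n a b l → let open Lines poly-ops K M E G in
          reach t n a b :+ (l :+ con 1ℤ) :=
            (K :+ con 1ℤ) :* t :- K :* n :+ M :* (t :- n) :+ (l :+ con 1ℤ)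
              :+ (E :* ((K :+ con 1ℤ) :* t :- K :* n) :+ (:- E :* b :+ :- G :* a))) refl
        linear : ∑ (λ n → + width t n) h ≡ ∑ g h + (E * ∑ f h + (- E * ∑ b h + - G * ∑ a h))
        linear = begin
          ∑ (λ n → + width t n) h
            ≡⟨ ∑-cong h (λ n n<h → trans (width≡ t n (ℕ.s≤s⁻¹ n<h))
                 (summand K M E G (+ t) (+ n) (a n) (b n) (+ extent t n))) ⟩
          ∑ (λ n → g n + (E * f n + (- E * b n + - G * a n))) h
            ≡⟨ ∑-+ g (λ n → E * f n + (- E * b n + - G * a n)) h ⟩
          ∑ g h + ∑ (λ n → E * f n + (- E * b n + - G * a n)) h
            ≡⟨ cong (λ z → ∑ g h + z) (∑-+ (λ n → E * f n) (λ n → - E * b n + - G * a n) h) ⟩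
          ∑ g h + (∑ (λ n → E * f n) h + ∑ (λ n → - E * b n + - G * a n) h)
            ≡⟨ cong (λ z → ∑ g h + (∑ (λ n → E * f n) h + z)) (∑-+ (λ n → - E * b n) (λ n → - G * a n) h) ⟩
          ∑ g h + (∑ (λ n → E * f n) h + (∑ (λ n → - E * b n) h + ∑ (λ n → - G * a n) h))
            ≡⟨ cong₂ (λ u v → ∑ g h + (u + v)) (∑-* E f h) (cong₂ _+_ (∑-* (- E) b h) (∑-* (- G) a h)) ⟩
          ∑ g h + (E * ∑ f h + (- E * ∑ b h + - G * ∑ a h)) ∎
          where open ≡-Reasoning
        -- The sums of f and b are paired because each alone depends on t modulo k, whereas
        -- `∑-telescope` makes their difference polynomial.
        regroup : ∀ E G g f b a →
          + 2 * (g + (E * f + (- E * b + - G * a))) ≡ + 2 * g + E * (+ 2 * (f - b)) - G * (+ 2 * a)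
        regroup = solve-∀
        collect : ∀ K M E G t →
          (K + M + + 3) * (t * t + t) + + 2 + E * ((K + + 2) * (t * t) + K * t) - G * (t * t + t)
            ≡ (K + M + + 3 + (K + + 2) * E - G) * (t * t) + (K + M + + 3 + K * E - G) * t + + 2
        collect = solve-∀
        twice : two * + total (width t) h ≡ c₂ * (+ t * + t) + c₁ * + t + two
        twice = begin
          two * + total (width t) h
            ≡⟨ cong (two *_) (trans (∑-total (width t) h) linear) ⟩
          two * (∑ g h + (E * ∑ f h + (- E * ∑ b h + - G * ∑ a h)))
            ≡⟨ regroup E G (∑ g h) (∑ f h) (∑ b h) (∑ a h) ⟩
          two * ∑ g h + E * (two * (∑ f h - ∑ b h)) - G * (two * ∑ a h)
            ≡⟨ cong₂ _-_ (cong₂ _+_ (base t) (cong (E *_)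
                 (trans (cong (λ h → two * (∑ f h - ∑ b h)) h≡) (∑-telescope k t q kq≤t t≤k[1+q]))))
                 (cong (G *_) (trans (cong (λ h → two * ∑ a h) h≡) (∑-triangle t (suc q)))) ⟩
          (K + M + + 3) * (+ t * + t + + t) + two + E * ((K + two) * (+ t * + t) + K * + t) - G * (+ t * + t + + t)
            ≡⟨ collect K M E G (+ t) ⟩
          c₂ * (+ t * + t) + c₁ * + t + two ∎
          where open ≡-Reasoning

      private
        1/k≡0 : 1 / k ≡ 0
        1/k≡0 = ℕ.m<n⇒m/n≡0 1<k

      row-0 : ∀ x → Region (0ℤ ≤_) 1ℤ (x , 0ℤ) ⇔ (0ℤ ≤ x × x ≤ + B)
      row-0 x = mk⇔
        (λ (_ , right , left) → subst (λ l → - (+ l) ≤ x) extent-1-0 (to (left⇔ 1 x 0 k0≤) left) ,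
          subst (x ≤_) R≡B (to (right⇔ 1 x 0) right))
        (λ (0≤x , x≤B) → 0≤+n 0 , from (right⇔ 1 x 0) (subst (x ≤_) (sym R≡B) x≤B) ,
          from (left⇔ 1 x 0 k0≤) (subst (λ l → - (+ l) ≤ x) (sym extent-1-0) 0≤x))
        where
        k0≤ : k ℕ.* 0 ℕ.≤ (k ℕ.+ 1) ℕ.* 1
        k0≤ = subst (ℕ._≤ (k ℕ.+ 1) ℕ.* 1) (sym (ℕ.*-zeroʳ k)) z≤n
        reach-0 : ∀ K M E G → Lℤ.reach K M E G 1ℤ 0ℤ 1ℤ 1ℤ ≡ Lℤ.B K M E G
        reach-0 = solve 4 (λ K M E G → let open Lines poly-ops K M E G renaming (B to B′) in
          reach (con 1ℤ) (con 0ℤ) (con 1ℤ) (con 1ℤ) := B′) refl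
        R≡B : R 1 0 ≡ + B
        R≡B = trans (cong (λ b → Lℤ.reach K M E G 1ℤ 0ℤ 1ℤ (+ (1 ∸ b))) (ℕ.*-zeroʳ k))
          (trans (reach-0 K M E G) (sym B≡))

      row-1 : ∀ x → Region (0ℤ ≤_) 1ℤ (x , 1ℤ) ⇔ (0ℤ ≤ x × x ≤ + suc e)
      row-1 x = mk⇔
        (λ (_ , right , left) → subst (λ l → - (+ l) ≤ x) extent-1-1 (to (left⇔ 1 x 1 k1≤) left) ,
          subst (x ≤_) R≡1+e (to (right⇔ 1 x 1) right))
        (λ (0≤x , x≤i) → 0≤+n 1 , from (right⇔ 1 x 1) (subst (x ≤_) (sym R≡1+e) x≤i) ,
          from (left⇔ 1 x 1 k1≤) (subst (λ l → - (+ l) ≤ x) (sym extent-1-1) 0≤x))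
        where
        k1≤ : k ℕ.* 1 ℕ.≤ (k ℕ.+ 1) ℕ.* 1
        k1≤ = ℕ.*-monoˡ-≤ 1 (ℕ.m≤m+n k 1)
        reach-1 : ∀ K M E G → Lℤ.reach K M E G 1ℤ 1ℤ 0ℤ 0ℤ ≡ 1ℤ + E
        reach-1 = solve 4 (λ K M E G → let open Lines poly-ops K M E G in
          reach (con 1ℤ) (con 1ℤ) (con 0ℤ) (con 0ℤ) := con 1ℤ :+ E) refl
        R≡1+e : R 1 1 ≡ + suc e
        R≡1+e = trans (cong (λ b → Lℤ.reach K M E G 1ℤ 1ℤ 0ℤ (+ b))
            (ℕ.m≤n⇒m∸n≡0 (ℕ.≤-trans (ℕ.<⇒≤ 1<k) (ℕ.≤-reflexive (sym (ℕ.*-identityʳ k))))))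
          (reach-1 K M E G)

      -- Since k > 1, the apex of P lies below height 2.
      in-rows-0-1 : ∀ x y → Region (0ℤ ≤_) 1ℤ (x , y) → (y ≡ 0ℤ) ⊎ (y ≡ 1ℤ)
      in-rows-0-1 x y region with to (region⇔rows 1 (x , y)) region
      ... | 0 , _ , y≡0 , _ = inj₁ y≡0
      ... | 1 , _ , y≡1 , _ = inj₂ y≡1
      ... | suc (suc n) , s≤s 2+n≤ , _ = contradiction (subst (λ q → suc (suc n) ℕ.≤ 1 ℕ.+ q) 1/k≡0 2+n≤) (λ { (s≤s ()) })

      weaken : ∀ {t z} → Region (0ℤ <_) t z → Region (0ℤ ≤_) t z
      weaken (b , (l , m , u) , left) = ℤ.<⇒≤ b , (ℤ.<⇒≤ l , ℤ.<⇒≤ m , ℤ.<⇒≤ u) , left-map ℤ.<⇒≤ left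

      interior⇔ : ∀ x y → Region (0ℤ <_) 1ℤ (x , y) ⇔ (y ≡ 1ℤ × 0ℤ ≤ x × x < + suc e)
      interior⇔ x y = mk⇔ forwards backwards
        where
        forwards : Region (0ℤ <_) 1ℤ (x , y) → y ≡ 1ℤ × 0ℤ ≤ x × x < + suc e
        forwards region@(0<y , (_ , 0<middle , _) , _) with in-rows-0-1 x y (weaken region)
        ... | inj₁ refl = contradiction 0<y (ℤ.<-irrefl refl)
        ... | inj₂ refl = refl , proj₁ (to (row-1 x) (weaken region)) ,
          0<-⇒< (subst (0ℤ <_) (middle-1 K M E G x) 0<middle)
        backwards : y ≡ 1ℤ × 0ℤ ≤ x × x < + suc e → Region (0ℤ <_) 1ℤ (x , y)
        backwards (refl , ℤ.+≤+ {n = j} _ , x<i) = ℤ.+<+ ℕ.z<s ,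
          ( subst (0ℤ <_) (sym (lower-1 K M E G x)) (ℤ.+-mono-<-≤ 0<i-x (0≤* (≤⇒0≤- (ℤ.+≤+ (ℕ.<⇒≤ 1<k))) (0≤+n e)))
          , subst (0ℤ <_) (sym (middle-1 K M E G x)) 0<i-x
          , subst (0ℤ <_) (sym (upper-1 K M E G x)) 0<i-x ) , left-inside j
          where 0<i-x = <⇒0<- x<i

      interior-card : HasCard (Region (0ℤ <_) 1ℤ) (suc e)
      interior-card = HasCard-cong equiv (rows-card (λ _ → 0ℤ) w 2)
        where
        w : ℕ → ℕ
        w 0       = 0
        w (suc _) = suc e
        equiv : ∀ z → Rows 2 (λ _ → 0ℤ) w z ⇔ Region (0ℤ <_) 1ℤ z
        equiv (x , y) = mk⇔
          (λ { (0 , _ , _ , _ , () , _)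
             ; (1 , _ , refl , j , j<i , refl) → from (interior⇔ (+ j) y) (refl , 0≤+n j , ℤ.+<+ j<i)
             ; (suc (suc _) , s≤s (s≤s ()) , _) })
          (λ region → back (to (interior⇔ x y) region))
          where
          back : y ≡ 1ℤ × 0ℤ ≤ x × x < + suc e → Rows 2 (λ _ → 0ℤ) w (x , y)
          back (refl , ℤ.+≤+ {n = j} _ , ℤ.+<+ j<i) = 1 , s≤s (s≤s z≤n) , refl , j , j<i , refl

      boundary-card : HasCard (λ z → Region (0ℤ ≤_) 1ℤ z × ¬ Region (0ℤ <_) 1ℤ z) (2 ℕ.+ B)
      boundary-card = subst (HasCard _) (ℕ.+-comm (suc B) 1) (HasCard-cong equiv (rows-card a w 2))
        where
        a : ℕ → ℤ
        a 0       = 0ℤ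
        a (suc _) = + suc e
        w : ℕ → ℕ
        w 0       = suc B
        w (suc _) = 1
        forwards : ∀ z → Rows 2 a w z → Region (0ℤ ≤_) 1ℤ z × ¬ Region (0ℤ <_) 1ℤ z
        forwards _ (0 , _ , refl , j , s≤s j≤B , refl) =
          from (row-0 (+ j)) (0≤+n j , ℤ.+≤+ j≤B) , λ { (ℤ.+<+ () , _) }
        forwards _ (1 , _ , refl , 0 , _ , refl) rewrite ℕ.+-identityʳ e =
          from (row-1 (+ suc e)) (0≤+n (suc e) , ℤ.≤-refl) ,
          λ region → ℤ.<-irrefl refl (proj₂ (proj₂ (to (interior⇔ (+ suc e) 1ℤ) region)))
        forwards _ (1 , _ , _ , suc _ , s≤s () , _)
        forwards _ (suc (suc _) , s≤s (s≤s ()) , _)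
        backwards : ∀ x y → Region (0ℤ ≤_) 1ℤ (x , y) → ¬ Region (0ℤ <_) 1ℤ (x , y) → Rows 2 a w (x , y)
        backwards x y region ¬interior with in-rows-0-1 x y region
        ... | inj₁ refl with ℤ.+≤+ {n = j} _ , ℤ.+≤+ j≤B ← to (row-0 x) region = 0 , s≤s z≤n , refl , j , s≤s j≤B , refl
        ... | inj₂ refl with 0≤x , x≤i ← to (row-1 x) region with x ℤ.<? + suc e
        ...   | yes x<i = contradiction (from (interior⇔ x 1ℤ) (refl , 0≤x , x<i)) ¬interior
        ...   | no  x≮i = 1 , s≤s (s≤s z≤n) , refl , 0 , s≤s z≤n ,
          trans (ℤ.≤-antisym x≤i (ℤ.≮⇒≥ x≮i)) (cong +_ (sym (ℕ.+-identityʳ (suc e))))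
        equiv : ∀ z → Rows 2 a w z ⇔ (Region (0ℤ ≤_) 1ℤ z × ¬ Region (0ℤ <_) 1ℤ z)
        equiv z@(x , y) = mk⇔ (forwards z) (λ (region , ¬interior) → backwards x y region ¬interior)

  -- The polygons with i = 1 and γ = 0

  [k+n]/k : ∀ k .{{_ : NonZero k}} n → (k ℕ.+ n) / k ≡ suc (n / k)
  [k+n]/k k n = trans (ℕ.m/n≡1+[m∸n]/n (ℕ.m≤m+n k n)) (cong (λ i → suc (i / k)) (ℕ.m+n∸m≡n k n))

  -- The increment in `step` is that of c (t² + t) from t to t + k, so agreement on 0, ..., k - 1
  -- propagates through each residue class.
  quadratic-by-steps : ∀ k .{{_ : NonZero k}} c (G : ℕ → ℤ) →
    (∀ r → r ℕ.< k → G r ≡ c * (+ r * + r + + r) + two) →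
    (∀ t → G (k ℕ.+ t) ≡ G t + c * (two * + k * + t + + k * + k + + k)) →
    ∀ t → G t ≡ c * (+ t * + t + + t) + two
  quadratic-by-steps k c G small step t = subst (λ t → G t ≡ c * (+ t * + t + + t) + two)
    (trans (ℕ.+-comm (t / k ℕ.* k) (t ℕ.% k)) (sym (ℕ.m≡m%n+[m/n]*n t k))) (go (t / k) (t ℕ.% k) (ℕ.m%n<n t k))
    where
    expand : ∀ c k t → c * (t * t + t) + + 2 + c * (+ 2 * k * t + k * k + k) ≡ c * ((k + t) * (k + t) + (k + t)) + + 2
    expand = solve-∀
    go : ∀ q r → r ℕ.< k → G (q ℕ.* k ℕ.+ r) ≡ c * (+ (q ℕ.* k ℕ.+ r) * + (q ℕ.* k ℕ.+ r) + + (q ℕ.* k ℕ.+ r)) + two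
    go zero    r r<k = small r r<k
    go (suc q) r r<k rewrite ℕ.+-assoc k (q ℕ.* k) r =
      trans (step t′) (trans (cong (_+ c * (two * + k * + t′ + + k * + k + + k)) (go q r r<k)) (expand c (+ k) (+ t′)))
      where t′ = q ℕ.* k ℕ.+ r

  -- Passing from t to t + k adds exactly k + 1 rows: k from t and one from t / k.
  ∑-shift : ∀ k .{{_ : NonZero k}} (f : ℕ → ℕ → ℤ) t →
    (∀ j → j ℕ.≤ t ℕ.+ t / k → f (k ℕ.+ t) (suc k ℕ.+ j) ≡ f t j) →
    ∑ (f (k ℕ.+ t)) (suc (k ℕ.+ t ℕ.+ (k ℕ.+ t) / k)) ≡ ∑ (f (k ℕ.+ t)) (suc k) + ∑ (f t) (suc (t ℕ.+ t / k))
  ∑-shift k f t shift = begin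
    ∑ (f (k ℕ.+ t)) (suc (k ℕ.+ t ℕ.+ (k ℕ.+ t) / k))
      ≡⟨ cong (∑ (f (k ℕ.+ t))) rows≡ ⟩
    ∑ (f (k ℕ.+ t)) (suc k ℕ.+ suc (t ℕ.+ t / k))
      ≡⟨ ∑-split (f (k ℕ.+ t)) (suc k) (suc (t ℕ.+ t / k)) ⟩
    ∑ (f (k ℕ.+ t)) (suc k) + ∑ (λ j → f (k ℕ.+ t) (suc k ℕ.+ j)) (suc (t ℕ.+ t / k))
      ≡⟨ cong (λ z → ∑ (f (k ℕ.+ t)) (suc k) + z) (∑-cong (suc (t ℕ.+ t / k)) (λ j j< → shift j (ℕ.s≤s⁻¹ j<))) ⟩
    ∑ (f (k ℕ.+ t)) (suc k) + ∑ (f t) (suc (t ℕ.+ t / k)) ∎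
    where
    open ≡-Reasoning
    rows≡ : suc (k ℕ.+ t ℕ.+ (k ℕ.+ t) / k) ≡ suc k ℕ.+ suc (t ℕ.+ t / k)
    rows≡ = cong suc (trans (cong (k ℕ.+ t ℕ.+_) ([k+n]/k k t))
      (trans (ℕ.+-assoc k t (suc (t / k))) (cong (k ℕ.+_) (ℕ.+-suc t (t / k)))))

  -- Hermite's identity for floors; both sides grow by 3 when n does.
  hermite-3 : ∀ n → n / 3 ℕ.+ (1 ℕ.+ n) / 3 ℕ.+ (2 ℕ.+ n) / 3 ≡ n
  hermite-3 0 = refl
  hermite-3 1 = refl
  hermite-3 2 = refl
  hermite-3 (suc (suc (suc n)))
    rewrite [k+n]/k 3 n | [k+n]/k 3 (1 ℕ.+ n) | [k+n]/k 3 (2 ℕ.+ n)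
          | ℕ.+-suc (n / 3) ((1 ℕ.+ n) / 3) | ℕ.+-suc (n / 3 ℕ.+ (1 ℕ.+ n) / 3) ((2 ℕ.+ n) / 3) = cong (3 ℕ.+_) (hermite-3 n)

  hermite-4 : ∀ n → n / 4 ℕ.+ (1 ℕ.+ n) / 4 ℕ.+ (2 ℕ.+ n) / 4 ℕ.+ (3 ℕ.+ n) / 4 ≡ n
  hermite-4 0 = refl
  hermite-4 1 = refl
  hermite-4 2 = refl
  hermite-4 3 = refl
  hermite-4 (suc (suc (suc (suc n))))
    rewrite [k+n]/k 4 n | [k+n]/k 4 (1 ℕ.+ n) | [k+n]/k 4 (2 ℕ.+ n) | [k+n]/k 4 (3 ℕ.+ n)
          | ℕ.+-suc (n / 4) ((1 ℕ.+ n) / 4) | ℕ.+-suc (n / 4 ℕ.+ (1 ℕ.+ n) / 4) ((2 ℕ.+ n) / 4)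
          | ℕ.+-suc (n / 4 ℕ.+ (1 ℕ.+ n) / 4 ℕ.+ (2 ℕ.+ n) / 4) ((3 ℕ.+ n) / 4) = cong (4 ℕ.+_) (hermite-4 n)

  -- When t grows by 2, each numerator grows by 4 and each quotient by 1. Serves the two new rows
  -- for k = 5 that are left over from a full period of `hermite-4`.
  half-sum : ∀ t → (1 ℕ.+ 2 ℕ.* t) / 4 ℕ.+ (2 ℕ.+ 2 ℕ.* t) / 4 ≡ t
  half-sum 0 = refl
  half-sum 1 = refl
  half-sum (suc (suc t)) = trans
    (cong₂ ℕ._+_
      (trans (cong (λ d → (1 ℕ.+ d) / 4) (ℕ.*-distribˡ-+ 2 2 t)) ([k+n]/k 4 (1 ℕ.+ 2 ℕ.* t)))
      (trans (cong (λ d → (2 ℕ.+ d) / 4) (ℕ.*-distribˡ-+ 2 2 t)) ([k+n]/k 4 (2 ℕ.+ 2 ℕ.* t))))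
    (trans (cong suc (ℕ.+-suc ((1 ℕ.+ 2 ℕ.* t) / 4) ((2 ℕ.+ 2 ℕ.* t) / 4))) (cong (2 ℕ.+_) (half-sum t)))

  -- The least integer not below -p / c is -⌊p / c⌋. Only negative x require an argument.
  0≤c*x+p⇔ : ∀ c .{{_ : NonZero c}} p x → (0ℤ ≤ + c * x + + p) ⇔ (- (+ (p / c)) ≤ x)
  0≤c*x+p⇔ c p (+ j) = mk⇔
    (λ _ → ℤ.≤-trans (ℤ.neg-mono-≤ (0≤+n (p / c))) (0≤+n j))
    (λ _ → 0≤+ (0≤* (0≤+n c) (0≤+n j)) (0≤+n p))
  0≤c*x+p⇔ c p -[1+ j ] = mk⇔
    (λ 0≤ → ℤ.neg-mono-≤ (ℤ.+≤+ (begin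
      suc j                   ≡⟨ ℕ.m*n/n≡m (suc j) c ⟨
      suc j ℕ.* c / c         ≤⟨ ℕ./-monoˡ-≤ c (subst (ℕ._≤ p) (ℕ.*-comm c (suc j))
                                    (ℤ.drop‿+≤+ (ℤ.0≤i-j⇒j≤i (subst (0ℤ ≤_) flip 0≤)))) ⟩
      p / c                   ∎)))
    (λ -p/c≤x → subst (0ℤ ≤_) (sym flip) (≤⇒0≤- (ℤ.+≤+ (begin
      c ℕ.* suc j             ≤⟨ ℕ.*-monoʳ-≤ c (ℤ.drop‿+≤+ (ℤ.neg-cancel-≤ -p/c≤x)) ⟩
      c ℕ.* (p / c)           ≡⟨ ℕ.*-comm c (p / c) ⟩
      p / c ℕ.* c             ≤⟨ ℕ.m/n*n≤m p c ⟩
      p                       ∎))))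
    where
    open ℕ.≤-Reasoning
    flip : + c * -[1+ j ] + + p ≡ + p - + (c ℕ.* suc j)
    flip = trans (ℤ.+-comm (+ c * -[1+ j ]) (+ p)) (cong (λ z → + p + z)
      (trans (sym (ℤ.neg-distribʳ-* (+ c) (+ suc j))) (cong -_ (sym (ℤ.pos-* c (suc j))))))

  -- `summand` is the length of row n for i = 1 and γ = 0, where the right boundary is the single
  -- line from base to apex.
  module Base (k m : ℕ) (extent : ℕ → ℕ → ℕ) where
    summand : ℕ → ℕ → ℤ
    summand t n = (+ k + 1ℤ) * + t - + k * + n + + m * (+ t - + n) + (+ extent t n + 1ℤ)

    BaseCount : .{{_ : NonZero k}} → Set
    BaseCount = ∀ t → two * ∑ (summand t) (suc (t ℕ.+ t / k)) ≡ (+ k + + m + + 3) * (+ t * + t + + t) + two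

  extent₃ : ℕ → ℕ → ℕ
  extent₃ t n = n / 2

  base₃ : Base.BaseCount 3 2 extent₃
  base₃ = quadratic-by-steps 3 (+ 8) (λ t → two * ∑ (g t) (suc (t ℕ.+ t / 3)))
    (λ { 0 _ → refl ; 1 _ → refl ; 2 _ → refl ; (suc (suc (suc _))) (s≤s (s≤s (s≤s ()))) })
    step
    where
    open Base 3 2 extent₃ renaming (summand to g)
    -- The four new rows, with n / 2 already evaluated to 0, 0, 1, 1.
    head : ∀ t → + 2 * (0ℤ + (+ 4 * (+ 3 + t) - + 3 * + 0 + + 2 * (+ 3 + t - + 0) + (+ 0 + 1ℤ))
                           + (+ 4 * (+ 3 + t) - + 3 * + 1 + + 2 * (+ 3 + t - + 1) + (+ 0 + 1ℤ))
                           + (+ 4 * (+ 3 + t) - + 3 * + 2 + + 2 * (+ 3 + t - + 2) + (+ 1 + 1ℤ))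
                           + (+ 4 * (+ 3 + t) - + 3 * + 3 + + 2 * (+ 3 + t - + 3) + (+ 1 + 1ℤ)))
                ≡ + 8 * (+ 2 * + 3 * t + + 3 * + 3 + + 3)
    head = solve-∀
    translate : ∀ t j l → + 4 * (+ 3 + t) - + 3 * (+ 4 + j) + + 2 * (+ 3 + t - (+ 4 + j)) + (+ 2 + l + 1ℤ)
      ≡ + 4 * t - + 3 * j + + 2 * (t - j) + (l + 1ℤ)
    translate = solve-∀
    shift : ∀ t j → g (3 ℕ.+ t) (4 ℕ.+ j) ≡ g t j
    shift t j = trans
      (cong (λ l → + 4 * (+ 3 + + t) - + 3 * (+ 4 + + j) + + 2 * (+ 3 + + t - (+ 4 + + j)) + (+ l + 1ℤ))
        (trans ([k+n]/k 2 (2 ℕ.+ j)) (cong suc ([k+n]/k 2 j))))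
      (translate (+ t) (+ j) (+ (j / 2)))
    step : ∀ t → two * ∑ (g (3 ℕ.+ t)) (suc (3 ℕ.+ t ℕ.+ (3 ℕ.+ t) / 3)) ≡
      two * ∑ (g t) (suc (t ℕ.+ t / 3)) + + 8 * (two * + 3 * + t + + 3 * + 3 + + 3)
    step t = begin
      two * ∑ (g (3 ℕ.+ t)) (suc (3 ℕ.+ t ℕ.+ (3 ℕ.+ t) / 3))
        ≡⟨ cong (two *_) (∑-shift 3 g t (λ j _ → shift t j)) ⟩
      two * (∑ (g (3 ℕ.+ t)) 4 + ∑ (g t) (suc (t ℕ.+ t / 3)))
        ≡⟨ ℤ.*-distribˡ-+ two (∑ (g (3 ℕ.+ t)) 4) (∑ (g t) (suc (t ℕ.+ t / 3))) ⟩
      two * ∑ (g (3 ℕ.+ t)) 4 + two * ∑ (g t) (suc (t ℕ.+ t / 3))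
        ≡⟨ cong (λ z → z + two * ∑ (g t) (suc (t ℕ.+ t / 3))) (head (+ t)) ⟩
      + 8 * (two * + 3 * + t + + 3 * + 3 + + 3) + two * ∑ (g t) (suc (t ℕ.+ t / 3))
        ≡⟨ ℤ.+-comm (+ 8 * (two * + 3 * + t + + 3 * + 3 + + 3)) (two * ∑ (g t) (suc (t ℕ.+ t / 3))) ⟩
      two * ∑ (g t) (suc (t ℕ.+ t / 3)) + + 8 * (two * + 3 * + t + + 3 * + 3 + + 3) ∎
      where open ≡-Reasoning

  -- Ensures that `2 ℕ.* t ∸ n` is a true difference in every row of the dilate, so that it may be
  -- shifted.
  top-row≤2t : ∀ k .{{_ : NonZero k}} t → t ℕ.+ t / k ℕ.≤ 2 ℕ.* t
  top-row≤2t k t = ℕ.+-monoʳ-≤ t (ℕ.≤-trans (ℕ.m/n≤m t k) (ℕ.m≤m+n t 0))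

  extent₅ : ℕ → ℕ → ℕ
  extent₅ t n = (2 ℕ.* t ∸ n) / 4

  base₅ : Base.BaseCount 5 1 extent₅
  base₅ = quadratic-by-steps 5 (+ 9) (λ t → two * ∑ (g t) (suc (t ℕ.+ t / 5)))
    (λ { 0 _ → refl ; 1 _ → refl ; 2 _ → refl ; 3 _ → refl ; 4 _ → refl
       ; (suc (suc (suc (suc (suc _))))) (s≤s (s≤s (s≤s (s≤s (s≤s ()))))) })
    step
    where
    open Base 5 1 extent₅ renaming (summand to g)
    head : ∀ t l₀ l₁ l₂ l₃ l₄ l₅ →
      + 2 * (0ℤ + (+ 6 * (+ 5 + t) - + 5 * + 0 + 1ℤ * (+ 5 + t - + 0) + (l₀ + 1ℤ))
                + (+ 6 * (+ 5 + t) - + 5 * + 1 + 1ℤ * (+ 5 + t - + 1) + (l₁ + 1ℤ))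
                + (+ 6 * (+ 5 + t) - + 5 * + 2 + 1ℤ * (+ 5 + t - + 2) + (l₂ + 1ℤ))
                + (+ 6 * (+ 5 + t) - + 5 * + 3 + 1ℤ * (+ 5 + t - + 3) + (l₃ + 1ℤ))
                + (+ 6 * (+ 5 + t) - + 5 * + 4 + 1ℤ * (+ 5 + t - + 4) + (l₄ + 1ℤ))
                + (+ 6 * (+ 5 + t) - + 5 * + 5 + 1ℤ * (+ 5 + t - + 5) + (l₅ + 1ℤ)))
        ≡ + 2 * (+ 126 + + 42 * t + ((l₁ + l₀) + (l₅ + l₄ + l₃ + l₂)))
    head = solve-∀
    collect : ∀ t → + 2 * (+ 126 + + 42 * t + ((+ 4 + t) + (+ 5 + (t + (t + 0ℤ))))) ≡ + 9 * (+ 2 * + 5 * t + + 5 * + 5 + + 5)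
    collect = solve-∀
    translate : ∀ t j l → + 6 * (+ 5 + t) - + 5 * (+ 6 + j) + 1ℤ * (+ 5 + t - (+ 6 + j)) + (1ℤ + l + 1ℤ)
      ≡ + 6 * t - + 5 * j + 1ℤ * (t - j) + (l + 1ℤ)
    translate = solve-∀
    double : ∀ t → 2 ℕ.* (5 ℕ.+ t) ≡ 10 ℕ.+ 2 ℕ.* t
    double t = ℕ.*-distribˡ-+ 2 5 t
    l : ℕ → ℕ → ℕ
    l t n = extent₅ (5 ℕ.+ t) n
    -- Rows 5 to 2 have the four consecutive numerators 5 + 2 t, ..., 8 + 2 t of Hermite's identity.
    -- Rows 1 and 0 have 9 + 2 t and 10 + 2 t; being twice 4 above those of `half-sum`, they add 4
    -- to its value.
    l-sum : ∀ t → (l t 1 ℕ.+ l t 0) ℕ.+ (l t 5 ℕ.+ l t 4 ℕ.+ l t 3 ℕ.+ l t 2) ≡ (4 ℕ.+ t) ℕ.+ (5 ℕ.+ 2 ℕ.* t)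
    l-sum t = trans
      (cong (λ d → ((d ∸ 1) / 4 ℕ.+ d / 4) ℕ.+ ((d ∸ 5) / 4 ℕ.+ (d ∸ 4) / 4 ℕ.+ (d ∸ 3) / 4 ℕ.+ (d ∸ 2) / 4)) (double t))
      (cong₂ ℕ._+_
      (trans (cong₂ ℕ._+_ (periods (1 ℕ.+ 2 ℕ.* t)) (periods (2 ℕ.+ 2 ℕ.* t)))
        (trans (cong (2 ℕ.+_) (trans (ℕ.+-suc a (suc b)) (cong suc (ℕ.+-suc a b)))) (cong (4 ℕ.+_) (half-sum t))))
      (hermite-4 (5 ℕ.+ 2 ℕ.* t)))
      where
      a = (1 ℕ.+ 2 ℕ.* t) / 4
      b = (2 ℕ.+ 2 ℕ.* t) / 4
      periods : ∀ n → (8 ℕ.+ n) / 4 ≡ 2 ℕ.+ n / 4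
      periods n = trans ([k+n]/k 4 (4 ℕ.+ n)) (cong suc ([k+n]/k 4 n))
    shift : ∀ t j → j ℕ.≤ t ℕ.+ t / 5 → g (5 ℕ.+ t) (6 ℕ.+ j) ≡ g t j
    shift t j j≤ = trans
      (cong (λ l → + 6 * (+ 5 + + t) - + 5 * (+ 6 + + j) + 1ℤ * (+ 5 + + t - (+ 6 + + j)) + (+ l + 1ℤ))
        (trans (cong (λ d → (d ∸ (6 ℕ.+ j)) / 4) (double t))
          (trans (cong (_/ 4) (ℕ.+-∸-assoc 4 (ℕ.≤-trans j≤ (top-row≤2t 5 t)))) ([k+n]/k 4 (2 ℕ.* t ∸ j)))))
      (translate (+ t) (+ j) (+ extent₅ t j))
    step : ∀ t → two * ∑ (g (5 ℕ.+ t)) (suc (5 ℕ.+ t ℕ.+ (5 ℕ.+ t) / 5)) ≡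
      two * ∑ (g t) (suc (t ℕ.+ t / 5)) + + 9 * (two * + 5 * + t + + 5 * + 5 + + 5)
    step t = begin
      two * ∑ (g (5 ℕ.+ t)) (suc (5 ℕ.+ t ℕ.+ (5 ℕ.+ t) / 5))
        ≡⟨ cong (two *_) (∑-shift 5 g t (shift t)) ⟩
      two * (∑ (g (5 ℕ.+ t)) 6 + S)
        ≡⟨ ℤ.*-distribˡ-+ two (∑ (g (5 ℕ.+ t)) 6) S ⟩
      two * ∑ (g (5 ℕ.+ t)) 6 + two * S
        ≡⟨ cong (λ z → z + two * S) (trans
             (head (+ t) (+ l t 0) (+ l t 1) (+ l t 2) (+ l t 3) (+ l t 4) (+ l t 5))
             (trans (cong (λ n → two * (+ 126 + + 42 * + t + + n)) (l-sum t)) (collect (+ t)))) ⟩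
      + 9 * (two * + 5 * + t + + 5 * + 5 + + 5) + two * S
        ≡⟨ ℤ.+-comm (+ 9 * (two * + 5 * + t + + 5 * + 5 + + 5)) (two * S) ⟩
      two * S + + 9 * (two * + 5 * + t + + 5 * + 5 + + 5) ∎
      where
      open ≡-Reasoning
      S = ∑ (g t) (suc (t ℕ.+ t / 5))

  extent₄ : ℕ → ℕ → ℕ
  extent₄ t n = n ⊓ ((2 ℕ.* t ∸ n) / 3)

  base₄ : Base.BaseCount 4 1 extent₄
  base₄ = quadratic-by-steps 4 (+ 8) (λ t → two * ∑ (Base.summand 4 1 extent₄ t) (suc (t ℕ.+ t / 4)))
    (λ { 0 _ → refl ; 1 _ → refl ; 2 _ → refl ; 3 _ → refl ; (suc (suc (suc (suc _)))) (s≤s (s≤s (s≤s (s≤s ())))) })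
    step
    where
    -- extent₄ t n = extent′ t n ∸ notch t n, where notch t n = 0 from the row t / 2 of the notch upwards.
    extent′ notch : ℕ → ℕ → ℕ
    extent′ t n = (2 ℕ.* t ∸ n) / 3
    notch t n = (2 ℕ.* t ∸ 4 ℕ.* n) / 3
    e : ℕ → ℕ → ℤ
    e t n = + notch t n
    open Base 4 1 extent′ renaming (summand to g)
    notch≡ : ∀ t n → notch t n ≡ extent′ t n ∸ n
    notch≡ t n = trans
      (cong (_/ 3) (trans (cong (λ i → 2 ℕ.* t ∸ (n ℕ.+ i)) (ℕ.*-comm 3 n)) (sym (ℕ.∸-+-assoc (2 ℕ.* t) n (n ℕ.* 3)))))
      (ℕ.[m∸n*o]/o≡m/o∸n (2 ℕ.* t ∸ n) n 3)
    extent₄+notch : ∀ t n → extent₄ t n ℕ.+ notch t n ≡ extent′ t n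
    extent₄+notch t n = trans (cong (extent₄ t n ℕ.+_) (notch≡ t n)) (ℕ.m⊓n+n∸m≡n n (extent′ t n))
    separate : ∀ t n → Base.summand 4 1 extent₄ t n ≡ g t n + ℤ.-1ℤ * e t n
    separate t n = trans (rearrange (+ 5 * + t - + 4 * + n + 1ℤ * (+ t - + n)) (+ extent₄ t n) (+ notch t n))
      (cong (λ l → + 5 * + t - + 4 * + n + 1ℤ * (+ t - + n) + (+ l + 1ℤ) + ℤ.-1ℤ * e t n) (extent₄+notch t n))
      where
      rearrange : ∀ a l e → a + (l + 1ℤ) ≡ a + (l + e + 1ℤ) + ℤ.-1ℤ * e
      rearrange = solve-∀
    ∑-separate : ∀ t h → ∑ (Base.summand 4 1 extent₄ t) h ≡ ∑ (g t) h + ℤ.-1ℤ * ∑ (e t) h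
    ∑-separate t h = trans (∑-cong h (λ n _ → separate t n))
      (trans (∑-+ (g t) (λ n → ℤ.-1ℤ * e t n) h) (cong (λ z → ∑ (g t) h + z) (∑-* ℤ.-1ℤ (e t) h)))
    double : ∀ t → 2 ℕ.* (4 ℕ.+ t) ≡ 8 ℕ.+ 2 ℕ.* t
    double t = ℕ.*-distribˡ-+ 2 4 t
    translate : ∀ t j l → + 5 * (+ 4 + t) - + 4 * (+ 5 + j) + 1ℤ * (+ 4 + t - (+ 5 + j)) + (1ℤ + l + 1ℤ)
      ≡ + 5 * t - + 4 * j + 1ℤ * (t - j) + (l + 1ℤ)
    translate = solve-∀
    shift : ∀ t j → j ℕ.≤ t ℕ.+ t / 4 → g (4 ℕ.+ t) (5 ℕ.+ j) ≡ g t j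
    shift t j j≤ = trans
      (cong (λ l → + 5 * (+ 4 + + t) - + 4 * (+ 5 + + j) + 1ℤ * (+ 4 + + t - (+ 5 + + j)) + (+ l + 1ℤ))
        (trans (cong (λ d → (d ∸ (5 ℕ.+ j)) / 3) (double t))
          (trans (cong (_/ 3) (ℕ.+-∸-assoc 3 (ℕ.≤-trans j≤ (top-row≤2t 4 t)))) ([k+n]/k 3 (2 ℕ.* t ∸ j)))))
      (translate (+ t) (+ j) (+ extent′ t j))
    -- Four times the notch is the lattice point (-2, 2), so this correction repeats after two rows,
    -- not five.
    notch-shift : ∀ t j → e (4 ℕ.+ t) (2 ℕ.+ j) ≡ e t j
    notch-shift t j = cong₂ (λ c d → + ((c ∸ d) / 3)) (double t) (ℕ.*-distribˡ-+ 4 2 j)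
    notch-rows : ∀ t → ∑ (e (4 ℕ.+ t)) (suc (4 ℕ.+ t ℕ.+ (4 ℕ.+ t) / 4)) ≡ ∑ (e (4 ℕ.+ t)) 2 + ∑ (e t) (suc (t ℕ.+ t / 4))
    notch-rows t = begin
      ∑ (e (4 ℕ.+ t)) (suc (4 ℕ.+ t ℕ.+ (4 ℕ.+ t) / 4))
        ≡⟨ cong (∑ (e (4 ℕ.+ t))) rows≡ ⟩
      ∑ (e (4 ℕ.+ t)) (2 ℕ.+ (h ℕ.+ 3))
        ≡⟨ ∑-split (e (4 ℕ.+ t)) 2 (h ℕ.+ 3) ⟩
      ∑ (e (4 ℕ.+ t)) 2 + ∑ (λ j → e (4 ℕ.+ t) (2 ℕ.+ j)) (h ℕ.+ 3)
        ≡⟨ cong (λ z → ∑ (e (4 ℕ.+ t)) 2 + z) (trans (∑-cong (h ℕ.+ 3) (λ j _ → notch-shift t j)) (∑-split (e t) h 3)) ⟩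
      ∑ (e (4 ℕ.+ t)) 2 + (∑ (e t) h + ∑ (λ j → e t (h ℕ.+ j)) 3)
        ≡⟨ cong (λ z → ∑ (e (4 ℕ.+ t)) 2 + (∑ (e t) h + z)) (∑-zero (λ j → e t (h ℕ.+ j)) 3 vanishes) ⟩
      ∑ (e (4 ℕ.+ t)) 2 + (∑ (e t) h + 0ℤ)
        ≡⟨ cong (λ z → ∑ (e (4 ℕ.+ t)) 2 + z) (ℤ.+-identityʳ (∑ (e t) h)) ⟩
      ∑ (e (4 ℕ.+ t)) 2 + ∑ (e t) h ∎
      where
      open ≡-Reasoning
      h = suc (t ℕ.+ t / 4)
      -- The region gains five rows but the correction is shifted by two; the other three rows lie
      -- above the notch and contribute 0.
      rows≡ : suc (4 ℕ.+ t ℕ.+ (4 ℕ.+ t) / 4) ≡ 2 ℕ.+ (h ℕ.+ 3)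
      rows≡ = trans (cong (λ q → 5 ℕ.+ (t ℕ.+ q)) ([k+n]/k 4 t))
        (trans (cong (5 ℕ.+_) (ℕ.+-suc t (t / 4))) (cong (2 ℕ.+_) (ℕ.+-comm 3 h)))
      vanishes : ∀ j → e t (h ℕ.+ j) ≡ 0ℤ
      vanishes j = cong (λ i → + (i / 3)) (ℕ.m≤n⇒m∸n≡0 (ℕ.*-mono-≤ {2} {4} {t} {h ℕ.+ j} (s≤s (s≤s z≤n))
        (ℕ.≤-trans (ℕ.m≤m+n t (t / 4)) (ℕ.≤-trans (ℕ.n≤1+n _) (ℕ.m≤m+n h j)))))
    l : ℕ → ℕ → ℕ
    l t n = extent′ (4 ℕ.+ t) n
    l-sum : ∀ t → l t 3 ℕ.+ l t 2 ℕ.+ l t 1 ≡ 5 ℕ.+ 2 ℕ.* t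
    l-sum t = trans (cong (λ d → (d ∸ 3) / 3 ℕ.+ (d ∸ 2) / 3 ℕ.+ (d ∸ 1) / 3) (double t)) (hermite-3 (5 ℕ.+ 2 ℕ.* t))
    -- The corrections in the two new rows are ⌊(8 + 2 t) / 3⌋ and ⌊(4 + 2 t) / 3⌋, the values l₀
    -- and l₄ of `extent′` in rows 0 and 4. They cancel, and the three consecutive numerators of
    -- rows 1 to 3 remain for Hermite's identity.
    head : ∀ t l₀ l₁ l₂ l₃ l₄ S S′ →
      + 2 * ((0ℤ + (+ 5 * (+ 4 + t) - + 4 * + 0 + 1ℤ * (+ 4 + t - + 0) + (l₀ + 1ℤ))
                 + (+ 5 * (+ 4 + t) - + 4 * + 1 + 1ℤ * (+ 4 + t - + 1) + (l₁ + 1ℤ))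
                 + (+ 5 * (+ 4 + t) - + 4 * + 2 + 1ℤ * (+ 4 + t - + 2) + (l₂ + 1ℤ))
                 + (+ 5 * (+ 4 + t) - + 4 * + 3 + 1ℤ * (+ 4 + t - + 3) + (l₃ + 1ℤ))
                 + (+ 5 * (+ 4 + t) - + 4 * + 4 + 1ℤ * (+ 4 + t - + 4) + (l₄ + 1ℤ)) + S)
              + ℤ.-1ℤ * ((0ℤ + l₀ + l₄) + S′))
        ≡ + 2 * (S + ℤ.-1ℤ * S′) + + 2 * (+ 75 + + 30 * t + (l₃ + l₂ + l₁))
    head = solve-∀
    collect : ∀ t → + 2 * (+ 75 + + 30 * t + (+ 5 + (t + (t + 0ℤ)))) ≡ + 8 * (+ 2 * + 4 * t + + 4 * + 4 + + 4)
    collect = solve-∀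
    step : ∀ t → two * ∑ (Base.summand 4 1 extent₄ (4 ℕ.+ t)) (suc (4 ℕ.+ t ℕ.+ (4 ℕ.+ t) / 4)) ≡
      two * ∑ (Base.summand 4 1 extent₄ t) (suc (t ℕ.+ t / 4)) + + 8 * (two * + 4 * + t + + 4 * + 4 + + 4)
    step t = begin
      two * ∑ (Base.summand 4 1 extent₄ (4 ℕ.+ t)) (suc (4 ℕ.+ t ℕ.+ (4 ℕ.+ t) / 4))
        ≡⟨ cong (two *_) (trans (∑-separate (4 ℕ.+ t) (suc (4 ℕ.+ t ℕ.+ (4 ℕ.+ t) / 4)))
             (cong₂ (λ a b → a + ℤ.-1ℤ * b) (∑-shift 4 g t (shift t)) (notch-rows t))) ⟩
      two * ((∑ (g (4 ℕ.+ t)) 5 + S) + ℤ.-1ℤ * (∑ (e (4 ℕ.+ t)) 2 + S′))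
        ≡⟨ head (+ t) (+ l t 0) (+ l t 1) (+ l t 2) (+ l t 3) (+ l t 4) S S′ ⟩
      two * (S + ℤ.-1ℤ * S′) + two * (+ 75 + + 30 * + t + + (l t 3 ℕ.+ l t 2 ℕ.+ l t 1))
        ≡⟨ cong₂ _+_ (cong (two *_) (sym (∑-separate t (suc (t ℕ.+ t / 4)))))
             (trans (cong (λ n → two * (+ 75 + + 30 * + t + + n)) (l-sum t)) (collect (+ t))) ⟩
      two * ∑ (Base.summand 4 1 extent₄ t) (suc (t ℕ.+ t / 4)) + + 8 * (two * + 4 * + t + + 4 * + 4 + + 4) ∎
      where
      open ≡-Reasoning
      S = ∑ (g t) (suc (t ℕ.+ t / 4))
      S′ = ∑ (e t) (suc (t ℕ.+ t / 4))

  -- For k = 3 the line through (0, 0) and the apex (-2/3, 4/3); for k = 4 the line through the apex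
  -- (-1/4, 5/4) and the notch (-1/2, 1/2), then the one through the notch and (0, 0); for k = 5 the
  -- line through the apex (-1/5, 6/5) and (-1/2, 0).
  Left₃ Left₄ Left₅ : (ℤ → Set) → ℤ → ℤ → ℤ → Set
  Left₃ Q t x y = Q (+ 2 * x + y)
  Left₄ Q t x y = Q (+ 3 * x - y + + 2 * t) × Q (x + y)
  Left₅ Q t x y = Q (+ 4 * x - y + + 2 * t)

  n≤2t : ∀ k .{{_ : NonZero k}} {t n} → k ℕ.* n ℕ.≤ (k ℕ.+ 1) ℕ.* t → n ℕ.≤ 2 ℕ.* t
  n≤2t k {t} {n} kn≤ = ℕ.*-cancelˡ-≤ k (begin
    k ℕ.* n               ≤⟨ kn≤ ⟩
    (k ℕ.+ 1) ℕ.* t       ≤⟨ ℕ.*-monoˡ-≤ t (ℕ.+-monoʳ-≤ k (ℕ.≤-trans (ℕ.>-nonZero⁻¹ k) (ℕ.m≤m+n k 0))) ⟩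
    2 ℕ.* k ℕ.* t         ≡⟨ cong (ℕ._* t) (ℕ.*-comm 2 k) ⟩
    k ℕ.* 2 ℕ.* t         ≡⟨ ℕ.*-assoc k 2 t ⟩
    k ℕ.* (2 ℕ.* t)       ∎)
    where open ℕ.≤-Reasoning

  extent⇔ : ∀ c .{{_ : NonZero c}} t x n → n ℕ.≤ 2 ℕ.* t →
    (0ℤ ≤ + c * x - + n + + 2 * + t) ⇔ (- (+ ((2 ℕ.* t ∸ n) / c)) ≤ x)
  extent⇔ c t x n n≤2t = subst (λ z → (0ℤ ≤ z) ⇔ (- (+ ((2 ℕ.* t ∸ n) / c)) ≤ x)) line≡ (0≤c*x+p⇔ c (2 ℕ.* t ∸ n) x)
    where
    rearrange : ∀ a b d → a + (d - b) ≡ a - b + d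
    rearrange = solve-∀
    line≡ : + c * x + + (2 ℕ.* t ∸ n) ≡ + c * x - + n + + 2 * + t
    line≡ = trans (cong (λ z → + c * x + z) (trans (+-∸ n≤2t) (cong (_- + n) (ℤ.pos-* 2 t))))
      (rearrange (+ c * x) (+ n) (+ 2 * + t))

  left⇔₃ : ∀ t x n → 3 ℕ.* n ℕ.≤ 4 ℕ.* t → Left₃ (0ℤ ≤_) (+ t) x (+ n) ⇔ (- (+ extent₃ t n) ≤ x)
  left⇔₃ t x n _ = 0≤c*x+p⇔ 2 n x

  left⇔₅ : ∀ t x n → 5 ℕ.* n ℕ.≤ 6 ℕ.* t → Left₅ (0ℤ ≤_) (+ t) x (+ n) ⇔ (- (+ extent₅ t n) ≤ x)
  left⇔₅ t x n 5n≤6t = extent⇔ 4 t x n (n≤2t 5 {t} 5n≤6t)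

  left⇔₄ : ∀ t x n → 4 ℕ.* n ℕ.≤ 5 ℕ.* t → Left₄ (0ℤ ≤_) (+ t) x (+ n) ⇔ (- (+ extent₄ t n) ≤ x)
  left⇔₄ t x n 4n≤5t = mk⇔
    (λ (0≤above , 0≤below) → subst (_≤ x) (sym (ℤ.neg-distrib-⊓-⊔ (+ n) (+ q)))
      (ℤ.⊔-lub (-n≤ 0≤below)
        (to (extent⇔ 3 t x n (n≤2t 4 {t} 4n≤5t)) 0≤above)))
    (λ -extent≤x → from (extent⇔ 3 t x n (n≤2t 4 {t} 4n≤5t)) (ℤ.≤-trans (ℤ.neg-mono-≤ (ℤ.+≤+ (ℕ.m⊓n≤n n q))) -extent≤x) ,
      subst (0ℤ ≤_) (cong (λ z → x + z) (ℤ.neg-involutive (+ n))) (≤⇒0≤- (ℤ.≤-trans (ℤ.neg-mono-≤ (ℤ.+≤+ (ℕ.m⊓n≤m n q))) -extent≤x)))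
    where
    q = (2 ℕ.* t ∸ n) / 3
    -n≤ : 0ℤ ≤ x + + n → - + n ≤ x
    -n≤ 0≤x+n = ℤ.0≤i-j⇒j≤i (subst (0ℤ ≤_) (cong (λ z → x + z) (sym (ℤ.neg-involutive (+ n)))) 0≤x+n)

  -- c · upper + left is a positive multiple of (k + 1) t - k y, the height below the apex.
  below-apex : ∀ c e k t y {u l} → 0ℤ ≤ u → 0ℤ ≤ l →
    + c * u + l ≡ (+ c * (1ℤ + + e) + 1ℤ) * ((+ k + 1ℤ) * t - + k * y) → + k * y ≤ (+ k + 1ℤ) * t
  below-apex c e k t y 0≤u 0≤l eq = ℤ.0≤i-j⇒j≤i (to (0≤-scaleℤ 0<factor ((+ k + 1ℤ) * t - + k * y))
    (subst (0ℤ ≤_) eq (0≤+ (0≤* (0≤+n c) 0≤u) 0≤l)))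
    where
    0<factor : 0ℤ < + c * (1ℤ + + e) + 1ℤ
    0<factor = ℤ.+-mono-≤-< (0≤* (0≤+n c) (0≤+n (suc e))) (ℤ.+<+ ℕ.z<s)

  height₃ : ∀ e γ t x y → Left₃ (0ℤ ≤_) t x y → 0ℤ ≤ Lℤ.upper (+ 3) (+ 2) (+ e) (+ γ) t x y → + 3 * y ≤ + 4 * t
  height₃ e γ t x y 0≤left 0≤upper = below-apex 2 e 3 t y 0≤upper 0≤left (identity (+ e) (+ γ) t x y)
    where
    identity : ∀ E G t x y → + 2 * Lℤ.upper (+ 3) (+ 2) E G t x y + (+ 2 * x + y) ≡ (+ 2 * (1ℤ + E) + 1ℤ) * (+ 4 * t - + 3 * y)
    identity = solve 5 (λ E G t x y → let open Lines poly-ops (con (+ 3)) (con (+ 2)) E G in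
      con (+ 2) :* upper t x y :+ (con (+ 2) :* x :+ y)
        := (con (+ 2) :* (con 1ℤ :+ E) :+ con 1ℤ) :* (con (+ 4) :* t :- con (+ 3) :* y)) refl

  height₄ : ∀ e γ t x y → Left₄ (0ℤ ≤_) t x y → 0ℤ ≤ Lℤ.upper (+ 4) (+ 1) (+ e) (+ γ) t x y → + 4 * y ≤ + 5 * t
  height₄ e γ t x y (0≤left , _) 0≤upper = below-apex 3 e 4 t y 0≤upper 0≤left (identity (+ e) (+ γ) t x y)
    where
    identity : ∀ E G t x y → + 3 * Lℤ.upper (+ 4) (+ 1) E G t x y + (+ 3 * x - y + + 2 * t) ≡ (+ 3 * (1ℤ + E) + 1ℤ) * (+ 5 * t - + 4 * y)
    identity = solve 5 (λ E G t x y → let open Lines poly-ops (con (+ 4)) (con (+ 1)) E G in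
      con (+ 3) :* upper t x y :+ (con (+ 3) :* x :- y :+ con (+ 2) :* t)
        := (con (+ 3) :* (con 1ℤ :+ E) :+ con 1ℤ) :* (con (+ 5) :* t :- con (+ 4) :* y)) refl

  height₅ : ∀ e γ t x y → Left₅ (0ℤ ≤_) t x y → 0ℤ ≤ Lℤ.upper (+ 5) (+ 1) (+ e) (+ γ) t x y → + 5 * y ≤ + 6 * t
  height₅ e γ t x y 0≤left 0≤upper = below-apex 4 e 5 t y 0≤upper 0≤left (identity (+ e) (+ γ) t x y)
    where
    identity : ∀ E G t x y → + 4 * Lℤ.upper (+ 5) (+ 1) E G t x y + (+ 4 * x - y + + 2 * t) ≡ (+ 4 * (1ℤ + E) + 1ℤ) * (+ 6 * t - + 5 * y)
    identity = solve 5 (λ E G t x y → let open Lines poly-ops (con (+ 5)) (con (+ 1)) E G in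
      con (+ 4) :* upper t x y :+ (con (+ 4) :* x :- y :+ con (+ 2) :* t)
        := (con (+ 4) :* (con 1ℤ :+ E) :+ con 1ℤ) :* (con (+ 6) :* t :- con (+ 5) :* y)) refl

  overshoot : ∀ k t d → k ℕ.* (t ℕ.+ d) ℕ.≤ (k ℕ.+ 1) ℕ.* t → k ℕ.* d ℕ.≤ t
  overshoot k t d h = ℕ.+-cancelˡ-≤ (k ℕ.* t) (k ℕ.* d) t (begin
    k ℕ.* t ℕ.+ k ℕ.* d   ≡⟨ ℕ.*-distribˡ-+ k t d ⟨
    k ℕ.* (t ℕ.+ d)       ≤⟨ h ⟩
    (k ℕ.+ 1) ℕ.* t       ≡⟨ ℕ.*-distribʳ-+ t k 1 ⟩
    k ℕ.* t ℕ.+ 1 ℕ.* t   ≡⟨ cong (k ℕ.* t ℕ.+_) (ℕ.*-identityˡ t) ⟩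
    k ℕ.* t ℕ.+ t         ∎)
    where open ℕ.≤-Reasoning

  d*c≤⇒d≤/ : ∀ c .{{_ : NonZero c}} d {p} → d ℕ.* c ℕ.≤ p → d ℕ.≤ p / c
  d*c≤⇒d≤/ c d {p} dc≤p = subst (ℕ._≤ p / c) (ℕ.m*n/n≡m d c) (ℕ./-monoˡ-≤ c dc≤p)

  2t∸[t+d] : ∀ t d → 2 ℕ.* t ∸ (t ℕ.+ d) ≡ t ∸ d
  2t∸[t+d] t d = trans (ℕ.[m+n]∸[m+o]≡n∸o t (t ℕ.+ 0) d) (cong (_∸ d) (ℕ.+-identityʳ t))

  beyond : ∀ {t n} → t ℕ.≤ n → n ≡ t ℕ.+ (n ∸ t)
  beyond t≤n = sym (ℕ.m+[n∸m]≡n t≤n)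

  tip₃ : ∀ t n → t ℕ.≤ n → 3 ℕ.* n ℕ.≤ 4 ℕ.* t → 2 ℕ.* (n ∸ t) ℕ.≤ extent₃ t n
  tip₃ t n t≤n 3n≤4t = d*c≤⇒d≤/ 2 (2 ℕ.* d) (begin
    2 ℕ.* d ℕ.* 2         ≡⟨ trans (ℕ.*-comm (2 ℕ.* d) 2) (sym (ℕ.*-assoc 2 2 d)) ⟩
    4 ℕ.* d               ≡⟨ ℕ.+-comm d (3 ℕ.* d) ⟩
    3 ℕ.* d ℕ.+ d         ≤⟨ ℕ.+-monoˡ-≤ d (overshoot 3 t d (subst (λ n → 3 ℕ.* n ℕ.≤ 4 ℕ.* t) (beyond t≤n) 3n≤4t)) ⟩
    t ℕ.+ d               ≡⟨ beyond t≤n ⟨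
    n                     ∎)
    where
    open ℕ.≤-Reasoning
    d = n ∸ t

  -- With d = n - t and k = c + 1, lying below the apex means k d ≤ t, that is c d ≤ t - d = 2 t -
  -- n.
  tip-extent : ∀ c .{{_ : NonZero c}} t n → t ℕ.≤ n → suc c ℕ.* n ℕ.≤ (suc c ℕ.+ 1) ℕ.* t → n ∸ t ℕ.≤ (2 ℕ.* t ∸ n) / c
  tip-extent c t n t≤n h = d*c≤⇒d≤/ c d (begin
    d ℕ.* c                 ≡⟨ ℕ.*-comm d c ⟩
    c ℕ.* d                 ≡⟨ ℕ.m+n∸m≡n d (c ℕ.* d) ⟨
    suc c ℕ.* d ∸ d         ≤⟨ ℕ.∸-monoˡ-≤ d (overshoot (suc c) t d (subst (λ n → suc c ℕ.* n ℕ.≤ (suc c ℕ.+ 1) ℕ.* t) (beyond t≤n) h)) ⟩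
    t ∸ d                   ≡⟨ 2t∸[t+d] t d ⟨
    2 ℕ.* t ∸ (t ℕ.+ d)     ≡⟨ cong (2 ℕ.* t ∸_) (beyond t≤n) ⟨
    2 ℕ.* t ∸ n             ∎)
    where
    open ℕ.≤-Reasoning
    d = n ∸ t

  tip₄ : ∀ t n → t ℕ.≤ n → 4 ℕ.* n ℕ.≤ 5 ℕ.* t → 1 ℕ.* (n ∸ t) ℕ.≤ extent₄ t n
  tip₄ t n t≤n h = subst (ℕ._≤ extent₄ t n) (sym (ℕ.*-identityˡ (n ∸ t)))
    (ℕ.⊓-glb (ℕ.m∸n≤m n t) (tip-extent 3 t n t≤n h))

  tip₅ : ∀ t n → t ℕ.≤ n → 5 ℕ.* n ℕ.≤ 6 ℕ.* t → 1 ℕ.* (n ∸ t) ℕ.≤ extent₅ t n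
  tip₅ t n t≤n h = subst (ℕ._≤ extent₅ t n) (sym (ℕ.*-identityˡ (n ∸ t))) (tip-extent 4 t n t≤n h)

  module Count₃ (e γ B : ℕ) (B≡ : + B ≡ Lℤ.B (+ 3) (+ 2) (+ e) (+ γ)) =
    Strip.Count 3 2 e γ B B≡ extent₃ Left₃ left⇔₃ (height₃ e γ) tip₃ base₃ (s≤s (s≤s z≤n)) refl refl (λ f → f)
      (λ j → ℤ.+-mono-≤-< (0≤* (0≤+n 2) (0≤+n j)) (ℤ.+<+ ℕ.z<s))

  module Count₄ (e γ B : ℕ) (B≡ : + B ≡ Lℤ.B (+ 4) (+ 1) (+ e) (+ γ)) =
    Strip.Count 4 1 e γ B B≡ extent₄ Left₄ left⇔₄ (height₄ e γ) tip₄ base₄ (s≤s (s≤s z≤n)) refl refl (λ f (a , b) → f a , f b)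
      (λ j → subst (0ℤ <_) (sym (ℤ.+-assoc (+ 3 * + j) ℤ.-1ℤ (+ 2))) (ℤ.+-mono-≤-< (0≤* (0≤+n 3) (0≤+n j)) (ℤ.+<+ {0} {1} ℕ.z<s)) ,
        ℤ.+-mono-≤-< (0≤+n j) (ℤ.+<+ ℕ.z<s))

  module Count₅ (e γ B : ℕ) (B≡ : + B ≡ Lℤ.B (+ 5) (+ 1) (+ e) (+ γ)) =
    Strip.Count 5 1 e γ B B≡ extent₅ Left₅ left⇔₅ (height₅ e γ) tip₅ base₅ (s≤s (s≤s z≤n)) refl refl (λ f → f)
      (λ j → subst (0ℤ <_) (sym (ℤ.+-assoc (+ 4 * + j) ℤ.-1ℤ (+ 2))) (ℤ.+-mono-≤-< (0≤* (0≤+n 4) (0≤+n j)) (ℤ.+<+ {0} {1} ℕ.z<s)))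

  -- Pseudointegrality from the region counts

  quadratic : ℤ → ℤ → List ℚ
  quadratic c₁ c₂ = 1ℚ List.∷ ℤtoℚ c₁ ℚ.* ½ List.∷ ℤtoℚ c₂ ℚ.* ½ List.∷ List.[]

  evalPoly-quadratic : ∀ c₁ c₂ t n → two * + n ≡ c₂ * (+ t * + t) + c₁ * + t + two →
    evalPoly (quadratic c₁ c₂) (ℕtoℚ t) ≡ ℕtoℚ n
  evalPoly-quadratic c₁ c₂ t n 2n≡ = begin
    evalPoly (quadratic c₁ c₂) τ
      ≡⟨ halve a c τ ⟩
    ½ ℚ.* (c ℚ.* (τ ℚ.* τ) ℚ.+ a ℚ.* τ ℚ.+ ℤtoℚ two)
      ≡⟨ cong (½ ℚ.*_) cast ⟨
    ½ ℚ.* ℤtoℚ (c₂ * (+ t * + t) + c₁ * + t + two)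
      ≡⟨ cong (λ z → ½ ℚ.* ℤtoℚ z) 2n≡ ⟨
    ½ ℚ.* ℤtoℚ (two * + n)
      ≡⟨ cong (½ ℚ.*_) (ℤtoℚ-* two (+ n)) ⟩
    ½ ℚ.* (ℤtoℚ two ℚ.* ℕtoℚ n)
      ≡⟨ ℚ.*-assoc ½ (ℤtoℚ two) (ℕtoℚ n) ⟨
    1ℚ ℚ.* ℕtoℚ n
      ≡⟨ ℚ.*-identityˡ (ℕtoℚ n) ⟩
    ℕtoℚ n ∎
    where
    open ≡-Reasoning
    τ = ℕtoℚ t
    a = ℤtoℚ c₁
    c = ℤtoℚ c₂
    halve : ∀ a c τ → 1ℚ ℚ.+ τ ℚ.* (a ℚ.* ½ ℚ.+ τ ℚ.* (c ℚ.* ½ ℚ.+ τ ℚ.* 0ℚ)) ≡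
      ½ ℚ.* (c ℚ.* (τ ℚ.* τ) ℚ.+ a ℚ.* τ ℚ.+ ℤtoℚ (+ 2))
    halve = S.solve 3 (λ a c τ → S.con 1ℚ S.:+ τ S.:* (a S.:* S.con ½ S.:+ τ S.:* (c S.:* S.con ½ S.:+ τ S.:* S.con 0ℚ))
      S.:= S.con ½ S.:* (c S.:* (τ S.:* τ) S.:+ a S.:* τ S.:+ S.con (ℤtoℚ (+ 2)))) refl
      where module S = ℚ-Solver.+-*-Solver
    cast : ℤtoℚ (c₂ * (+ t * + t) + c₁ * + t + two) ≡ c ℚ.* (τ ℚ.* τ) ℚ.+ a ℚ.* τ ℚ.+ ℤtoℚ two
    cast = trans (ℤtoℚ-+ (c₂ * (+ t * + t) + c₁ * + t) two) (cong (ℚ._+ ℤtoℚ two)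
      (trans (ℤtoℚ-+ (c₂ * (+ t * + t)) (c₁ * + t)) (cong₂ ℚ._+_
        (trans (ℤtoℚ-* c₂ (+ t * + t)) (cong (c ℚ.*_) (ℤtoℚ-* (+ t) (+ t)))) (ℤtoℚ-* c₁ (+ t)))))

  Realises : ℕ → ℕ → ℕ → ConvexPolygon → Set
  Realises D i b P = HasDenominator P D × Pseudointegral P × HasInteriorCount P i × HasBoundaryCount P b

  realises : ∀ {D i b} P (Region : (ℤ → Set) → ℤ → ℤ × ℤ → Set) c₁ c₂ → HasDenominator P D →
    (∀ t z → InDil (suc t) P (latticePt z) ⇔ Region (0ℤ ≤_) (+ suc t) z) →
    (∀ z → InP P (latticePt z) ⇔ Region (0ℤ ≤_) 1ℤ z) →
    (∀ z → InInt P (latticePt z) ⇔ Region (0ℤ <_) 1ℤ z) →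
    (∀ t → Σ ℕ λ n → HasCard (Region (0ℤ ≤_) (+ t)) n × two * + n ≡ c₂ * (+ t * + t) + c₁ * + t + two) →
    HasCard (Region (0ℤ <_) 1ℤ) i →
    HasCard (λ z → Region (0ℤ ≤_) 1ℤ z × ¬ Region (0ℤ <_) 1ℤ z) b →
    Realises D i b P
  realises P Region c₁ c₂ denominator inDil⇔ inP⇔ inInt⇔ region-card interior-card boundary-card =
    denominator ,
    (quadratic c₁ c₂ , λ { (suc t) _ →
      let n , card , 2n≡ = region-card (suc t) in
      n , HasCard-cong (λ z → ⇔-sym (inDil⇔ t z)) card , evalPoly-quadratic c₁ c₂ (suc t) n 2n≡ }) ,
    HasCard-cong (λ z → ⇔-sym (inInt⇔ z)) interior-card ,
    HasCard-cong (λ z → mk⇔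
      (λ (region , ¬interior) → from (inP⇔ z) region , λ interior → ¬interior (to (inInt⇔ z) interior))
      (λ (inP , ¬interior) → to (inP⇔ z) inP , λ interior → ¬interior (from (inInt⇔ z) interior))) boundary-card

  -- What `0ℤ ≤_` and `0ℤ <_` have in common, so that one argument recovers the region from the
  -- sides for both the polygon and its interior.
  record Sign (Q : ℤ → Set) : Set where
    field
      add   : ∀ {a b} → Q a → Q b → Q (a + b)
      scale : ∀ {c} → 0ℤ < c → ∀ z → Q (c * z) ⇔ Q z

  0≤-sign : Sign (0ℤ ≤_)
  0≤-sign = record { add = 0≤+ ; scale = 0≤-scaleℤ }

  0<-sign : Sign (0ℤ <_)
  0<-sign = record { add = λ 0<a 0<b → ℤ.+-mono-<-≤ 0<a (ℤ.<⇒≤ 0<b) ; scale = 0<-scaleℤ }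

  0<* : ∀ {a b} → 0ℤ < a → 0ℤ < b → 0ℤ < a * b
  0<* {a} {b} 0<a = from (0<-scaleℤ 0<a b)

  -- Polygons with labelled corners.  The elbow is a vertex only if i > 1, the shoulder only if γ > 0.

  data Corner : Set where
    apex notch origin base elbow shoulder : Corner

  -- Coordinates are numerators over the common denominator D = δ K. The factor δ is 2 for k = 5,
  -- because of the abscissa -1/2, and 1 otherwise.
  module Positions {A : Set} (ops : Ops A) (K M δ E G : A) where
    open Ops ops
    open Lines ops K M E G public using (I; B; lower; middle; upper)

    apexˣ apexʸ baseˣ elbowˣ shoulderˣ shoulderʸ : A
    apexˣ     = # 0ℤ ⊝ δ ⊗ M
    apexʸ     = δ ⊗ (K ⊕ # 1ℤ)
    baseˣ     = δ ⊗ K ⊗ B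
    elbowˣ    = δ ⊗ (K ⊗ I ⊕ (K ⊝ # 1ℤ) ⊗ (B ⊝ # 1ℤ))
    shoulderˣ = δ ⊗ K ⊗ I
    shoulderʸ = δ ⊗ K

    sideOf : A → A → A → A → A → A → A → A → A
    sideOf D a₁ a₂ b₁ b₂ t x y = (b₁ ⊝ a₁) ⊗ (D ⊗ y ⊝ t ⊗ a₂) ⊝ (b₂ ⊝ a₂) ⊗ (D ⊗ x ⊝ t ⊗ a₁)

  module Pℤ = Positions ℤ-ops

  origin→base : ∀ K M δ E G o t x y → let open Pℤ K M δ E G in
    sideOf (δ * K) o 0ℤ baseˣ 0ℤ t x y ≡ (baseˣ - o) * (δ * K) * y
  origin→base = solve 9 (λ K M δ E G o t x y → let open Positions poly-ops K M δ E G in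
    sideOf (δ :* K) o (con 0ℤ) baseˣ (con 0ℤ) t x y := (baseˣ :- o) :* (δ :* K) :* y) refl

  base→elbow : ∀ K M δ E G t x y → let open Pℤ K M δ E G in
    sideOf (δ * K) baseˣ 0ℤ elbowˣ δ t x y ≡ δ * (δ * K) * lower t x y
  base→elbow = solve 8 (λ K M δ E G t x y → let open Positions poly-ops K M δ E G in
    sideOf (δ :* K) baseˣ (con 0ℤ) elbowˣ δ t x y := δ :* (δ :* K) :* lower t x y) refl

  -- For E = 0 the elbow lies on the segment from base to shoulder and is skipped. Likewise
  -- `elbow→apex` skips the shoulder for G = 0, and `base→apex` skips both.
  base→shoulder : ∀ K M δ G t x y → let open Pℤ K M δ 0ℤ G in
    sideOf (δ * K) baseˣ 0ℤ shoulderˣ shoulderʸ t x y ≡ δ * K * (δ * K) * lower t x y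
  base→shoulder = solve 7 (λ K M δ G t x y → let open Positions poly-ops K M δ (con 0ℤ) G in
    sideOf (δ :* K) baseˣ (con 0ℤ) shoulderˣ shoulderʸ t x y := δ :* K :* (δ :* K) :* lower t x y) refl

  base→apex : ∀ K M δ t x y → let open Pℤ K M δ 0ℤ 0ℤ in
    sideOf (δ * K) baseˣ 0ℤ apexˣ apexʸ t x y ≡ (δ * K + δ) * (δ * K) * lower t x y
  base→apex = solve 6 (λ K M δ t x y → let open Positions poly-ops K M δ (con 0ℤ) (con 0ℤ) in
    sideOf (δ :* K) baseˣ (con 0ℤ) apexˣ apexʸ t x y := (δ :* K :+ δ) :* (δ :* K) :* lower t x y) refl

  elbow→shoulder : ∀ K M δ E G t x y → let open Pℤ K M δ E G in
    sideOf (δ * K) elbowˣ δ shoulderˣ shoulderʸ t x y ≡ δ * (K - 1ℤ) * (δ * K) * middle t x y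
  elbow→shoulder = solve 8 (λ K M δ E G t x y → let open Positions poly-ops K M δ E G in
    sideOf (δ :* K) elbowˣ δ shoulderˣ shoulderʸ t x y := δ :* (K :- con 1ℤ) :* (δ :* K) :* middle t x y) refl

  elbow→apex : ∀ K M δ E t x y → let open Pℤ K M δ E 0ℤ in
    sideOf (δ * K) elbowˣ δ apexˣ apexʸ t x y ≡ δ * K * (δ * K) * middle t x y
  elbow→apex = solve 7 (λ K M δ E t x y → let open Positions poly-ops K M δ E (con 0ℤ) in
    sideOf (δ :* K) elbowˣ δ apexˣ apexʸ t x y := δ :* K :* (δ :* K) :* middle t x y) refl

  shoulder→apex : ∀ K M δ E G t x y → let open Pℤ K M δ E G in
    sideOf (δ * K) shoulderˣ shoulderʸ apexˣ apexʸ t x y ≡ δ * (δ * K) * upper t x y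
  shoulder→apex = solve 8 (λ K M δ E G t x y → let open Positions poly-ops K M δ E G in
    sideOf (δ :* K) shoulderˣ shoulderʸ apexˣ apexʸ t x y := δ :* (δ :* K) :* upper t x y) refl

  -- Values at the corners off a side are factored to make the sign visible; a value built from E
  -- and G alone vanishes just when the corner falls onto the line of that side.
  lower-at-apex : ∀ K M δ E G → let open Pℤ K M δ E G in lower (δ * K) apexˣ apexʸ ≡ δ * (G + K * K * E)
  lower-at-apex = solve 5 (λ K M δ E G → let open Positions poly-ops K M δ E G in
    lower (δ :* K) apexˣ apexʸ := δ :* (G :+ K :* K :* E)) refl

  lower-at-shoulder : ∀ K M δ E G → let open Pℤ K M δ E G in lower (δ * K) shoulderˣ shoulderʸ ≡ δ * K * ((K - 1ℤ) * E)
  lower-at-shoulder = solve 5 (λ K M δ E G → let open Positions poly-ops K M δ E G in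
    lower (δ :* K) shoulderˣ shoulderʸ := δ :* K :* ((K :- con 1ℤ) :* E)) refl

  lower-at-origin : ∀ K M δ E G o → let open Pℤ K M δ E G in lower (δ * K) o 0ℤ ≡ baseˣ - o
  lower-at-origin = solve 6 (λ K M δ E G o → let open Positions poly-ops K M δ E G in
    lower (δ :* K) o (con 0ℤ) := baseˣ :- o) refl

  middle-at-apex : ∀ K M δ E G → let open Pℤ K M δ E G in middle (δ * K) apexˣ apexʸ ≡ δ * G
  middle-at-apex = solve 5 (λ K M δ E G → let open Positions poly-ops K M δ E G in
    middle (δ :* K) apexˣ apexʸ := δ :* G) refl

  middle-at-base : ∀ K M δ E G → let open Pℤ K M δ E G in middle (δ * K) baseˣ 0ℤ ≡ δ * K * E
  middle-at-base = solve 5 (λ K M δ E G → let open Positions poly-ops K M δ E G in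
    middle (δ :* K) baseˣ (con 0ℤ) := δ :* K :* E) refl

  middle-at-origin : ∀ K M δ E G o → let open Pℤ K M δ E G in middle (δ * K) o 0ℤ ≡ (baseˣ - o) + δ * K * E
  middle-at-origin = solve 6 (λ K M δ E G o → let open Positions poly-ops K M δ E G in
    middle (δ :* K) o (con 0ℤ) := (baseˣ :- o) :+ δ :* K :* E) refl

  upper-at-base : ∀ K M δ E G → let open Pℤ K M δ E G in upper (δ * K) baseˣ 0ℤ ≡ δ * K * (E + G)
  upper-at-base = solve 5 (λ K M δ E G → let open Positions poly-ops K M δ E G in
    upper (δ :* K) baseˣ (con 0ℤ) := δ :* K :* (E :+ G)) refl

  upper-at-elbow : ∀ K M δ E G → let open Pℤ K M δ E G in upper (δ * K) elbowˣ δ ≡ δ * ((K - 1ℤ) * G)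
  upper-at-elbow = solve 5 (λ K M δ E G → let open Positions poly-ops K M δ E G in
    upper (δ :* K) elbowˣ δ := δ :* ((K :- con 1ℤ) :* G)) refl

  upper-at-origin : ∀ K M δ E G o → let open Pℤ K M δ E G in upper (δ * K) o 0ℤ ≡ (baseˣ - o) + δ * K * (E + G)
  upper-at-origin = solve 6 (λ K M δ E G o → let open Positions poly-ops K M δ E G in
    upper (δ :* K) o (con 0ℤ) := (baseˣ :- o) :+ δ :* K :* (E :+ G)) refl

  0<+ : ∀ {a b} → 0ℤ < a → 0ℤ ≤ b → 0ℤ < a + b
  0<+ = ℤ.+-mono-<-≤

  positive? : ∀ n → Maybe (0ℤ < + n)
  positive? zero    = nothing
  positive? (suc n) = just (ℤ.+<+ ℕ.z<s)

  zero? : ∀ n → Maybe (n ≡ 0)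
  zero? zero    = just refl
  zero? (suc n) = nothing

  -- The right-hand corners and lines are common to all families; only the left part (`o`,
  -- `notchPoint`, `apexLine`, `notchLine`) is supplied by each.
  module Frame (k m d e γ D-1 : ℕ) (D≡ : + suc D-1 ≡ + d * + k) (0<δ : 0ℤ < + d) (1<K : 1ℤ < + k)
               (o : ℤ) (notchPoint : ℤ × ℤ) (apexLine notchLine : Line) where
    open ScaledPolygon D-1
    private
      K = + k
      M = + m
      δ = + d
      E = + e
      G = + γ
    open Pℤ K M δ E G

    corner : Corner → ℤ × ℤ
    corner apex     = apexˣ , apexʸ
    corner notch    = notchPoint
    corner origin   = o , 0ℤ
    corner base     = baseˣ , 0ℤ
    corner elbow    = elbowˣ , δ
    corner shoulder = shoulderˣ , shoulderʸ

    -- The line through each corner and its counterclockwise successor.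
    line : Corner → Line
    line apex     = apexLine
    line notch    = notchLine
    line origin   = λ _ _ y → y
    line base     = lower
    line elbow    = middle
    line shoulder = upper

    Separation Edge : Corner → Corner → Set
    Separation s v = LeftOf (line s) (corner v)
    Edge s v = Supports (line s) (corner s) (corner v)

    private
      0<K : 0ℤ < K
      0<K = ℤ.<-trans (ℤ.+<+ ℕ.z<s) 1<K

      0<K-1 : 0ℤ < K - 1ℤ
      0<K-1 = <⇒0<- 1<K

      0<δK : 0ℤ < δ * K
      0<δK = 0<* 0<δ 0<K

      separates : ∀ {z} (ℓ : Line) x y → ℓ (δ * K) x y ≡ z → 0ℤ < z → 0ℤ < ℓ (+ D) x y
      separates ℓ x y ℓ≡z = subst (0ℤ <_) (sym (trans (cong (λ t → ℓ t x y) D≡) ℓ≡z))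

      supports : ∀ s v c → 0ℤ < c → (∀ t x y →
        sideOf (δ * K) (proj₁ (corner s)) (proj₂ (corner s)) (proj₁ (corner v)) (proj₂ (corner v)) t x y ≡ c * line s t x y) → Edge s v
      supports s v c 0<c side≡ = c , 0<c , λ t x y →
        trans (cong (λ D → sideOf D (proj₁ (corner s)) (proj₂ (corner s)) (proj₁ (corner v)) (proj₂ (corner v)) t x y) D≡) (side≡ t x y)

    -- `separation` and `edge` supply the entries that involve the left part. `0<base-origin` is
    -- optional since base and origin may coincide.
    module Polygons (separation : ∀ s v → Maybe (Separation s v)) (edge : ∀ s v → Maybe (Edge s v))
                    (0<base-origin : Maybe (0ℤ < baseˣ - o)) where

      -- The tables sep and edges return just as soon as e, γ and B are zero or successors, so separated? and closed?
      -- below are decided by evaluation for each of the finitely many shapes.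
      sep : ∀ s v → Maybe (Separation s v)
      sep origin apex = just (0<* 0<δ (0<+ 0<K (0≤+n 1)))
      sep origin elbow = just 0<δ
      sep origin shoulder = just 0<δK
      sep base apex with positive? e | positive? γ
      ... | just 0<E | _ = just (separates lower apexˣ apexʸ (lower-at-apex K M δ E G)
        (0<* 0<δ (ℤ.+-mono-≤-< (0≤+n γ) (0<* (0<* 0<K 0<K) 0<E))))
      ... | nothing | just 0<G = just (separates lower apexˣ apexʸ (lower-at-apex K M δ E G)
        (0<* 0<δ (0<+ 0<G (0≤* (0≤* (0≤+n k) (0≤+n k)) (0≤+n e)))))
      ... | nothing | nothing = nothing
      sep base shoulder = Maybe.map
        (λ 0<E → separates lower shoulderˣ shoulderʸ (lower-at-shoulder K M δ E G) (0<* 0<δK (0<* 0<K-1 0<E))) (positive? e)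
      sep base origin = Maybe.map
        (λ 0<base-o → separates lower o 0ℤ (lower-at-origin K M δ E G o) 0<base-o) 0<base-origin
      sep elbow apex = Maybe.map
        (λ 0<G → separates middle apexˣ apexʸ (middle-at-apex K M δ E G) (0<* 0<δ 0<G)) (positive? γ)
      sep elbow base = Maybe.map
        (λ 0<E → separates middle baseˣ 0ℤ (middle-at-base K M δ E G) (0<* 0<δK 0<E)) (positive? e)
      sep elbow origin = Maybe.map
        (λ 0<base-o → separates middle o 0ℤ (middle-at-origin K M δ E G o)
          (0<+ 0<base-o (0≤* (ℤ.<⇒≤ 0<δK) (0≤+n e)))) 0<base-origin
      sep shoulder base with positive? e | positive? γ
      ... | just 0<E | _ = just (separates upper baseˣ 0ℤ (upper-at-base K M δ E G) (0<* 0<δK (0<+ 0<E (0≤+n γ))))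
      ... | nothing | just 0<G = just (separates upper baseˣ 0ℤ (upper-at-base K M δ E G)
        (0<* 0<δK (ℤ.+-mono-≤-< (0≤+n e) 0<G)))
      ... | nothing | nothing = nothing
      sep shoulder elbow = Maybe.map
        (λ 0<G → separates upper elbowˣ δ (upper-at-elbow K M δ E G) (0<* 0<δ (0<* 0<K-1 0<G))) (positive? γ)
      sep shoulder origin = Maybe.map
        (λ 0<base-o → separates upper o 0ℤ (upper-at-origin K M δ E G o)
          (0<+ 0<base-o (0≤* (ℤ.<⇒≤ 0<δK) (0≤+ (0≤+n e) (0≤+n γ))))) 0<base-origin
      sep s v = separation s v

      edges : ∀ s v → Maybe (Edge s v)
      edges origin base = Maybe.map
        (λ 0<base-o → supports origin base ((baseˣ - o) * (δ * K)) (0<* 0<base-o 0<δK) (origin→base K M δ E G o)) 0<base-origin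
      edges base elbow = just (supports base elbow (δ * (δ * K)) (0<* 0<δ 0<δK) (base→elbow K M δ E G))
      edges base shoulder = Maybe.map
        (λ { refl → supports base shoulder (δ * K * (δ * K)) (0<* 0<δK 0<δK) (base→shoulder K M δ G) }) (zero? e)
      edges base apex with zero? e | zero? γ
      ... | just refl | just refl = just (supports base apex ((δ * K + δ) * (δ * K)) (0<* (0<+ 0<δK (ℤ.<⇒≤ 0<δ)) 0<δK) (base→apex K M δ))
      ... | _ | _ = nothing
      edges elbow shoulder = just (supports elbow shoulder (δ * (K - 1ℤ) * (δ * K)) (0<* (0<* 0<δ 0<K-1) 0<δK) (elbow→shoulder K M δ E G))
      edges elbow apex = Maybe.map
        (λ { refl → supports elbow apex (δ * K * (δ * K)) (0<* 0<δK 0<δK) (elbow→apex K M δ E) }) (zero? γ)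
      edges shoulder apex = just (supports shoulder apex (δ * (δ * K)) (0<* 0<δ 0<δK) (shoulder→apex K M δ E G))
      edges s v = edge s v

      module _ {n} (corners : Vec Corner (suc (suc (suc n)))) where
        private
          at : Fin (suc (suc (suc n))) → Corner
          at = lookup corners

        separated? : Dec (∀ j i → (i ≡ j) ⊎ (i ≡ next j) ⊎ T (is-just (sep (at j) (at i))))
        separated? = Fin.all? λ j → Fin.all? λ i →
          (i Fin.≟ j) ⊎-dec ((i Fin.≟ next j) ⊎-dec T? (is-just (sep (at j) (at i))))

        closed? : Dec (∀ j → T (is-just (edges (at j) (at (next j)))))
        closed? = Fin.all? λ j → T? (is-just (edges (at j) (at (next j))))

        module _ {separated : True separated?} {closed : True closed?} where
          cornerPoints : Fin (suc (suc (suc n))) → ℤ × ℤ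
          cornerPoints j = corner (at j)

          cornerLines : Fin (suc (suc (suc n))) → Line
          cornerLines j = line (at j)

          edges-support : ∀ j → Supports (cornerLines j) (cornerPoints j) (cornerPoints (next j))
          edges-support j = to-witness-T (edges (at j) (at (next j))) (toWitness closed j)

          corners-left : ∀ j i → i ≢ j → i ≢ next j → LeftOf (cornerLines j) (cornerPoints i)
          corners-left j i i≢j i≢next with toWitness separated j i
          ... | inj₁ i≡j = contradiction i≡j i≢j
          ... | inj₂ (inj₁ i≡next) = contradiction i≡next i≢next
          ... | inj₂ (inj₂ left) = to-witness-T (sep (at j) (at i)) left

          cornerPolygon : ConvexPolygon
          cornerPolygon = polygon cornerPoints cornerLines edges-support corners-left

          cornerPolygon-realises : ∀ {i b} (Region : (ℤ → Set) → ℤ → ℤ × ℤ → Set) c₁ c₂ →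
            (∀ {Q} → Sign Q → ∀ t x y → (∀ j → Q (line (at j) t x y)) ⇔ Region Q t (x , y)) →
            (∀ t → Σ ℕ λ n → HasCard (Region (0ℤ ≤_) (+ t)) n × two * + n ≡ c₂ * (+ t * + t) + c₁ * + t + two) →
            HasCard (Region (0ℤ <_) 1ℤ) i →
            HasCard (λ z → Region (0ℤ ≤_) 1ℤ z × ¬ Region (0ℤ <_) 1ℤ z) b →
            (∀ n → 1 ℕ.≤ n → n ℕ.< D → ¬ VerticesIntegralAfter n cornerPolygon) →
            Realises D i b cornerPolygon
          cornerPolygon-realises Region c₁ c₂ region⇔ region-card interior-card boundary-card minimal =
            realises cornerPolygon Region c₁ c₂
              (s≤s z≤n , integral-after-D cornerPoints cornerLines edges-support corners-left , minimal)
              (λ t (x , y) → ⇔-trans (inDil⇔ cornerPoints cornerLines edges-support corners-left t x y) (region⇔ 0≤-sign (+ suc t) x y))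
              (λ (x , y) → ⇔-trans (inP⇔ cornerPoints cornerLines edges-support corners-left x y) (region⇔ 0≤-sign 1ℤ x y))
              (λ (x , y) → ⇔-trans (inInt⇔ cornerPoints cornerLines edges-support corners-left x y) (region⇔ 0<-sign 1ℤ x y))
              region-card interior-card boundary-card

  -- The three families, indexed by k.  Only k = 4 has a notch: for k = 3, 5 that corner is a dummy.

  -- Omitting a degenerate corner loses no inequality: for E = 0 the forms `lower` and `middle`
  -- coincide, for G = 0 `middle` and `upper` do.
  lower≡middle : ∀ K M G t x y → Lℤ.lower K M 0ℤ G t x y ≡ Lℤ.middle K M 0ℤ G t x y
  lower≡middle = solve 6 (λ K M G t x y → let open Lines poly-ops K M (con 0ℤ) G in lower t x y := middle t x y) refl

  middle≡upper : ∀ K M E t x y → Lℤ.middle K M E 0ℤ t x y ≡ Lℤ.upper K M E 0ℤ t x y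
  middle≡upper = solve 6 (λ K M E t x y → let open Lines poly-ops K M E (con 0ℤ) in middle t x y := upper t x y) refl

  no-elbow : ∀ K M G (Q : ℤ → Set) t x y → let open Lℤ K M 0ℤ G in
    Q (lower t x y) → Q (upper t x y) → Q (lower t x y) × Q (middle t x y) × Q (upper t x y)
  no-elbow K M G Q t x y l u = l , subst Q (lower≡middle K M G t x y) l , u

  no-shoulder : ∀ K M E (Q : ℤ → Set) t x y → let open Lℤ K M E 0ℤ in
    Q (lower t x y) → Q (middle t x y) → Q (lower t x y) × Q (middle t x y) × Q (upper t x y)
  no-shoulder K M E Q t x y l m = l , m , subst Q (middle≡upper K M E t x y) m

  no-elbow-no-shoulder : ∀ K M (Q : ℤ → Set) t x y → let open Lℤ K M 0ℤ 0ℤ in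
    Q (lower t x y) → Q (lower t x y) × Q (middle t x y) × Q (upper t x y)
  no-elbow-no-shoulder K M Q t x y l = no-shoulder K M 0ℤ Q t x y l (subst Q (lower≡middle K M 0ℤ t x y) l)

  module Family₃ (e γ B : ℕ) (B≡ : + B ≡ Lℤ.B (+ 3) (+ 2) (+ e) (+ γ)) where
    open Count₃ e γ B B≡
    open ScaledPolygon 2
    apexLine : Line
    apexLine t x y = + 2 * x + y
    open Frame 3 2 1 e γ 2 refl (ℤ.+<+ ℕ.z<s) (ℤ.+<+ (s≤s (s≤s z≤n))) 0ℤ (0ℤ , 0ℤ) apexLine apexLine public
    private
      E = + e
      G = + γ
      0≤B = subst (0ℤ ≤_) B≡ (0≤+n B)

      at-base : ∀ E G → let open Pℤ (+ 3) (+ 2) 1ℤ E G renaming (B to B′) in + 2 * baseˣ + 0ℤ ≡ + 6 * B′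
      at-base = solve 2 (λ E G → let open Positions poly-ops (con (+ 3)) (con (+ 2)) (con 1ℤ) E G renaming (B to B′) in
        con (+ 2) :* baseˣ :+ con 0ℤ := con (+ 6) :* B′) refl

      at-elbow : ∀ E G → let open Pℤ (+ 3) (+ 2) 1ℤ E G renaming (B to B′) in + 2 * elbowˣ + 1ℤ ≡ + 3 + (+ 4 * B′ + + 6 * E)
      at-elbow = solve 2 (λ E G → let open Positions poly-ops (con (+ 3)) (con (+ 2)) (con 1ℤ) E G renaming (B to B′) in
        con (+ 2) :* elbowˣ :+ con 1ℤ := con (+ 3) :+ (con (+ 4) :* B′ :+ con (+ 6) :* E)) refl

      left-edge : ∀ t x y → (0ℤ - -[1+ 1 ]) * (+ 3 * y - t * + 4) - (0ℤ - + 4) * (+ 3 * x - t * -[1+ 1 ]) ≡ + 6 * (+ 2 * x + y)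
      left-edge = solve-∀

      separation : ∀ s v → Maybe (Separation s v)
      separation apex base = Maybe.map (λ 0<B → subst (0ℤ <_) (sym (at-base E G))
        (0<* (ℤ.+<+ {0} {6} ℕ.z<s) (subst (0ℤ <_) B≡ 0<B))) (positive? B)
      separation apex elbow = just (subst (0ℤ <_) (sym (at-elbow E G))
        (0<+ (ℤ.+<+ {0} {3} ℕ.z<s) (0≤+ (0≤* (0≤+n 4) 0≤B) (0≤* (0≤+n 6) (0≤+n e)))))
      separation apex shoulder = just (0<+ (0<* (ℤ.+<+ {0} {2} ℕ.z<s) (ℤ.+<+ ℕ.z<s)) (0≤+n 3))
      separation _ _ = nothing

      edge : ∀ s v → Maybe (Edge s v)
      edge apex origin = just (+ 6 , ℤ.+<+ ℕ.z<s , left-edge)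
      -- For B = 0 the base is the origin, so the left edge ends there.
      edge apex base = Maybe.map (λ { refl → subst (λ b → Supports apexLine (corner apex) (1ℤ * + 3 * b , 0ℤ)) B≡
        (+ 6 , ℤ.+<+ ℕ.z<s , left-edge) }) (zero? B)
      edge _ _ = nothing

      base-origin : Maybe (0ℤ < 1ℤ * + 3 * Lℤ.B (+ 3) (+ 2) E G - 0ℤ)
      base-origin = Maybe.map (λ 0<B → 0<+ (0<* (ℤ.+<+ {0} {3} ℕ.z<s) (subst (0ℤ <_) B≡ 0<B)) (0≤+n 0)) (positive? B)

    open Polygons separation edge base-origin public

    -- The direction that depends on the shape, as forms of omitted corners must be recovered;
    -- `region-lines` gives the converse for all shapes at once.
    Fills : ∀ {n} → Vec Corner n → Set₁
    Fills corners = ∀ {Q} → Sign Q → ∀ t x y → (∀ j → Q (line (lookup corners j) t x y)) → Region Q t (x , y)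

    region-lines : ∀ (Q : ℤ → Set) t x y → Region Q t (x , y) → ∀ c → Q (line c t x y)
    region-lines Q t x y (_ , _ , left) apex = left
    region-lines Q t x y (_ , _ , left) notch = left
    region-lines Q t x y (bottom , _) origin = bottom
    region-lines Q t x y (_ , (l , _) , _) base = l
    region-lines Q t x y (_ , (_ , m , _) , _) elbow = m
    region-lines Q t x y (_ , (_ , _ , u) , _) shoulder = u

    -- For b = 2 the bottom edge shrinks to a point, and y has to be bounded by its two neighbours:
    -- twice `lower` plus the left form is (3 + 6 E) y.
    bottom-if-B≡0 : 0 ≡ B → ∀ {Q} → Sign Q → ∀ t x y → Q (line base t x y) → Q (line apex t x y) → Q y
    bottom-if-B≡0 refl {Q} sign t x y lower left = to (Sign.scale sign 0<factor y)
      (subst Q (trans (combine E G t x y) (trans (cong (λ b → + 2 * b * t + (+ 3 + + 6 * E - + 2 * b) * y) (sym B≡)) (simplify E t y)))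
        (Sign.add sign (from (Sign.scale sign (ℤ.+<+ {0} {2} ℕ.z<s) (line base t x y)) lower) left))
      where
      combine : ∀ E G t x y → + 2 * Lℤ.lower (+ 3) (+ 2) E G t x y + (+ 2 * x + y) ≡
        + 2 * Lℤ.B (+ 3) (+ 2) E G * t + (+ 3 + + 6 * E - + 2 * Lℤ.B (+ 3) (+ 2) E G) * y
      combine = solve 5 (λ E G t x y → let open Lines poly-ops (con (+ 3)) (con (+ 2)) E G renaming (B to B′; lower to lower′) in
        con (+ 2) :* lower′ t x y :+ (con (+ 2) :* x :+ y)
          := con (+ 2) :* B′ :* t :+ (con (+ 3) :+ con (+ 6) :* E :- con (+ 2) :* B′) :* y) refl
      simplify : ∀ E t y → + 2 * 0ℤ * t + (+ 3 + + 6 * E - + 2 * 0ℤ) * y ≡ (+ 3 + + 6 * E) * y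
      simplify = solve-∀
      0<factor : 0ℤ < + 3 + + 6 * E
      0<factor = 0<+ (ℤ.+<+ {0} {3} ℕ.z<s) (0≤* (0≤+n 6) (0≤+n e))

    realise : ∀ {n} (rest : Vec Corner (suc (suc n))) {s : True (separated? (apex ∷ rest))} {c : True (closed? (apex ∷ rest))} →
      Fills (apex ∷ rest) → Σ ConvexPolygon (Realises 3 (suc e) (2 ℕ.+ B))
    realise rest {s} {c} fills = cornerPolygon (apex ∷ rest) {s} {c} ,
      cornerPolygon-realises (apex ∷ rest) {s} {c} Region c₁ c₂
        (λ {Q} sign t x y → mk⇔ (fills sign t x y) (λ region j → region-lines Q t x y region (lookup (apex ∷ rest) j)))
        region-card interior-card boundary-card
        -- The height 4/3 of the apex excludes 1 and 2.
        λ { 1 _ _ h → 3≢1 (proj₂ (h 0F)) ; 2 _ _ h → 3≢1 (proj₂ (h 0F)) ; (suc (suc (suc _))) _ (s≤s (s≤s (s≤s ()))) }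
      where
      3≢1 : 3 ≢ 1
      3≢1 ()

  -- The shape depends on whether elbow (e > 0), shoulder (γ > 0) and bottom edge (B > 0) are
  -- present. B = 0 together with γ = 0 is impossible, since `B≡` would equate 0 with a positive
  -- number.
  family₃ : ∀ e γ B → + B ≡ Lℤ.B (+ 3) (+ 2) (+ e) (+ γ) → Σ ConvexPolygon (Realises 3 (suc e) (2 ℕ.+ B))
  family₃ zero    zero    (suc B) B≡ = Family₃.realise 0 0 (suc B) B≡ (origin ∷ base ∷ [])
    λ {Q} _ t x y h → h 1F , no-elbow-no-shoulder (+ 3) (+ 2) Q t x y (h 2F) , h 0F
  family₃ zero    (suc γ) (suc B) B≡ = Family₃.realise 0 (suc γ) (suc B) B≡ (origin ∷ base ∷ shoulder ∷ [])
    λ {Q} _ t x y h → h 1F , no-elbow (+ 3) (+ 2) (+ suc γ) Q t x y (h 2F) (h 3F) , h 0F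
  family₃ (suc e) zero    (suc B) B≡ = Family₃.realise (suc e) 0 (suc B) B≡ (origin ∷ base ∷ elbow ∷ [])
    λ {Q} _ t x y h → h 1F , no-shoulder (+ 3) (+ 2) (+ suc e) Q t x y (h 2F) (h 3F) , h 0F
  family₃ (suc e) (suc γ) (suc B) B≡ = Family₃.realise (suc e) (suc γ) (suc B) B≡ (origin ∷ base ∷ elbow ∷ shoulder ∷ [])
    λ _ t x y h → h 1F , (h 2F , h 3F , h 4F) , h 0F
  family₃ zero    (suc γ) zero B≡ = Family₃.realise 0 (suc γ) 0 B≡ (base ∷ shoulder ∷ [])
    λ {Q} sign t x y h → Family₃.bottom-if-B≡0 0 (suc γ) 0 B≡ refl sign t x y (h 1F) (h 0F) ,
      no-elbow (+ 3) (+ 2) (+ suc γ) Q t x y (h 1F) (h 2F) , h 0F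
  family₃ (suc e) (suc γ) zero B≡ = Family₃.realise (suc e) (suc γ) 0 B≡ (base ∷ elbow ∷ shoulder ∷ [])
    λ sign t x y h → Family₃.bottom-if-B≡0 (suc e) (suc γ) 0 B≡ refl sign t x y (h 1F) (h 0F) , (h 1F , h 2F , h 3F) , h 0F

  module Family₄ (e γ B : ℕ) (B≡ : + B ≡ Lℤ.B (+ 4) (+ 1) (+ e) (+ γ)) where
    open Count₄ e γ B B≡
    open ScaledPolygon 3
    apexLine notchLine : Line
    apexLine t x y = + 3 * x - y + + 2 * t
    notchLine _ x y = x + y
    open Frame 4 1 1 e γ 3 refl (ℤ.+<+ ℕ.z<s) (ℤ.+<+ (s≤s (s≤s z≤n))) 0ℤ (-[1+ 1 ] , + 2) apexLine notchLine public
    private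
      E = + e
      G = + γ
      0≤B = subst (0ℤ ≤_) B≡ (0≤+n B)

      apexLine-at-base : ∀ E G → let open Pℤ (+ 4) (+ 1) 1ℤ E G renaming (B to B′) in
        + 3 * baseˣ - 0ℤ + + 8 ≡ + 8 + + 12 * B′
      apexLine-at-base = solve 2 (λ E G → let open Positions poly-ops (con (+ 4)) (con (+ 1)) (con 1ℤ) E G renaming (B to B′) in
        con (+ 3) :* baseˣ :- con 0ℤ :+ con (+ 8) := con (+ 8) :+ con (+ 12) :* B′) refl

      apexLine-at-elbow : ∀ E G → let open Pℤ (+ 4) (+ 1) 1ℤ E G renaming (B to B′) in
        + 3 * elbowˣ - 1ℤ + + 8 ≡ + 10 + (+ 9 * B′ + + 12 * E)
      apexLine-at-elbow = solve 2 (λ E G → let open Positions poly-ops (con (+ 4)) (con (+ 1)) (con 1ℤ) E G renaming (B to B′) in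
        con (+ 3) :* elbowˣ :- con 1ℤ :+ con (+ 8) := con (+ 10) :+ (con (+ 9) :* B′ :+ con (+ 12) :* E)) refl

      apexLine-at-shoulder : ∀ E → + 3 * (1ℤ * + 4 * (1ℤ + E)) - + 4 + + 8 ≡ + 16 + + 12 * E
      apexLine-at-shoulder = solve-∀

      notchLine-at-elbow : ∀ E G → let open Pℤ (+ 4) (+ 1) 1ℤ E G renaming (B to B′) in
        elbowˣ + 1ℤ ≡ + 2 + (+ 3 * B′ + + 4 * E)
      notchLine-at-elbow = solve 2 (λ E G → let open Positions poly-ops (con (+ 4)) (con (+ 1)) (con 1ℤ) E G renaming (B to B′) in
        elbowˣ :+ con 1ℤ := con (+ 2) :+ (con (+ 3) :* B′ :+ con (+ 4) :* E)) refl

      lower-at-notch : ∀ E G → let open Lℤ (+ 4) (+ 1) E G renaming (B to B′; lower to lower′) in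
        lower′ (+ 4) -[1+ 1 ] (+ 2) ≡ + 4 + (+ 2 * B′ + + 8 * E)
      lower-at-notch = solve 2 (λ E G → let open Lines poly-ops (con (+ 4)) (con (+ 1)) E G renaming (B to B′; lower to lower′) in
        lower′ (con (+ 4)) (con -[1+ 1 ]) (con (+ 2)) := con (+ 4) :+ (con (+ 2) :* B′ :+ con (+ 8) :* E)) refl

      middle-at-notch : ∀ E G → let open Lℤ (+ 4) (+ 1) E G renaming (B to B′; middle to middle′) in
        middle′ (+ 4) -[1+ 1 ] (+ 2) ≡ + 4 + (+ 2 * B′ + + 4 * E)
      middle-at-notch = solve 2 (λ E G → let open Lines poly-ops (con (+ 4)) (con (+ 1)) E G renaming (B to B′; middle to middle′) in
        middle′ (con (+ 4)) (con -[1+ 1 ]) (con (+ 2)) := con (+ 4) :+ (con (+ 2) :* B′ :+ con (+ 4) :* E)) refl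

      upper-at-notch : ∀ E G → let open Lℤ (+ 4) (+ 1) E G renaming (upper to upper′) in
        upper′ (+ 4) -[1+ 1 ] (+ 2) ≡ + 16 + + 12 * E
      upper-at-notch = solve 2 (λ E G → let open Lines poly-ops (con (+ 4)) (con (+ 1)) E G renaming (upper to upper′) in
        upper′ (con (+ 4)) (con -[1+ 1 ]) (con (+ 2)) := con (+ 16) :+ con (+ 12) :* E) refl

      apex-edge : ∀ t x y → (-[1+ 1 ] - -[1+ 0 ]) * (+ 4 * y - t * + 5) - (+ 2 - + 5) * (+ 4 * x - t * -[1+ 0 ]) ≡ + 4 * (+ 3 * x - y + + 2 * t)
      apex-edge = solve-∀

      notch-edge : ∀ t x y → (0ℤ - -[1+ 1 ]) * (+ 4 * y - t * + 2) - (0ℤ - + 2) * (+ 4 * x - t * -[1+ 1 ]) ≡ + 8 * (x + y)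
      notch-edge = solve-∀

      combination : ∀ a b {z w} c → 0ℤ ≤ z → 0ℤ ≤ w → 0ℤ < + suc c + (+ a * z + + b * w)
      combination a b c 0≤z 0≤w = 0<+ (ℤ.+<+ {0} {suc c} ℕ.z<s) (0≤+ (0≤* (0≤+n a) 0≤z) (0≤* (0≤+n b) 0≤w))

      separation : ∀ s v → Maybe (Separation s v)
      separation apex origin = just (ℤ.+<+ ℕ.z<s)
      separation apex base = just (subst (0ℤ <_) (sym (apexLine-at-base E G))
        (0<+ (ℤ.+<+ {0} {8} ℕ.z<s) (0≤* (0≤+n 12) 0≤B)))
      separation apex elbow = just (subst (0ℤ <_) (sym (apexLine-at-elbow E G)) (combination 9 12 9 0≤B (0≤+n e)))
      separation apex shoulder = just (subst (0ℤ <_) (sym (apexLine-at-shoulder E))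
        (0<+ (ℤ.+<+ {0} {16} ℕ.z<s) (0≤* (0≤+n 12) (0≤+n e))))
      separation notch apex = just (ℤ.+<+ ℕ.z<s)
      separation notch base = Maybe.map (λ 0<B → subst (0ℤ <_) (sym (ℤ.+-identityʳ _))
        (0<* (ℤ.+<+ {0} {4} ℕ.z<s) (subst (0ℤ <_) B≡ 0<B))) (positive? B)
      separation notch elbow = just (subst (0ℤ <_) (sym (notchLine-at-elbow E G)) (combination 3 4 1 0≤B (0≤+n e)))
      separation notch shoulder = just (0<+ (ℤ.+<+ ℕ.z<s) (0≤+n 4))
      separation origin notch = just (ℤ.+<+ ℕ.z<s)
      separation base notch = just (subst (0ℤ <_) (sym (lower-at-notch E G)) (combination 2 8 3 0≤B (0≤+n e)))
      separation elbow notch = just (subst (0ℤ <_) (sym (middle-at-notch E G)) (combination 2 4 3 0≤B (0≤+n e)))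
      separation shoulder notch = just (subst (0ℤ <_) (sym (upper-at-notch E G))
        (0<+ (ℤ.+<+ {0} {16} ℕ.z<s) (0≤* (0≤+n 12) (0≤+n e))))
      separation _ _ = nothing

      edge : ∀ s v → Maybe (Edge s v)
      edge apex notch = just (+ 4 , ℤ.+<+ ℕ.z<s , apex-edge)
      edge notch origin = just (+ 8 , ℤ.+<+ ℕ.z<s , notch-edge)
      edge notch base = Maybe.map (λ { refl → subst (λ b → Supports notchLine (corner notch) (1ℤ * + 4 * b , 0ℤ)) B≡
        (+ 8 , ℤ.+<+ ℕ.z<s , notch-edge) }) (zero? B)
      edge _ _ = nothing

      base-origin : Maybe (0ℤ < 1ℤ * + 4 * Lℤ.B (+ 4) (+ 1) E G - 0ℤ)
      base-origin = Maybe.map (λ 0<B → 0<+ (0<* (ℤ.+<+ {0} {4} ℕ.z<s) (subst (0ℤ <_) B≡ 0<B)) (0≤+n 0)) (positive? B)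

    open Polygons separation edge base-origin public

    Fills : ∀ {n} → Vec Corner n → Set₁
    Fills corners = ∀ {Q} → Sign Q → ∀ t x y → (∀ j → Q (line (lookup corners j) t x y)) → Region Q t (x , y)

    region-lines : ∀ (Q : ℤ → Set) t x y → Region Q t (x , y) → ∀ c → Q (line c t x y)
    region-lines Q t x y (_ , _ , above , _) apex = above
    region-lines Q t x y (_ , _ , _ , below) notch = below
    region-lines Q t x y (bottom , _) origin = bottom
    region-lines Q t x y (_ , (l , _) , _) base = l
    region-lines Q t x y (_ , (_ , m , _) , _) elbow = m
    region-lines Q t x y (_ , (_ , _ , u) , _) shoulder = u

    -- As for k = 3, with the side through the notch as left neighbour: the two forms add up to (2 +
    -- 4 E) y.
    bottom-if-B≡0 : 0 ≡ B → ∀ {Q} → Sign Q → ∀ t x y → Q (line base t x y) → Q (line notch t x y) → Q y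
    bottom-if-B≡0 refl {Q} sign t x y lower below = to (Sign.scale sign 0<factor y)
      (subst Q (trans (combine E G t x y) (trans (cong (λ b → b * t + (+ 2 + + 4 * E - b) * y) (sym B≡)) (simplify E t y)))
        (Sign.add sign lower below))
      where
      combine : ∀ E G t x y → Lℤ.lower (+ 4) (+ 1) E G t x y + (x + y) ≡
        Lℤ.B (+ 4) (+ 1) E G * t + (+ 2 + + 4 * E - Lℤ.B (+ 4) (+ 1) E G) * y
      combine = solve 5 (λ E G t x y → let open Lines poly-ops (con (+ 4)) (con (+ 1)) E G renaming (B to B′; lower to lower′) in
        lower′ t x y :+ (x :+ y) := B′ :* t :+ (con (+ 2) :+ con (+ 4) :* E :- B′) :* y) refl
      simplify : ∀ E t y → 0ℤ * t + (+ 2 + + 4 * E - 0ℤ) * y ≡ (+ 2 + + 4 * E) * y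
      simplify = solve-∀
      0<factor : 0ℤ < + 2 + + 4 * E
      0<factor = 0<+ (ℤ.+<+ {0} {2} ℕ.z<s) (0≤* (0≤+n 4) (0≤+n e))

    realise : ∀ {n} (rest : Vec Corner (suc (suc n))) {s : True (separated? (apex ∷ rest))} {c : True (closed? (apex ∷ rest))} →
      Fills (apex ∷ rest) → Σ ConvexPolygon (Realises 4 (suc e) (2 ℕ.+ B))
    realise rest {s} {c} fills = cornerPolygon (apex ∷ rest) {s} {c} ,
      cornerPolygon-realises (apex ∷ rest) {s} {c} Region c₁ c₂
        (λ {Q} sign t x y → mk⇔ (fills sign t x y) (λ region j → region-lines Q t x y region (lookup (apex ∷ rest) j)))
        region-card interior-card boundary-card
        λ { 1 _ _ h → 4≢1 (proj₂ (h 0F)) ; 2 _ _ h → 2≢1 (proj₂ (h 0F)) ; 3 _ _ h → 4≢1 (proj₂ (h 0F))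
          ; (suc (suc (suc (suc _)))) _ (s≤s (s≤s (s≤s (s≤s ())))) }
      where
      4≢1 : 4 ≢ 1
      4≢1 ()
      2≢1 : 2 ≢ 1
      2≢1 ()

  family₄ : ∀ e γ B → + B ≡ Lℤ.B (+ 4) (+ 1) (+ e) (+ γ) → Σ ConvexPolygon (Realises 4 (suc e) (2 ℕ.+ B))
  family₄ zero    zero    (suc B) B≡ = Family₄.realise 0 0 (suc B) B≡ (notch ∷ origin ∷ base ∷ [])
    λ {Q} _ t x y h → h 2F , no-elbow-no-shoulder (+ 4) (+ 1) Q t x y (h 3F) , h 0F , h 1F
  family₄ zero    (suc γ) (suc B) B≡ = Family₄.realise 0 (suc γ) (suc B) B≡ (notch ∷ origin ∷ base ∷ shoulder ∷ [])
    λ {Q} _ t x y h → h 2F , no-elbow (+ 4) (+ 1) (+ suc γ) Q t x y (h 3F) (h 4F) , h 0F , h 1F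
  family₄ (suc e) zero    (suc B) B≡ = Family₄.realise (suc e) 0 (suc B) B≡ (notch ∷ origin ∷ base ∷ elbow ∷ [])
    λ {Q} _ t x y h → h 2F , no-shoulder (+ 4) (+ 1) (+ suc e) Q t x y (h 3F) (h 4F) , h 0F , h 1F
  family₄ (suc e) (suc γ) (suc B) B≡ = Family₄.realise (suc e) (suc γ) (suc B) B≡ (notch ∷ origin ∷ base ∷ elbow ∷ shoulder ∷ [])
    λ _ t x y h → h 2F , (h 3F , h 4F , h 5F) , h 0F , h 1F
  family₄ zero    (suc γ) zero B≡ = Family₄.realise 0 (suc γ) 0 B≡ (notch ∷ base ∷ shoulder ∷ [])
    λ {Q} sign t x y h → Family₄.bottom-if-B≡0 0 (suc γ) 0 B≡ refl sign t x y (h 2F) (h 1F) ,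
      no-elbow (+ 4) (+ 1) (+ suc γ) Q t x y (h 2F) (h 3F) , h 0F , h 1F
  family₄ (suc e) (suc γ) zero B≡ = Family₄.realise (suc e) (suc γ) 0 B≡ (notch ∷ base ∷ elbow ∷ shoulder ∷ [])
    λ sign t x y h → Family₄.bottom-if-B≡0 (suc e) (suc γ) 0 B≡ refl sign t x y (h 2F) (h 1F) , (h 2F , h 3F , h 4F) , h 0F , h 1F

  module Family₅ (e γ B : ℕ) (B≡ : + B ≡ Lℤ.B (+ 5) (+ 1) (+ e) (+ γ)) where
    open Count₅ e γ B B≡
    open ScaledPolygon 9
    apexLine : Line
    apexLine t x y = + 4 * x - y + + 2 * t
    open Frame 5 1 2 e γ 9 refl (ℤ.+<+ ℕ.z<s) (ℤ.+<+ (s≤s (s≤s z≤n))) -[1+ 4 ] (0ℤ , 0ℤ) apexLine apexLine public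
    private
      E = + e
      G = + γ
      0≤B = subst (0ℤ ≤_) B≡ (0≤+n B)

      at-base : ∀ E G → let open Pℤ (+ 5) (+ 1) (+ 2) E G renaming (B to B′) in
        + 4 * baseˣ - 0ℤ + + 20 ≡ + 20 + + 40 * B′
      at-base = solve 2 (λ E G → let open Positions poly-ops (con (+ 5)) (con (+ 1)) (con (+ 2)) E G renaming (B to B′) in
        con (+ 4) :* baseˣ :- con 0ℤ :+ con (+ 20) := con (+ 20) :+ con (+ 40) :* B′) refl

      at-elbow : ∀ E G → let open Pℤ (+ 5) (+ 1) (+ 2) E G renaming (B to B′) in
        + 4 * elbowˣ - + 2 + + 20 ≡ + 26 + (+ 32 * B′ + + 40 * E)
      at-elbow = solve 2 (λ E G → let open Positions poly-ops (con (+ 5)) (con (+ 1)) (con (+ 2)) E G renaming (B to B′) in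
        con (+ 4) :* elbowˣ :- con (+ 2) :+ con (+ 20) := con (+ 26) :+ (con (+ 32) :* B′ :+ con (+ 40) :* E)) refl

      at-shoulder : ∀ E → + 4 * (+ 2 * + 5 * (1ℤ + E)) - + 10 + + 20 ≡ + 50 + + 40 * E
      at-shoulder = solve-∀

      left-edge : ∀ t x y → (-[1+ 4 ] - -[1+ 1 ]) * (+ 10 * y - t * + 12) - (0ℤ - + 12) * (+ 10 * x - t * -[1+ 1 ]) ≡ + 30 * (+ 4 * x - y + + 2 * t)
      left-edge = solve-∀

      separation : ∀ s v → Maybe (Separation s v)
      separation apex base = just (subst (0ℤ <_) (sym (at-base E G)) (0<+ (ℤ.+<+ {0} {20} ℕ.z<s) (0≤* (0≤+n 40) 0≤B)))
      separation apex elbow = just (subst (0ℤ <_) (sym (at-elbow E G))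
        (0<+ (ℤ.+<+ {0} {26} ℕ.z<s) (0≤+ (0≤* (0≤+n 32) 0≤B) (0≤* (0≤+n 40) (0≤+n e)))))
      separation apex shoulder = just (subst (0ℤ <_) (sym (at-shoulder E))
        (0<+ (ℤ.+<+ {0} {50} ℕ.z<s) (0≤* (0≤+n 40) (0≤+n e))))
      separation _ _ = nothing

      edge : ∀ s v → Maybe (Edge s v)
      edge apex origin = just (+ 30 , ℤ.+<+ ℕ.z<s , left-edge)
      edge _ _ = nothing

      -- With the origin at -1/2 the bottom edge never degenerates, so B = 0 is not a separate shape
      -- here.
      base-origin : 0ℤ < + 2 * + 5 * Lℤ.B (+ 5) (+ 1) E G - -[1+ 4 ]
      base-origin = ℤ.+-mono-≤-< (0≤* (0≤+n 10) 0≤B) (ℤ.+<+ {0} {5} ℕ.z<s)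

    open Polygons separation edge (just base-origin) public

    Fills : ∀ {n} → Vec Corner n → Set₁
    Fills corners = ∀ {Q} → Sign Q → ∀ t x y → (∀ j → Q (line (lookup corners j) t x y)) → Region Q t (x , y)

    region-lines : ∀ (Q : ℤ → Set) t x y → Region Q t (x , y) → ∀ c → Q (line c t x y)
    region-lines Q t x y (_ , _ , left) apex = left
    region-lines Q t x y (_ , _ , left) notch = left
    region-lines Q t x y (bottom , _) origin = bottom
    region-lines Q t x y (_ , (l , _) , _) base = l
    region-lines Q t x y (_ , (_ , m , _) , _) elbow = m
    region-lines Q t x y (_ , (_ , _ , u) , _) shoulder = u

    realise : ∀ {n} (rest : Vec Corner (suc n)) {s : True (separated? (apex ∷ origin ∷ rest))} {c : True (closed? (apex ∷ origin ∷ rest))} →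
      Fills (apex ∷ origin ∷ rest) → Σ ConvexPolygon (Realises 10 (suc e) (2 ℕ.+ B))
    realise rest {s} {c} fills = cornerPolygon (apex ∷ origin ∷ rest) {s} {c} ,
      cornerPolygon-realises (apex ∷ origin ∷ rest) {s} {c} Region c₁ c₂
        (λ {Q} sign t x y → mk⇔ (fills sign t x y) (λ region j → region-lines Q t x y region (lookup (apex ∷ origin ∷ rest) j)))
        region-card interior-card boundary-card
        -- The height 6/5 of the apex excludes every value below 10 except 5, which the abscissa
        -- -1/2 of the origin excludes; hence both are fixed as the first two corners.
        λ { 1 _ _ h → 5≢1 (proj₂ (h 0F)) ; 2 _ _ h → 5≢1 (proj₂ (h 0F)) ; 3 _ _ h → 5≢1 (proj₂ (h 0F))
          ; 4 _ _ h → 5≢1 (proj₂ (h 0F)) ; 5 _ _ h → 2≢1 (proj₁ (h 1F)) ; 6 _ _ h → 5≢1 (proj₂ (h 0F))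
          ; 7 _ _ h → 5≢1 (proj₂ (h 0F)) ; 8 _ _ h → 5≢1 (proj₂ (h 0F)) ; 9 _ _ h → 5≢1 (proj₂ (h 0F))
          ; (suc (suc (suc (suc (suc (suc (suc (suc (suc (suc _)))))))))) _
              (s≤s (s≤s (s≤s (s≤s (s≤s (s≤s (s≤s (s≤s (s≤s (s≤s ())))))))))) }
      where
      5≢1 : 5 ≢ 1
      5≢1 ()
      2≢1 : 2 ≢ 1
      2≢1 ()

  family₅ : ∀ e γ B → + B ≡ Lℤ.B (+ 5) (+ 1) (+ e) (+ γ) → Σ ConvexPolygon (Realises 10 (suc e) (2 ℕ.+ B))
  family₅ zero    zero    B B≡ = Family₅.realise 0 0 B B≡ (base ∷ [])
    λ {Q} _ t x y h → h 1F , no-elbow-no-shoulder (+ 5) (+ 1) Q t x y (h 2F) , h 0F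
  family₅ zero    (suc γ) B B≡ = Family₅.realise 0 (suc γ) B B≡ (base ∷ shoulder ∷ [])
    λ {Q} _ t x y h → h 1F , no-elbow (+ 5) (+ 1) (+ suc γ) Q t x y (h 2F) (h 3F) , h 0F
  family₅ (suc e) zero    B B≡ = Family₅.realise (suc e) 0 B B≡ (base ∷ elbow ∷ [])
    λ {Q} _ t x y h → h 1F , no-shoulder (+ 5) (+ 1) (+ suc e) Q t x y (h 2F) (h 3F) , h 0F
  family₅ (suc e) (suc γ) B B≡ = Family₅.realise (suc e) (suc γ) B B≡ (base ∷ elbow ∷ shoulder ∷ [])
    λ _ t x y h → h 1F , (h 2F , h 3F , h 4F) , h 0F

  -- All three bounds read b ≤ k i + m + 3, with m + 3 equal to 5, 4 and 4; γ is the difference of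
  -- the two sides.
  slack : ∀ k m e B → 2 ℕ.+ B ℕ.≤ k ℕ.* suc e ℕ.+ (m ℕ.+ 3) → Σ ℕ λ γ → + B ≡ Lℤ.B (+ k) (+ m) (+ e) (+ γ)
  slack k m e B b≤ = γ , (begin
    + B                                                                   ≡⟨ isolate (+ B) (+ γ) ⟩
    + 2 + + B + + γ - + γ - + 2                                           ≡⟨ cong (λ n → + n - + γ - + 2) (ℕ.m+[n∸m]≡n b≤) ⟩
    + (k ℕ.* suc e) + (+ m + + 3) - + γ - + 2                             ≡⟨ cong (λ z → z + (+ m + + 3) - + γ - + 2) (ℤ.pos-* k (suc e)) ⟩
    + k * (1ℤ + + e) + (+ m + + 3) - + γ - + 2                            ≡⟨ regroup (+ k * (1ℤ + + e)) (+ m) (+ γ) ⟩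
    + k * (1ℤ + + e) + + m + 1ℤ - + γ                                     ∎)
    where
    open ≡-Reasoning
    γ = k ℕ.* suc e ℕ.+ (m ℕ.+ 3) ∸ (2 ℕ.+ B)
    isolate : ∀ b g → b ≡ + 2 + b + g - g - + 2
    isolate = solve-∀
    regroup : ∀ p m g → p + (m + + 3) - g - + 2 ≡ p + m + 1ℤ - g
    regroup = solve-∀

  realise₃ : ∀ e B → 2 ℕ.+ B ℕ.≤ 3 ℕ.* suc e ℕ.+ 5 → Σ ConvexPolygon (Realises 3 (suc e) (2 ℕ.+ B))
  realise₃ e B b≤ = let γ , B≡ = slack 3 2 e B b≤ in family₃ e γ B B≡

  realise₄ : ∀ e B → 2 ℕ.+ B ℕ.≤ 4 ℕ.* suc e ℕ.+ 4 → Σ ConvexPolygon (Realises 4 (suc e) (2 ℕ.+ B))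
  realise₄ e B b≤ = let γ , B≡ = slack 4 1 e B b≤ in family₄ e γ B B≡

  realise₁₀ : ∀ e B → 2 ℕ.+ B ℕ.≤ 5 ℕ.* suc e ℕ.+ 4 → Σ ConvexPolygon (Realises 10 (suc e) (2 ℕ.+ B))
  realise₁₀ e B b≤ = let γ , B≡ = slack 5 1 e B b≤ in family₅ e γ B B≡

open Construction using (realise₃; realise₄; realise₁₀)
open import Data.Nat using (ℕ; _+_; _*_; _≤_)

theorem7p2 : (i b : ℕ) → 1 ≤ i → 1 ≤ b →
    ((2 ≤ b → b ≤ 3 * i + 5 → Σ ConvexPolygon λ P →
    HasDenominator P 3 × Pseudointegral P × HasInteriorCount P i × HasBoundaryCount P b)
    × (2 ≤ b → b ≤ 4 * i + 4 → Σ ConvexPolygon λ P →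
    HasDenominator P 4 × Pseudointegral P × HasInteriorCount P i × HasBoundaryCount P b)
    × (2 ≤ b → b ≤ 5 * i + 4 → Σ ConvexPolygon λ P →
    HasDenominator P 10 × Pseudointegral P × HasInteriorCount P i × HasBoundaryCount P b))
theorem7p2 (suc e) (suc zero) _ _ = (λ { (s≤s ()) _ }) , (λ { (s≤s ()) _ }) , (λ { (s≤s ()) _ })
theorem7p2 (suc e) (suc (suc B)) _ _ = (λ _ → realise₃ e B) , (λ _ → realise₄ e B) , (λ _ → realise₁₀ e B)
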